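{- Let $k\ge 1$ be an integer. For $n\ge 1$, let $p_{n,k}$ denote the probability that an arbitrary face of a uniformly random rooted plane curve with $n$ vertices has degree $k$; equivalently, $(n+2)p_{n,k}$ is the expected number of faces of degree $k$ in a uniformly random rooted plane curve with $n$ vertices. Then \[ 1>\limsup_{n\to\infty}p_{n,k}\ \ge\ \liminf_{n\to\infty}p_{n,k}>0. \]
   Context: A rooted plane curve with $n\ge 1$ vertices is given by a set $F$ of $4n$ flags and permutations $\sigma,\tau$ of $F$ such that: $\sigma$ is a product of $n$ disjoint $4$-cycles (the vertices); $\tau$ is a fixed-point-free involution (the edges); $\langle\sigma,\tau\rangle$ acts transitively on $F$; $\sigma\tau$ has exactly $n+2$ cycles (so the map is planar; these cycles are the faces); and $\sigma^2\tau$ has exactly two cycles (the map is the image of a single immersed circle in the sphere). A root is a distinguished flag, and rooted objects are identified up to relabelings of flags conjugating $\sigma,\tau$ and preserving the root. The degree of a face is the length of the corresponding cycle of $\sigma\tau$. Equivalently, a plane curve is the 4-valent planar map obtained from a generic immersion of a circle in the sphere (a knot diagram with crossing information forgotten), considered up to orientation-preserving homeomorphism. -}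

module Defs where

open import Data.Nat using (ℕ; zero; suc; _+_; _*_; _≤ᵇ_; _≡ᵇ_)
open import Data.Bool using (Bool; true; false; _∧_; _∨_; not; if_then_else_)
open import Data.Fin using (Fin; toℕ)
open import Data.Fin.Properties using (_≟_)
open import Data.List using (List; []; _∷_; [_]; map; concatMap; length; allFin; upTo)
open import Data.Nat.ListAction using (sum)
open import Data.Bool.ListAction using (all; any)
open import Data.Vec using (Vec; lookup) renaming ([] to []v; _∷_ to _∷v_)
open import Data.Product using (_×_; _,_; proj₁; proj₂)
open import Data.Integer using (+_)
open import Data.Rational using (ℚ; _/_; 0ℚ)
open import Relation.Nullary.Decidable using (⌊_⌋)

filterᵇ : ∀ {A : Set} → (A → Bool) → List A → List A
filterᵇ p []       = []
filterᵇ p (x ∷ xs) = if p x then x ∷ filterᵇ p xs else filterᵇ p xs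

_==_ : ∀ {m} → Fin m → Fin m → Bool
x == y = ⌊ x ≟ y ⌋

iter : ∀ {A : Set} → ℕ → (A → A) → A → A
iter zero    f x = x
iter (suc i) f x = f (iter i f x)

allVecs : ∀ {A : Set} → List A → (k : ℕ) → List (Vec A k)
allVecs xs zero    = [ []v ]
allVecs xs (suc k) = concatMap (λ v → map (λ a → a ∷v v) xs) (allVecs xs k)

allMaps : (m : ℕ) → List (Fin m → Fin m)
allMaps m = map lookup (allVecs (allFin m) m)

allPairs : (m : ℕ) → List ((Fin m → Fin m) × (Fin m → Fin m))
allPairs m = concatMap (λ s → map (λ t → (s , t)) (allMaps m)) (allMaps m)

inCycle : ∀ {m} → (Fin m → Fin m) → Fin m → Fin m → Bool
inCycle {m} π x y = any (λ i → iter i π x == y) (upTo m)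

cycleLength : ∀ {m} → (Fin m → Fin m) → Fin m → ℕ
cycleLength {m} π x = length (filterᵇ (λ y → inCycle π x y) (allFin m))

isCycleRep : ∀ {m} → (Fin m → Fin m) → Fin m → Bool
isCycleRep {m} π x = all (λ i → toℕ x ≤ᵇ toℕ (iter i π x)) (upTo m)

numCycles : ∀ {m} → (Fin m → Fin m) → ℕ
numCycles {m} π = length (filterᵇ (isCycleRep π) (allFin m))

numCyclesOfLength : ∀ {m} → ℕ → (Fin m → Fin m) → ℕ
numCyclesOfLength {m} k π =
  length (filterᵇ (λ x → isCycleRep π x ∧ (cycleLength π x ≡ᵇ k)) (allFin m))

isFourCycles : ∀ {m} → (Fin m → Fin m) → Bool
isFourCycles {m} σ =
  all (λ x → (iter 4 σ x == x) ∧ not (σ x == x) ∧ not (iter 2 σ x == x)) (allFin m)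

isFPFInvolution : ∀ {m} → (Fin m → Fin m) → Bool
isFPFInvolution {m} τ = all (λ x → (τ (τ x) == x) ∧ not (τ x == x)) (allFin m)

reach : ∀ {m} → (Fin m → Fin m) → (Fin m → Fin m) → ℕ → Fin m → Fin m → Bool
reach σ τ zero    x y = x == y
reach σ τ (suc j) x y = reach σ τ j x y ∨ reach σ τ j (σ x) y ∨ reach σ τ j (τ x) y

-- ⟨σ,τ⟩ acts transitively on Fin m (σ, τ being permutations of a finite
-- set, the group orbit equals the set reachable by positive words,
-- and words of length < m suffice)
isTransitive : ∀ {m} → (Fin m → Fin m) → (Fin m → Fin m) → Bool
isTransitive {m} σ τ = all (λ x → all (λ y → reach σ τ m x y) (allFin m)) (allFin m)

-- faces: cycles of στ (apply τ first, then σ)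
στ : ∀ {m} → (Fin m → Fin m) → (Fin m → Fin m) → Fin m → Fin m
στ σ τ x = σ (τ x)

isPlaneCurve : (n : ℕ) → (Fin (4 * n) → Fin (4 * n)) × (Fin (4 * n) → Fin (4 * n)) → Bool
isPlaneCurve n (σ , τ) =
  isFourCycles σ ∧ isFPFInvolution τ ∧ isTransitive σ τ
  ∧ (numCycles (στ σ τ) ≡ᵇ (n + 2))
  ∧ (numCycles (λ x → σ (σ (τ x))) ≡ᵇ 2)

-- all labelled plane curves with n vertices on the flag set Fin (4n).
-- Rooting at flag 0, each rooted plane curve corresponds to exactly
-- (4n-1)! labelled ones (transitivity ⇒ no nontrivial root-preserving
-- automorphism), so the uniform distribution on this list induces the
-- uniform distribution on rooted plane curves.
labelledCurves : (n : ℕ) → List ((Fin (4 * n) → Fin (4 * n)) × (Fin (4 * n) → Fin (4 * n)))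
labelledCurves n = filterᵇ (isPlaneCurve n) (allPairs (4 * n))

curveCount : ℕ → ℕ
curveCount n = length (labelledCurves n)

degreeKFaceTotal : ℕ → ℕ → ℕ
degreeKFaceTotal n k =
  sum (map (λ p → numCyclesOfLength k (στ (proj₁ p) (proj₂ p))) (labelledCurves n))

-- p_{n,k} = E[#faces of degree k] / (n+2)
--        = degreeKFaceTotal n k / ((n + 2) * curveCount n).
-- (The denominator is positive for n ≥ 1; the 0 branch is never used then.)
pnk : ℕ → ℕ → ℚ
pnk n k with (n + 2) * curveCount n
... | zero  = 0ℚ
... | suc d = (+ degreeKFaceTotal n k) / suc d

{-# OPTIONS --safe #-}
module Submission where

open import Defs
open import Data.Nat using (ℕ; zero; suc; _+_; _*_; _∸_; _^_; _≤_; _<_; _≥_; z≤n; s≤s; _≤ᵇ_; _≡ᵇ_; _≤?_; nonZero)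
open import Data.Nat.Properties hiding (_≟_)
open import Data.Nat.DivMod using (_%_; _/_; m≡m%n+[m/n]*n; m%n<n)
open import Data.Nat.Induction using (<-wellFounded)
open import Data.Nat.ListAction using (sum)
open import Data.Nat.ListAction.Properties using (sum-++)
open import Data.Nat.Solver using (module +-*-Solver)
open import Data.Bool using (Bool; true; false; T; _∧_; _∨_; not)
open import Data.Bool.ListAction using (all; any)
import Data.Bool.Properties as Bool
open import Data.Empty using (⊥; ⊥-elim)
open import Data.Unit using (tt)
open import Data.Fin using (Fin; zero; suc; toℕ; punchIn; punchOut)
import Data.Fin.Properties as Fin
open import Data.Fin.Properties using (_≟_; punchIn-injective; punchInᵢ≢i; punchOut-injective; punchIn-punchOut; punchOut-punchIn; punchOut-cong; toℕ-injective; toℕ<n)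
import Data.Integer as ℤ
open import Data.Integer using (+≤+)
import Data.Integer.Properties as ℤₚ
import Data.List as List
open import Data.List using (List; []; _∷_; map; concatMap; length; allFin; upTo; _++_)
open import Data.List.Properties using (length-map; length-++; length-tabulate; map-++; map-∘; map-cong; map-concatMap; concatMap-map; concatMap-cong)
open import Data.List.Membership.Propositional using (_∈_; _∉_)
open import Data.List.Membership.Propositional.Properties using (∈-map⁺; ∈-map⁻; ∈-∃++; ∈-++⁺ˡ; ∈-++⁺ʳ; ∈-++⁻; ∈-allFin; ∈-upTo⁺; ∈-lookup)
import Data.List.Relation.Unary.All as All
open import Data.List.Relation.Unary.All using (All; []; _∷_)
open import Data.List.Relation.Unary.AllPairs using ([]; _∷_)
import Data.List.Relation.Unary.Any as Any
open import Data.List.Relation.Unary.Any using (here; there)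
open import Data.List.Relation.Unary.Any.Properties using (lookup-index)
open import Data.List.Relation.Unary.Unique.Propositional using (Unique)
import Data.List.Relation.Unary.Unique.Propositional.Properties as Uniq
open import Data.List.Relation.Unary.Unique.Propositional.Properties using (allFin⁺)
open import Data.Product using (_×_; _,_; proj₁; proj₂; ∃; ∃-syntax; ∃₂)
import Data.Rational as ℚ
open import Data.Rational using (ℚ; 0ℚ; 1ℚ; fromℚᵘ)
import Data.Rational.Properties as ℚₚ
import Data.Rational.Unnormalised as ℚᵘ
open import Data.Rational.Unnormalised using (mkℚᵘ; *≤*)
import Data.Rational.Unnormalised.Properties as ℚᵘₚ
import Data.Sum as Sum
open import Data.Sum using (_⊎_; inj₁; inj₂; [_,_]′)
import Data.Sum.Properties as Sumₚ
open import Data.Sum.Properties using (inj₁-injective; inj₂-injective)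
open import Data.Vec using (Vec; lookup; tabulate) renaming ([] to []v; _∷_ to _∷v_)
open import Data.Vec.Properties using (lookup∘tabulate; tabulate∘lookup; tabulate-cong)
open import Function using (_∘_; id; case_of_)
open import Induction.WellFounded using (Acc; acc)
open import Relation.Binary.Definitions using (DecidableEquality; tri<; tri≈; tri>)
open import Relation.Binary.PropositionalEquality using (_≡_; _≢_; _≗_; refl; sym; trans; cong; cong₂; subst; subst₂; module ≡-Reasoning)
open import Relation.Nullary using (¬_; Dec; yes; no)
open import Relation.Nullary.Decidable using (⌊_⌋; _⊎-dec_)

-- Write L(n) for the number of labelled curves with n crossings and R(n) = (4n+1)(4n+2)(4n+3)(4n+4) for the
-- number of ways to label a new crossing.
--
-- Inserting a curl at any of the 4n flags, and then further curls along the boundary of the new monogon, is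
-- injective and creates a face of degree k, so the curves with n + k crossings have in total at least
-- 4n L(n) R(n) ⋯ R(n+k-1) / k faces of degree k. It remains to bound the growth: 4(n+1) L(n+1) ≤ K · 4n L(n) R(n).
--
-- A crossing is removed by the smoothing that keeps the curve in one piece. Euler's inequality shows that the
-- result is planar. The smoothing is undone with boundedly many choices if the two strands it produces are
-- joined by a short walk, which is the case at a corner of a face of degree at most 47 where the orientations of the
-- two edges are coherent. If such corners are rare, a discharging argument shows that most crossings lie
-- between two bigons with alternating boundary; there three crossings in a row can be replaced by one. So every
-- curve has linearly many reducible places, and the bound on the growth follows by double counting.
--
-- The upper bound for degree k follows from the lower bound for degree k + 1, since the proportions add up to 1.

-- Counting with lists

-- The obstacle to the growth bound is the number of ways to undo a removal. A crossing is put back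
-- on two strands, so an arbitrary removal has quadratically many inverses, while the bound leaves
-- room for one free corner of the smaller curve times a constant. The second strand must be
-- recovered from the first. Of the two smoothings of a crossing, the one that joins outgoing ends
-- to outgoing ends keeps the curve in one piece, and it opens exactly the corners through which the
-- orientation passes coherently. The face at such a corner borders both new strands, so if it is
-- short, its boundary is a short walk between them. At an alternating corner the smoothing would
-- split the curve. At a bigon, however, the position of the second strand is forced whatever the
-- orientation, and two such smoothings along a row of three crossings give a single curve again,
-- since two half twists leave the outer ends joined as they were. All counts concern labelled
-- curves. Curls and reductions involve the same number of labellings of the new crossing, so these
-- factors cancel when the two estimates are combined.

∈-filterᵇ⁺ : ∀ {A : Set} (p : A → Bool) {x xs} → x ∈ xs → p x ≡ true → x ∈ filterᵇ p xs
∈-filterᵇ⁺ p {xs = y ∷ ys} (here refl) px rewrite px = here refl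
∈-filterᵇ⁺ p {xs = y ∷ ys} (there i) px with p y
... | true  = there (∈-filterᵇ⁺ p i px)
... | false = ∈-filterᵇ⁺ p i px

∈-filterᵇ⁻ : ∀ {A : Set} (p : A → Bool) {x} xs → x ∈ filterᵇ p xs → x ∈ xs × p x ≡ true
∈-filterᵇ⁻ p (y ∷ ys) i with p y in eq
∈-filterᵇ⁻ p (y ∷ ys) (here refl) | true = here refl , eq
∈-filterᵇ⁻ p (y ∷ ys) (there i)   | true with ∈-filterᵇ⁻ p ys i
... | j , px = there j , px
∈-filterᵇ⁻ p (y ∷ ys) i | false with ∈-filterᵇ⁻ p ys i
... | j , px = there j , px

∉⇒All≢ : ∀ {A : Set} {x : A} xs → x ∉ xs → All (x ≢_) xs
∉⇒All≢ xs x∉ = All.tabulate λ i eq → x∉ (subst (_∈ xs) (sym eq) i)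

All≢⇒∉ : ∀ {A : Set} {x : A} {xs} → All (x ≢_) xs → x ∉ xs
All≢⇒∉ al i = All.lookup al i refl

filterᵇ-unique : ∀ {A : Set} (p : A → Bool) {xs} → Unique xs → Unique (filterᵇ p xs)
filterᵇ-unique p {[]} _ = []
filterᵇ-unique p {x ∷ xs} (al ∷ u) with p x
... | true  = ∉⇒All≢ _ (λ i → All≢⇒∉ al (proj₁ (∈-filterᵇ⁻ p xs i))) ∷ filterᵇ-unique p u
... | false = filterᵇ-unique p u

sum-⊆ : ∀ {A : Set} (w : A → ℕ) {xs ys} → Unique xs → (∀ {x} → x ∈ xs → x ∈ ys) →
        sum (map w xs) ≤ sum (map w ys)
sum-⊆ w {[]} _ _ = z≤n
sum-⊆ w {x ∷ xs} (al ∷ u) sub with ∈-∃++ (sub (here refl))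
... | as , bs , refl = begin
  w x + sum (map w xs)                          ≤⟨ +-monoʳ-≤ (w x) (sum-⊆ w u sub′) ⟩
  w x + sum (map w (as ++ bs))                  ≡⟨ cong (λ z → w x + sum z) (map-++ w as bs) ⟩
  w x + sum (map w as ++ map w bs)              ≡⟨ cong (w x +_) (sum-++ (map w as) _) ⟩
  w x + (sum (map w as) + sum (map w bs))       ≡⟨ +-assoc (w x) (sum (map w as)) _ ⟨
  (w x + sum (map w as)) + sum (map w bs)       ≡⟨ cong (_+ sum (map w bs)) (+-comm (w x) _) ⟩
  (sum (map w as) + w x) + sum (map w bs)       ≡⟨ +-assoc (sum (map w as)) (w x) _ ⟩
  sum (map w as) + (w x + sum (map w bs))       ≡⟨ sum-++ (map w as) _ ⟨
  sum (map w as ++ map w (x ∷ bs))              ≡⟨ cong sum (map-++ w as (x ∷ bs)) ⟨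
  sum (map w (as ++ x ∷ bs))                    ∎
  where
  open ≤-Reasoning
  sub′ : ∀ {y} → y ∈ xs → y ∈ as ++ bs
  sub′ {y} i with ∈-++⁻ as (sub (there i))
  ... | inj₁ j         = ∈-++⁺ˡ j
  ... | inj₂ (here eq) = ⊥-elim (All≢⇒∉ al (subst (_∈ xs) eq i))
  ... | inj₂ (there j) = ∈-++⁺ʳ as j

sum-ones : ∀ {A : Set} (xs : List A) → sum (map (λ _ → 1) xs) ≡ length xs
sum-ones []       = refl
sum-ones (_ ∷ xs) = cong suc (sum-ones xs)

length-⊆ : ∀ {A : Set} {xs ys : List A} → Unique xs → (∀ {x} → x ∈ xs → x ∈ ys) → length xs ≤ length ys
length-⊆ {xs = xs} {ys} u sub =
  subst₂ _≤_ (sum-ones xs) (sum-ones ys) (sum-⊆ (λ _ → 1) u sub)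

map-unique : ∀ {A B : Set} (f : A → B) {xs} → Unique xs →
             (∀ {x y} → x ∈ xs → y ∈ xs → f x ≡ f y → x ≡ y) → Unique (map f xs)
map-unique f {[]} _ _ = []
map-unique f {x ∷ xs} (al ∷ u) inj =
  ∉⇒All≢ _ (λ i → let (y , j , eq) = ∈-map⁻ f i
                  in All≢⇒∉ al (subst (_∈ xs) (sym (inj (here refl) (there j) eq)) j))
  ∷ map-unique f u (λ i j → inj (there i) (there j))

length-injection : ∀ {A B : Set} (f : A → B) {xs ys} → Unique xs →
                   (∀ {x} → x ∈ xs → f x ∈ ys) →
                   (∀ {x y} → x ∈ xs → y ∈ xs → f x ≡ f y → x ≡ y) → length xs ≤ length ys
length-injection f {xs} {ys} u into inj =
  subst (_≤ length ys) (length-map f xs)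
    (length-⊆ (map-unique f u inj) λ i → let (x , j , eq) = ∈-map⁻ f i in subst (_∈ ys) (sym eq) (into j))

length-surjection : ∀ {A B : Set} (g : B → A) {xs ys} → Unique xs →
                    (∀ {x} → x ∈ xs → ∃ λ y → y ∈ ys × g y ≡ x) → length xs ≤ length ys
length-surjection g {xs} {ys} u onto =
  subst (length xs ≤_) (length-map g ys)
    (length-⊆ u λ i → let (y , j , eq) = onto i in subst (_∈ map g ys) eq (∈-map⁺ g j))

-- The second list runs in the outer loop, as in `allVecs`: `allVecs xs (suc k)` unfolds to a
-- `grid _∷v_`, so facts about grids apply to it directly.
grid : ∀ {A B C : Set} → (A → B → C) → List A → List B → List C
grid f xs ys = concatMap (λ y → map (λ x → f x y) xs) ys

∈-grid⁺ : ∀ {A B C : Set} (f : A → B → C) {xs ys x y} → x ∈ xs → y ∈ ys → f x y ∈ grid f xs ys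
∈-grid⁺ f {xs} i (here refl) = ∈-++⁺ˡ (∈-map⁺ _ i)
∈-grid⁺ f {xs} i (there {x = z} j) = ∈-++⁺ʳ (map (λ x → f x z) xs) (∈-grid⁺ f i j)

∈-grid⁻ : ∀ {A B C : Set} (f : A → B → C) xs ys {c} → c ∈ grid f xs ys →
          ∃₂ λ x y → x ∈ xs × y ∈ ys × c ≡ f x y
∈-grid⁻ f xs (y ∷ ys) i with ∈-++⁻ (map (λ x → f x y) xs) i
... | inj₁ j = let (x , k , eq) = ∈-map⁻ _ j in x , y , k , here refl , eq
... | inj₂ j = let (x , z , k , l , eq) = ∈-grid⁻ f xs ys j in x , z , k , there l , eq

grid-unique : ∀ {A B C : Set} (f : A → B → C) {xs ys} →
              (∀ {a b c d} → f a b ≡ f c d → a ≡ c × b ≡ d) →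
              Unique xs → Unique ys → Unique (grid f xs ys)
grid-unique f {xs} {[]} inj u _ = []
grid-unique f {xs} {y ∷ ys} inj u (al ∷ v) =
  Uniq.++⁺ (map-unique _ u (λ _ _ eq → proj₁ (inj eq))) (grid-unique f inj u v)
    λ (i , j) → let (x , _ , eq) = ∈-map⁻ _ i
                    (_ , z , _ , l , eq′) = ∈-grid⁻ f xs ys j
                in All≢⇒∉ al (subst (_∈ ys) (sym (proj₂ (inj (trans (sym eq) eq′)))) l)

length-grid : ∀ {A B C : Set} (f : A → B → C) xs ys → length (grid f xs ys) ≡ length ys * length xs
length-grid f xs []       = refl
length-grid f xs (y ∷ ys) =
  trans (length-++ (map (λ x → f x y) xs)) (cong₂ _+_ (length-map _ xs) (length-grid f xs ys))

pairs : ∀ {A B : Set} → List A → List B → List (A × B)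
pairs = λ xs ys → grid (λ y x → x , y) ys xs

length-pairs : ∀ {A B : Set} (xs : List A) (ys : List B) → length (pairs xs ys) ≡ length xs * length ys
length-pairs xs ys = length-grid _ ys xs

∈-pairs⁺ : ∀ {A B : Set} {xs : List A} {ys : List B} {x y} → x ∈ xs → y ∈ ys → (x , y) ∈ pairs xs ys
∈-pairs⁺ i j = ∈-grid⁺ _ j i

∈-pairs⁻ : ∀ {A B : Set} (xs : List A) (ys : List B) {x y} → (x , y) ∈ pairs xs ys → x ∈ xs × y ∈ ys
∈-pairs⁻ xs ys i with ∈-grid⁻ _ ys xs i
... | _ , _ , j , k , refl = k , j

pairs-unique : ∀ {A B : Set} {xs : List A} {ys : List B} → Unique xs → Unique ys → Unique (pairs xs ys)
pairs-unique u v = grid-unique _ (λ { refl → refl , refl }) v u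

fibres : ∀ {A B : Set} → (A → B → Bool) → List A → List B → List (A × B)
fibres p xs ys = filterᵇ (λ (x , y) → p x y) (pairs xs ys)

filterᵇ-++ : ∀ {A : Set} (p : A → Bool) xs ys → filterᵇ p (xs ++ ys) ≡ filterᵇ p xs ++ filterᵇ p ys
filterᵇ-++ p []       ys = refl
filterᵇ-++ p (x ∷ xs) ys with p x
... | true  = cong (x ∷_) (filterᵇ-++ p xs ys)
... | false = filterᵇ-++ p xs ys

filterᵇ-map : ∀ {A B : Set} (p : B → Bool) (f : A → B) xs → filterᵇ p (map f xs) ≡ map f (filterᵇ (p ∘ f) xs)
filterᵇ-map p f []       = refl
filterᵇ-map p f (x ∷ xs) with p (f x)
... | true  = cong (f x ∷_) (filterᵇ-map p f xs)
... | false = filterᵇ-map p f xs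

length-fibres : ∀ {A B : Set} (p : A → B → Bool) xs ys →
                length (fibres p xs ys) ≡ sum (map (λ x → length (filterᵇ (p x) ys)) xs)
length-fibres p []       ys = refl
length-fibres p (x ∷ xs) ys =
  trans (cong length (filterᵇ-++ _ (map (x ,_) ys) _))
  (trans (length-++ (filterᵇ _ (map (x ,_) ys)))
  (cong₂ _+_ (trans (cong length (filterᵇ-map _ (x ,_) ys)) (length-map _ (filterᵇ (p x) ys)))
             (length-fibres p xs ys)))

sum-mono : ∀ {A : Set} (v w : A → ℕ) xs → (∀ {x} → x ∈ xs → v x ≤ w x) → sum (map v xs) ≤ sum (map w xs)
sum-mono v w []       _  = z≤n
sum-mono v w (x ∷ xs) le = +-mono-≤ (le (here refl)) (sum-mono v w xs (le ∘ there))

sum-+ : ∀ {A : Set} (v w : A → ℕ) xs → sum (map (λ x → v x + w x) xs) ≡ sum (map v xs) + sum (map w xs)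
sum-+ v w []       = refl
sum-+ v w (x ∷ xs) rewrite sum-+ v w xs = interchange (v x) (w x) (sum (map v xs)) (sum (map w xs))
  where
  interchange : ∀ a b c d → (a + b) + (c + d) ≡ (a + c) + (b + d)
  interchange a b c d = trans (+-assoc a b _) (trans (cong (a +_) (trans (sym (+-assoc b c d))
    (trans (cong (_+ d) (+-comm b c)) (+-assoc c b d)))) (sym (+-assoc a c _)))

sum-* : ∀ {A : Set} c (v : A → ℕ) xs → sum (map (λ x → c * v x) xs) ≡ c * sum (map v xs)
sum-* c v []       = sym (*-zeroʳ c)
sum-* c v (x ∷ xs) rewrite sum-* c v xs = sym (*-distribˡ-+ c (v x) _)

sum-const : ∀ {A : Set} c (xs : List A) → sum (map (λ _ → c) xs) ≡ length xs * c
sum-const c []       = refl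
sum-const c (_ ∷ xs) = cong (c +_) (sum-const c xs)

indicator : Bool → ℕ
indicator true  = 1
indicator false = 0

sum-indicator : ∀ {A : Set} (p : A → Bool) xs → sum (map (indicator ∘ p) xs) ≡ length (filterᵇ p xs)
sum-indicator p []       = refl
sum-indicator p (x ∷ xs) with p x
... | true  = cong suc (sum-indicator p xs)
... | false = sum-indicator p xs

length-concatMap : ∀ {A B : Set} (f : A → List B) xs → length (concatMap f xs) ≡ sum (map (length ∘ f) xs)
length-concatMap f []       = refl
length-concatMap f (x ∷ xs) = trans (length-++ (f x)) (cong (length (f x) +_) (length-concatMap f xs))

sum-concatMap : ∀ {A B : Set} (w : B → ℕ) (f : A → List B) xs →
                sum (map w (concatMap f xs)) ≡ sum (map (λ x → sum (map w (f x))) xs)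
sum-concatMap w f []       = refl
sum-concatMap w f (x ∷ xs) = trans (cong sum (map-++ w (f x) _))
  (trans (sum-++ (map w (f x)) _) (cong (sum (map w (f x)) +_) (sum-concatMap w f xs)))

∈-concatMap : ∀ {A B : Set} (f : A → List B) {x xs y} → x ∈ xs → y ∈ f x → y ∈ concatMap f xs
∈-concatMap f (here refl) j = ∈-++⁺ˡ j
∈-concatMap f (there {x = z} i) j = ∈-++⁺ʳ (f z) (∈-concatMap f i j)

∈-concatMap⁻ : ∀ {A B : Set} (f : A → List B) xs {y} → y ∈ concatMap f xs → ∃ λ x → x ∈ xs × y ∈ f x
∈-concatMap⁻ f (x ∷ xs) i with ∈-++⁻ (f x) i
... | inj₁ j = x , here refl , j
... | inj₂ j = let (z , k , l) = ∈-concatMap⁻ f xs j in z , there k , l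

concatMap-unique : ∀ {A B : Set} (f : A → List B) {xs} → Unique xs → (∀ x → Unique (f x)) →
                   (∀ {x x′ y} → x ∈ xs → x′ ∈ xs → y ∈ f x → y ∈ f x′ → x ≡ x′) → Unique (concatMap f xs)
concatMap-unique f {[]} _ _ _ = []
concatMap-unique f {x ∷ xs} (al ∷ u) uf disj =
  Uniq.++⁺ (uf x) (concatMap-unique f u uf λ i j → disj (there i) (there j))
    λ (i , j) → let (z , k , l) = ∈-concatMap⁻ f xs j
                in All≢⇒∉ al (subst (_∈ xs) (sym (disj (here refl) (there k) i l)) k)

-- Codes of pairs of self-maps of Fin m

∈-allVecs : ∀ {A : Set} {xs : List A} → (∀ a → a ∈ xs) → ∀ {k} (v : Vec A k) → v ∈ allVecs xs k
∈-allVecs full []v      = here refl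
∈-allVecs full (a ∷v v) = ∈-grid⁺ _∷v_ (full a) (∈-allVecs full v)

allVecs-unique : ∀ {A : Set} {xs : List A} → Unique xs → ∀ k → Unique (allVecs xs k)
allVecs-unique u zero    = [] ∷ []
allVecs-unique u (suc k) = grid-unique _∷v_ (λ { refl → refl , refl }) u (allVecs-unique u k)

-- Without function extensionality, equality of self-maps is too fine for membership and uniqueness
-- in lists. Vectors with the same entries are equal, so the counting is done with them.
Code : ℕ → Set
Code m = Vec (Fin m) m × Vec (Fin m) m

Maps : ℕ → Set
Maps m = (Fin m → Fin m) × (Fin m → Fin m)

decode : ∀ {m} → Code m → Maps m
decode (v , w) = lookup v , lookup w

encode : ∀ {m} → Maps m → Code m
encode (f , g) = tabulate f , tabulate g

vecs : (m : ℕ) → List (Vec (Fin m) m)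
vecs m = allVecs (allFin m) m

codes : (m : ℕ) → List (Code m)
codes m = pairs (vecs m) (vecs m)

∈-codes : ∀ {m} (c : Code m) → c ∈ codes m
∈-codes (v , w) = ∈-pairs⁺ (∈-allVecs ∈-allFin v) (∈-allVecs ∈-allFin w)

codes-unique : ∀ m → Unique (codes m)
codes-unique m = pairs-unique u u where u = allVecs-unique (allFin⁺ m) m

allPairs-codes : ∀ m → allPairs m ≡ map decode (codes m)
allPairs-codes m = sym (trans (map-concatMap decode _ (vecs m))
  (trans (concatMap-cong (λ v → trans (sym (map-∘ (vecs m))) (map-∘ (vecs m))) (vecs m))
         (sym (concatMap-map (λ s → map (s ,_) (allMaps m)) lookup (vecs m)))))

lookup-ext : ∀ {A : Set} {m} (v w : Vec A m) → lookup v ≗ lookup w → v ≡ w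
lookup-ext v w eq = trans (sym (tabulate∘lookup v)) (trans (tabulate-cong eq) (tabulate∘lookup w))

encode-decode : ∀ {m} (f g : Fin m → Fin m) (c : Code m) →
                f ≗ proj₁ (decode c) → g ≗ proj₂ (decode c) → encode (f , g) ≡ c
encode-decode f g (v , w) p q =
  cong₂ _,_ (trans (tabulate-cong p) (tabulate∘lookup v)) (trans (tabulate-cong q) (tabulate∘lookup w))

-- Boolean reflection

true≢false : true ≢ false
true≢false ()

∧-true⁻ : ∀ {a b} → a ∧ b ≡ true → a ≡ true × b ≡ true
∧-true⁻ {true} eq = refl , eq

∧-true⁺ : ∀ {a b} → a ≡ true → b ≡ true → a ∧ b ≡ true
∧-true⁺ refl refl = refl

not-true⁻ : ∀ {a} → not a ≡ true → a ≡ false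
not-true⁻ {false} _ = refl

not-injective : ∀ {a b} → not a ≡ not b → a ≡ b
not-injective {true}  {true}  _ = refl
not-injective {false} {false} _ = refl

≢true⇒≡false : ∀ {b} → b ≢ true → b ≡ false
≢true⇒≡false {true}  ne = ⊥-elim (ne refl)
≢true⇒≡false {false} _  = refl

==⇒≡ : ∀ {m} {x y : Fin m} → (x == y) ≡ true → x ≡ y
==⇒≡ {x = x} {y} eq with x ≟ y
... | yes p = p

≡⇒== : ∀ {m} {x y : Fin m} → x ≡ y → (x == y) ≡ true
≡⇒== {x = x} {y} eq with x ≟ y
... | yes _ = refl
... | no ne = ⊥-elim (ne eq)

≢⇒==false : ∀ {m} {x y : Fin m} → x ≢ y → (x == y) ≡ false
≢⇒==false {x = x} {y} ne with x ≟ y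
... | yes p = ⊥-elim (ne p)
... | no _  = refl

==false⇒≢ : ∀ {m} {x y : Fin m} → (x == y) ≡ false → x ≢ y
==false⇒≢ eq p = true≢false (trans (sym (≡⇒== p)) eq)

all⁻ : ∀ {A : Set} (p : A → Bool) {xs x} → all p xs ≡ true → x ∈ xs → p x ≡ true
all⁻ p {y ∷ ys} eq (here refl) = proj₁ (∧-true⁻ eq)
all⁻ p {y ∷ ys} eq (there i)   = all⁻ p (proj₂ (∧-true⁻ {p y} eq)) i

all⁺ : ∀ {A : Set} (p : A → Bool) xs → (∀ {x} → x ∈ xs → p x ≡ true) → all p xs ≡ true
all⁺ p []       _ = refl
all⁺ p (x ∷ xs) f = ∧-true⁺ (f (here refl)) (all⁺ p xs (f ∘ there))

any⁺ : ∀ {A : Set} (p : A → Bool) {xs x} → x ∈ xs → p x ≡ true → any p xs ≡ true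
any⁺ p (here refl) px rewrite px = refl
any⁺ p {y ∷ ys} (there i) px with p y
... | true  = refl
... | false = any⁺ p i px

any⁻ : ∀ {A : Set} (p : A → Bool) xs → any p xs ≡ true → ∃ λ x → x ∈ xs × p x ≡ true
any⁻ p (x ∷ xs) eq with p x in px
... | true  = x , here refl , px
... | false = let (y , i , py) = any⁻ p xs eq in y , there i , py

all-false : ∀ {A : Set} (p : A → Bool) xs → all p xs ≡ false → ∃ λ x → x ∈ xs × p x ≡ false
all-false p (x ∷ xs) eq with p x in px
... | false = x , here refl , px
... | true  = let (y , i , py) = all-false p xs eq in y , there i , py

≤ᵇ-true⁻ : ∀ {a b} → (a ≤ᵇ b) ≡ true → a ≤ b
≤ᵇ-true⁻ {a} {b} eq = ≤ᵇ⇒≤ a b (subst T (sym eq) tt)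

≤ᵇ-true⁺ : ∀ {a b} → a ≤ b → (a ≤ᵇ b) ≡ true
≤ᵇ-true⁺ {a} {b} le with a ≤ᵇ b | ≤⇒≤ᵇ le
... | true | _ = refl

≤ᵇ-false⁻ : ∀ {a b} → (a ≤ᵇ b) ≡ false → b < a
≤ᵇ-false⁻ eq = ≰⇒> λ le → true≢false (trans (sym (≤ᵇ-true⁺ le)) eq)

≡ᵇ-true⁻ : ∀ a b → (a ≡ᵇ b) ≡ true → a ≡ b
≡ᵇ-true⁻ a b eq = ≡ᵇ⇒≡ a b (subst T (sym eq) tt)

≡ᵇ-true⁺ : ∀ {a b} → a ≡ b → (a ≡ᵇ b) ≡ true
≡ᵇ-true⁺ {a} {b} e with a ≡ᵇ b | ≡⇒≡ᵇ a b e
... | true | _ = refl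

-- Orbits

Inj : {A B : Set} → (A → B) → Set
Inj f = ∀ {x y} → f x ≡ f y → x ≡ y

involutive⇒inj : ∀ {F : Set} {f : F → F} → (∀ x → f (f x) ≡ x) → Inj f
involutive⇒inj {f = f} inv {x} {y} eq = trans (sym (inv x)) (trans (cong f eq) (inv y))

Orb : {F : Set} → (F → F) → F → F → Set
Orb π x y = ∃ λ i → iter i π x ≡ y

iter-+ : ∀ {F : Set} (π : F → F) i j x → iter (i + j) π x ≡ iter i π (iter j π x)
iter-+ π zero    j x = refl
iter-+ π (suc i) j x = cong π (iter-+ π i j x)

iter-comm : ∀ {F : Set} (π : F → F) i x → iter i π (π x) ≡ π (iter i π x)
iter-comm π zero    x = refl
iter-comm π (suc i) x = cong π (iter-comm π i x)

iter-inj : ∀ {F : Set} {π : F → F} → Inj π → ∀ i → Inj (iter i π)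
iter-inj inj zero    eq = eq
iter-inj inj (suc i) eq = iter-inj inj i (inj eq)

orb-refl : ∀ {F : Set} {π : F → F} {x} → Orb π x x
orb-refl = 0 , refl

orb-step : ∀ {F : Set} {π : F → F} {x y} → Orb π x y → Orb π x (π y)
orb-step {π = π} (i , eq) = suc i , cong π eq

orb-trans : ∀ {F : Set} {π : F → F} {x y z} → Orb π x y → Orb π y z → Orb π x z
orb-trans {π = π} {x} (i , refl) (j , refl) = j + i , iter-+ π j i x

orb-map : ∀ {F F′ : Set} {π : F → F} {π′ : F′ → F′} (f : F → F′) →
          (∀ x → Orb π′ (f x) (f (π x))) → ∀ {x y} → Orb π x y → Orb π′ (f x) (f y)
orb-map f step (zero  , refl) = orb-refl
orb-map {π = π} f step {x} (suc i , refl) =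
  orb-trans (orb-map {π = π} f step {x} (i , refl)) (step (iter i π x))

orb-invariant : ∀ {F : Set} {π : F → F} (Q : F → Set) → (∀ {x} → Q x → Q (π x)) →
                ∀ {x y} → Q x → Orb π x y → Q y
orb-invariant Q step qx (zero  , refl) = qx
orb-invariant Q step qx (suc i , refl) = step (orb-invariant Q step qx (i , refl))

iter-period : ∀ {F : Set} (π : F → F) {x d} → iter d π x ≡ x → ∀ k → iter (k * d) π x ≡ x
iter-period π {x} {d} eq zero    = refl
iter-period π {x} {d} eq (suc k) = trans (iter-+ π d (k * d) x) (trans (cong (iter d π) (iter-period π eq k)) eq)

iter-mod : ∀ {F : Set} (π : F → F) {x d} → iter (suc d) π x ≡ x → ∀ i → iter i π x ≡ iter (i % suc d) π x
iter-mod π {x} {d} eq i = trans (cong (λ k → iter k π x) (m≡m%n+[m/n]*n i (suc d)))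
  (trans (iter-+ π (i % suc d) (i / suc d * suc d) x) (cong (iter (i % suc d) π) (iter-period π eq (i / suc d))))

module Cycles {m} {π : Fin m → Fin m} (inj : Inj π) where

  cancel : ∀ {x i j} → i < j → iter i π x ≡ iter j π x → iter (j ∸ i) π x ≡ x
  cancel {x} {i} {j} i<j eq = iter-inj inj i
    (trans (sym (iter-+ π i (j ∸ i) x)) (trans (cong (λ k → iter k π x) (m+[n∸m]≡n (<⇒≤ i<j))) (sym eq)))

  period : ∀ x → ∃ λ d → suc d ≤ m × iter (suc d) π x ≡ x
  period x with Fin.pigeonhole (n<1+n m) (λ (i : Fin (suc m)) → iter (toℕ i) π x)
  ... | i , j , i<j , eq with toℕ j ∸ toℕ i in e
  ... | zero  = ⊥-elim (<⇒≢ (m<n⇒0<n∸m i<j) (sym e))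
  ... | suc d = d , subst (_≤ m) e (≤-trans (m∸n≤m (toℕ j) (toℕ i)) (≤-pred (toℕ<n j)))
                  , subst (λ k → iter k π x ≡ x) e (cancel i<j eq)

  orb-bounded : ∀ {x y} → Orb π x y → ∃ λ i → i < m × iter i π x ≡ y
  orb-bounded {x} (i , eq) with period x
  ... | d , d<m , per = i % suc d , <-≤-trans (m%n<n i (suc d)) d<m , trans (sym (iter-mod π per i)) eq

  orb-back : ∀ x → Orb π (π x) x
  orb-back x with period x
  ... | d , _ , per = d , trans (iter-comm π d x) per

  orb-sym : ∀ {x y} → Orb π x y → Orb π y x
  orb-sym (zero  , refl) = orb-refl
  orb-sym {x} (suc i , refl) = orb-trans (orb-back _) (orb-sym (i , refl))

  inCycle⁺ : ∀ {x y} → Orb π x y → inCycle π x y ≡ true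
  inCycle⁺ o with orb-bounded o
  ... | i , i<m , eq = any⁺ _ (∈-upTo⁺ i<m) (≡⇒== eq)

  inCycle⁻ : ∀ {x y} → inCycle π x y ≡ true → Orb π x y
  inCycle⁻ eq with any⁻ _ (upTo m) eq
  ... | i , _ , p = i , ==⇒≡ p

  orb? : ∀ x y → Dec (Orb π x y)
  orb? x y with inCycle π x y in eq
  ... | true  = yes (inCycle⁻ eq)
  ... | false = no λ o → true≢false (trans (sym (inCycle⁺ o)) eq)

  rep-min : ∀ {x y} → isCycleRep π x ≡ true → Orb π x y → toℕ x ≤ toℕ y
  rep-min r o with orb-bounded o
  ... | i , i<m , refl = ≤ᵇ-true⁻ (all⁻ _ r (∈-upTo⁺ i<m))

  findRep : ∀ x → Acc _<_ (toℕ x) → ∃ λ r → isCycleRep π r ≡ true × Orb π x r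
  findRep x (acc rs) with isCycleRep π x in eq
  ... | true  = x , eq , orb-refl
  ... | false with all-false _ (upTo m) eq
  ...   | i , _ , f with findRep (iter i π x) (rs (≤ᵇ-false⁻ f))
  ...     | r , rr , o = r , rr , orb-trans (i , refl) o

  rep : Fin m → Fin m
  rep x = proj₁ (findRep x (<-wellFounded _))

  rep-isRep : ∀ x → isCycleRep π (rep x) ≡ true
  rep-isRep x = proj₁ (proj₂ (findRep x (<-wellFounded _)))

  rep-orb : ∀ x → Orb π x (rep x)
  rep-orb x = proj₂ (proj₂ (findRep x (<-wellFounded _)))

  rep-unique : ∀ {x y} → isCycleRep π x ≡ true → isCycleRep π y ≡ true → Orb π x y → x ≡ y
  rep-unique rx ry o = toℕ-injective (≤-antisym (rep-min rx o) (rep-min ry (orb-sym o)))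

reps : ∀ {m} → (Fin m → Fin m) → List (Fin m)
reps {m} π = filterᵇ (isCycleRep π) (allFin m)

∈-reps⁻ : ∀ {m} (π : Fin m → Fin m) {x} → x ∈ reps π → isCycleRep π x ≡ true
∈-reps⁻ {m} π i = proj₂ (∈-filterᵇ⁻ (isCycleRep π) (allFin m) i)

reps-unique : ∀ {m} (π : Fin m → Fin m) → Unique (reps π)
reps-unique {m} π = filterᵇ-unique _ (allFin⁺ m)

-- Only one direction is demanded: a class may carry several labels. Such a labelling bounds the
-- number of classes from above, and it can be pulled back along any map that reflects the relation.
-- Equalities of cycle numbers come from two such bounds.
record Covers {F : Set} (R : F → F → Set) (K : ℕ) : Set where
  constructor covers
  field
    label    : F → Fin K
    separate : ∀ {x y} → label x ≡ label y → R x y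

open Covers

length-allFin : ∀ n → length (allFin n) ≡ n
length-allFin n = length-tabulate id

lookup-unique : ∀ {A : Set} {xs : List A} → Unique xs → ∀ {i j} → List.lookup xs i ≡ List.lookup xs j → i ≡ j
lookup-unique {xs = x ∷ xs} (al ∷ u) {zero}  {zero}  _  = refl
lookup-unique {xs = x ∷ xs} (al ∷ u) {zero}  {suc j} eq = ⊥-elim (All≢⇒∉ al (subst (_∈ xs) (sym eq) (∈-lookup j)))
lookup-unique {xs = x ∷ xs} (al ∷ u) {suc i} {zero}  eq = ⊥-elim (All≢⇒∉ al (subst (_∈ xs) eq (∈-lookup i)))
lookup-unique {xs = x ∷ xs} (al ∷ u) {suc i} {suc j} eq = cong suc (lookup-unique u eq)

module Count {m} {π : Fin m → Fin m} (inj : Inj π) where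
  open Cycles inj

  numCycles≤ : ∀ {K} → Covers (Orb π) K → numCycles π ≤ K
  numCycles≤ {K} c = subst (numCycles π ≤_) (length-allFin K)
    (length-injection (label c) (reps-unique π) (λ _ → ∈-allFin _)
      λ i j eq → rep-unique (∈-reps⁻ π i) (∈-reps⁻ π j) (separate c eq))

  rep∈ : ∀ x → rep x ∈ reps π
  rep∈ x = ∈-filterᵇ⁺ _ (∈-allFin _) (rep-isRep x)

  cycleLabel : Fin m → Fin (numCycles π)
  cycleLabel x = Any.index (rep∈ x)

  cycleLabel-rep : ∀ x → List.lookup (reps π) (cycleLabel x) ≡ rep x
  cycleLabel-rep x = sym (lookup-index (rep∈ x))

  cycleCover : Covers (Orb π) (numCycles π)
  cycleCover = covers cycleLabel λ {x} {y} eq →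
    orb-trans (rep-orb x) (subst (λ z → Orb π z y)
      (trans (sym (cycleLabel-rep y)) (trans (cong (List.lookup (reps π)) (sym eq)) (cycleLabel-rep x)))
      (orb-sym (rep-orb y)))

  cycleLabel-exact : ∀ {x y} → Orb π x y → cycleLabel x ≡ cycleLabel y
  cycleLabel-exact {x} {y} o = lookup-unique (reps-unique π)
    (trans (cycleLabel-rep x) (trans
      (rep-unique (rep-isRep x) (rep-isRep y) (orb-trans (orb-sym (rep-orb x)) (orb-trans o (rep-orb y))))
      (sym (cycleLabel-rep y))))

  cycleLabel-surjective : ∀ i → ∃ λ x → cycleLabel x ≡ i
  cycleLabel-surjective i = r , lookup-unique (reps-unique π)
    (trans (cycleLabel-rep r) (sym (rep-unique (∈-reps⁻ π (∈-lookup i)) (rep-isRep r) (rep-orb r))))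
    where r = List.lookup (reps π) i

-- Two permutations that differ by a transposition

record Swapped {F : Set} (π π′ : F → F) (a b : F) : Set where
  constructor swapped
  field
    at-a : π′ a ≡ π b
    at-b : π′ b ≡ π a
    off  : ∀ {x} → x ≢ a → x ≢ b → π′ x ≡ π x

swapped-sym : ∀ {F : Set} {π π′ : F → F} {a b} → Swapped π π′ a b → Swapped π′ π a b
swapped-sym (swapped p q r) = swapped (sym q) (sym p) (λ x y → sym (r x y))

module Transposition {m} {π π′ : Fin m → Fin m} (inj : Inj π) (inj′ : Inj π′) {a b} (sw : Swapped π π′ a b) where
  open Swapped sw
  private
    module C  = Cycles inj
    module C′ = Cycles inj′
    module N  = Count inj
    module N′ = Count inj′
    OnAB : Fin m → Set
    OnAB z = Orb π′ z a ⊎ Orb π′ z b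

  onAB-step : ∀ {z w} → Orb π′ w z → OnAB z → OnAB w
  onAB-step o (inj₁ p) = inj₁ (orb-trans o p)
  onAB-step o (inj₂ p) = inj₂ (orb-trans o p)

  -- A π-walk is a π′-walk as long as it avoids `a` and `b`. A step out of one of these two points
  -- lands on the π′-cycle of the other, so the walk never leaves these two cycles unnoticed.
  orb-split : ∀ {x y} → Orb π x y → Orb π′ x y ⊎ (OnAB x × OnAB y)
  orb-split {x} = orb-invariant (λ y → Orb π′ x y ⊎ (OnAB x × OnAB y)) step (inj₁ orb-refl)
    where
    step : ∀ {y} → Orb π′ x y ⊎ (OnAB x × OnAB y) → Orb π′ x (π y) ⊎ (OnAB x × OnAB (π y))
    step {y} s with y ≟ a | y ≟ b
    step (inj₁ o)       | yes refl | _ = inj₂ (inj₁ o , inj₂ (subst (λ z → Orb π′ z b) at-b (C′.orb-back b)))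
    step (inj₂ (p , _)) | yes refl | _ = inj₂ (p , inj₂ (subst (λ z → Orb π′ z b) at-b (C′.orb-back b)))
    step (inj₁ o)       | no _ | yes refl = inj₂ (inj₂ o , inj₁ (subst (λ z → Orb π′ z a) at-a (C′.orb-back a)))
    step (inj₂ (p , _)) | no _ | yes refl = inj₂ (p , inj₁ (subst (λ z → Orb π′ z a) at-a (C′.orb-back a)))
    step {y} (inj₁ o) | no na | no nb = inj₁ (subst (Orb π′ x) (off na nb) (orb-step o))
    step {y} (inj₂ (p , q)) | no na | no nb = inj₂ (p , subst OnAB (off na nb) (onAB-step (C′.orb-back y) q))

  -- The extra label is reserved for the π′-cycle of `a`. Two remaining points of one π-cycle that
  -- π′ seemed to separate would both lie on the cycle of `b`, hence on the same one.
  numCycles-weak : numCycles π′ ≤ suc (numCycles π)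
  numCycles-weak = N′.numCycles≤ (covers lab sep)
    where
    lab : Fin m → Fin (suc (numCycles π))
    lab x with C′.orb? x a
    ... | yes _ = zero
    ... | no  _ = suc (N.cycleLabel x)
    other : ∀ {z} → ¬ Orb π′ z a → OnAB z → Orb π′ z b
    other n (inj₁ o) = ⊥-elim (n o)
    other n (inj₂ o) = o
    sep : ∀ {x y} → lab x ≡ lab y → Orb π′ x y
    sep {x} {y} eq with C′.orb? x a | C′.orb? y a
    ... | yes p | yes q = orb-trans p (C′.orb-sym q)
    ... | no p  | no q with orb-split (separate N.cycleCover (Fin.suc-injective eq))
    ...   | inj₁ o       = o
    ...   | inj₂ (s , t) = orb-trans (other p s) (C′.orb-sym (other q t))

  -- The π-cycle of `b` avoids `a`, so π′ follows it from `π b` until `b` is reached, and `at-a`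
  -- leads from `a` into this stretch.
  joined : ¬ Orb π a b → Orb π′ a b
  joined na with C.period b
  ... | d , _ , per = go d (subst (Orb π′ a) per)
    where
    go : ∀ i → (Orb π′ a (iter (suc i) π b) → Orb π′ a b) → Orb π′ a b
    go i k = [ k , id ]′ (walk i)
      where
      walk : ∀ i → Orb π′ a (iter (suc i) π b) ⊎ Orb π′ a b
      walk zero    = inj₁ (1 , at-a)
      walk (suc i) with walk i
      ... | inj₂ o = inj₂ o
      ... | inj₁ o with iter (suc i) π b ≟ b
      ...   | yes e = inj₂ (subst (Orb π′ a) e o)
      ...   | no ne = inj₁ (subst (Orb π′ a) (off (λ e → na (C.orb-sym (suc i , e))) ne) (orb-step o))

  -- The cycles of `a` and `b` become one, so the label of `b` can be replaced by that of `a` and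
  -- punched out.
  numCycles-join : ¬ Orb π a b → suc (numCycles π′) ≤ numCycles π
  numCycles-join na = merge (numCycles π) N.cycleCover
    where
    step : ∀ x → Orb π′ x (π x)
    step x with x ≟ a | x ≟ b
    ... | yes refl | _        = orb-trans (joined na) (1 , at-b)
    ... | no _     | yes refl = orb-trans (C′.orb-sym (joined na)) (1 , at-a)
    ... | no p     | no q     = 1 , off p q
    coarser : ∀ {x y} → Orb π x y → Orb π′ x y
    coarser = orb-map id step
    merge : ∀ K → Covers (Orb π) K → suc (numCycles π′) ≤ K
    merge zero (covers lab _) with lab a
    ... | ()
    merge (suc K) (covers lab sep) = s≤s (N′.numCycles≤ (covers lab′ sep′))
      where
      b≢a : lab b ≢ lab a
      b≢a e = na (sep (sym e))
      lab′ : Fin m → Fin K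
      lab′ x with lab b ≟ lab x
      ... | yes _ = punchOut b≢a
      ... | no ne = punchOut ne
      sep′ : ∀ {x y} → lab′ x ≡ lab′ y → Orb π′ x y
      sep′ {x} {y} eq with lab b ≟ lab x | lab b ≟ lab y
      ... | yes p | yes q = coarser (sep (trans (sym p) q))
      ... | yes p | no q  = orb-trans (coarser (sep (sym p))) (orb-trans (C′.orb-sym (joined na))
                              (coarser (sep (punchOut-injective b≢a q eq))))
      ... | no p  | yes q = orb-trans (coarser (sep (punchOut-injective p b≢a eq)))
                              (orb-trans (joined na) (coarser (sep q)))
      ... | no p  | no q  = coarser (sep (punchOut-injective p q eq))

  -- Following π from b, the point a is met before b; up to there π′ started at a agrees with π.
  separated : a ≢ b → Orb π a b → ¬ Orb π′ a b
  separated a≢b o o′ with C.orb-bounded (C.orb-sym o)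
  ... | n , _ , hit = clash (walk n)
    where
    Free : ℕ → Set
    Free n = ∀ k → k ≤ n → iter (suc k) π b ≢ a × iter (suc k) π b ≢ b
    Agree : ℕ → Set
    Agree n = ∀ k → k ≤ n → iter (suc k) π′ a ≡ iter (suc k) π b
    walk : ∀ n → (Free n × Agree n) ⊎ (∃ λ j → (∀ k → k < j → iter (suc k) π b ≢ a × iter (suc k) π b ≢ b)
             × Agree j × (iter (suc j) π b ≡ a ⊎ iter (suc j) π b ≡ b))
    walk zero with iter 1 π b ≟ a | iter 1 π b ≟ b
    ... | yes p | _     = inj₂ (0 , (λ _ ()) , (λ { zero _ → at-a }) , inj₁ p)
    ... | no _  | yes p = inj₂ (0 , (λ _ ()) , (λ { zero _ → at-a }) , inj₂ p)
    ... | no p  | no q  = inj₁ ((λ { zero _ → p , q }) , (λ { zero _ → at-a }))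
    walk (suc n) with walk n
    ... | inj₂ r = inj₂ r
    ... | inj₁ (fr , ag) = next
      where
      ag′ : Agree (suc n)
      ag′ k le with m≤n⇒m<n∨m≡n le
      ... | inj₁ lt   = ag k (≤-pred lt)
      ... | inj₂ refl = trans (cong π′ (ag n ≤-refl)) (off (proj₁ (fr n ≤-refl)) (proj₂ (fr n ≤-refl)))
      next : _
      next with iter (suc (suc n)) π b ≟ a | iter (suc (suc n)) π b ≟ b
      ... | yes p | _     = inj₂ (suc n , (λ k lt → fr k (≤-pred lt)) , ag′ , inj₁ p)
      ... | no _  | yes p = inj₂ (suc n , (λ k lt → fr k (≤-pred lt)) , ag′ , inj₂ p)
      ... | no p  | no q  = inj₁ (fr′ , ag′)
        where
        fr′ : Free (suc n)
        fr′ k le with m≤n⇒m<n∨m≡n le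
        ... | inj₁ lt   = fr k (≤-pred lt)
        ... | inj₂ refl = p , q
    miss : ∀ (ψ : Fin m → Fin m) z y j → z ≢ y → (∀ k → k < j → iter (suc k) ψ z ≢ y) →
           iter (suc j) ψ z ≡ z → ¬ Orb ψ z y
    miss ψ z y j z≢y mis per (i , eq) = go (i % suc j) (m%n<n i (suc j)) (trans (sym (iter-mod ψ per i)) eq)
      where
      go : ∀ k → k < suc j → iter k ψ z ≢ y
      go zero    _  e = z≢y e
      go (suc k) lt e = mis k (≤-pred lt) e
    clash : _ → ⊥
    clash (inj₁ (fr , _)) = go n ≤-refl hit
      where
      go : ∀ k → k ≤ n → iter k π b ≢ a
      go zero    _  e = a≢b (sym e)
      go (suc k) le e = proj₁ (fr k (<⇒≤ le)) e
    clash (inj₂ (j , fr , ag , inj₁ p)) =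
      miss π′ a b j a≢b (λ k lt e → proj₂ (fr k lt) (trans (sym (ag k (<⇒≤ lt))) e)) (trans (ag j ≤-refl) p) o′
    clash (inj₂ (j , fr , ag , inj₂ p)) =
      miss π b a j (a≢b ∘ sym) (λ k lt e → proj₁ (fr k lt) e) p (C.orb-sym o)

numCycles-split : ∀ {m} {π π′ : Fin m → Fin m} → Inj π → Inj π′ → ∀ {a b} → Swapped π π′ a b →
                  a ≢ b → Orb π a b → suc (numCycles π) ≤ numCycles π′
numCycles-split inj inj′ sw a≢b o =
  Transposition.numCycles-join inj′ inj (swapped-sym sw) (Transposition.separated inj inj′ sw a≢b o)

numCycles-≗ : ∀ {m} {π π′ : Fin m → Fin m} → Inj π → Inj π′ → π ≗ π′ → numCycles π ≤ numCycles π′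
numCycles-≗ inj inj′ eq = Count.numCycles≤ inj
  (covers (Count.cycleLabel inj′) (λ e → orb-map id (λ x → 1 , eq x) (separate (Count.cycleCover inj′) e)))

-- Retracts of permutations

-- A step on one side may correspond to several steps or to none on the other. The points may
-- therefore differ, as when a vertex is placed on an edge, while the cycles still correspond one to
-- one.
record Retract {F F′ : Set} (π : F → F) (π′ : F′ → F′) : Set where
  field
    ι       : F′ → F
    q       : F → F′
    ι-step  : ∀ x → Orb π (ι x) (ι (π′ x))
    q-step  : ∀ x → Orb π′ (q x) (q (π x))
    q-ι     : ∀ x → q (ι x) ≡ x
    ι-q     : ∀ x → Orb π (ι (q x)) x

_∙_ : ∀ {F F′ F″ : Set} {π : F → F} {π′ : F′ → F′} {π″ : F″ → F″} → Retract π π′ → Retract π′ π″ → Retract π π″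
R ∙ S = record
  { ι = R.ι ∘ S.ι ; q = S.q ∘ R.q
  ; ι-step = λ x → orb-map R.ι R.ι-step (S.ι-step x)
  ; q-step = λ x → orb-map S.q S.q-step (R.q-step x)
  ; q-ι = λ x → trans (cong S.q (R.q-ι _)) (S.q-ι x)
  ; ι-q = λ x → orb-trans (orb-map R.ι R.ι-step (S.ι-q (R.q x))) (R.ι-q x) }
  where
  module R = Retract R
  module S = Retract S

retract-numCycles : ∀ {m m′} {π : Fin m → Fin m} {π′ : Fin m′ → Fin m′} → Inj π → Inj π′ →
                    Retract π π′ → numCycles π ≡ numCycles π′
retract-numCycles {π = π} {π′} inj inj′ R = ≤-antisym
  (Count.numCycles≤ inj (covers (Count.cycleLabel inj′ ∘ q) λ {x} {y} eq →
    orb-trans (Cycles.orb-sym inj (ι-q x))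
      (orb-trans (orb-map ι ι-step (separate (Count.cycleCover inj′) eq)) (ι-q y))))
  (Count.numCycles≤ inj′ (covers (Count.cycleLabel inj ∘ ι) λ {x} {y} eq →
    subst₂ (Orb π′) (q-ι x) (q-ι y) (orb-map q q-step (separate (Count.cycleCover inj) eq))))
  where
  open Retract R

-- Colourings and connectedness

Inv : {F : Set} → (F → Bool) → (F → F) → Set
Inv c f = ∀ x → c (f x) ≡ c x

-- Colourings are preferred to paths because they can be pulled back along a change of the map,
-- while a path would have to be rerouted. For χ = σ this is transitivity; for χ = σ² it says that
-- all strands form one closed curve.
Connected : {F : Set} → (F → F) → (F → F) → Set
Connected {F} χ τ = (c : F → Bool) → Inv c χ → Inv c τ → ∀ x y → c x ≡ c y

record FourValent {F : Set} (σ τ : F → F) : Set where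
  field
    σ⁴  : ∀ x → σ (σ (σ (σ x))) ≡ x
    σ≢  : ∀ x → σ x ≢ x
    σσ≢ : ∀ x → σ (σ x) ≢ x
    ττ  : ∀ x → τ (τ x) ≡ x
    τ≢  : ∀ x → τ x ≢ x

  σ-inj : Inj σ
  σ-inj {x} {y} eq = trans (sym (σ⁴ x)) (trans (cong (σ ∘ σ ∘ σ) eq) (σ⁴ y))

  τ-inj : Inj τ
  τ-inj = involutive⇒inj ττ

  φ-inj : Inj (σ ∘ τ)
  φ-inj = τ-inj ∘ σ-inj

  σ³≢ : ∀ x → σ (σ (σ x)) ≢ x
  σ³≢ x eq = σ≢ x (trans (cong σ (sym eq)) (σ⁴ x))

connected-σ : ∀ {F : Set} {σ τ : F → F} → Connected (σ ∘ σ) τ → Connected σ τ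
connected-σ con c iσ iτ = con c (λ x → trans (iσ _) (iσ x)) iτ

-- Euler's inequality: insert the edges one at a time, keeping track of the connected components.

module Euler {m} {σ τ : Fin m → Fin m} (fv : FourValent σ τ) where
  open FourValent fv
  open import Data.List.Membership.DecPropositional (Fin._≟_ {m}) using (_∈?_)

  Touched : List (Fin m) → Fin m → Set
  Touched xs x = x ∈ xs ⊎ τ x ∈ xs

  touched? : ∀ xs x → Dec (Touched xs x)
  touched? xs x = (x ∈? xs) ⊎-dec (τ x ∈? xs)

  touched-τ : ∀ {xs x} → Touched xs x → Touched xs (τ x)
  touched-τ {xs} {x} (inj₁ i) = inj₂ (subst (_∈ xs) (sym (ττ x)) i)
  touched-τ (inj₂ i) = inj₁ i

  -- A flag whose edge is still missing is a free end, and a face walks around it. With no edge at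
  -- all, every vertex is surrounded by one face.
  edges : List (Fin m) → Fin m → Fin m
  edges xs x with touched? xs x
  ... | yes _ = τ x
  ... | no  _ = x

  edges-yes : ∀ {xs x} → Touched xs x → edges xs x ≡ τ x
  edges-yes {xs} {x} t with touched? xs x
  ... | yes _ = refl
  ... | no n  = ⊥-elim (n t)

  edges-no : ∀ {xs x} → ¬ Touched xs x → edges xs x ≡ x
  edges-no {xs} {x} n with touched? xs x
  ... | yes t = ⊥-elim (n t)
  ... | no _  = refl

  edges-involutive : ∀ xs x → edges xs (edges xs x) ≡ x
  edges-involutive xs x = go (touched? xs x)
    where
    go : Dec (Touched xs x) → edges xs (edges xs x) ≡ x
    go (yes t) = trans (cong (edges xs) (edges-yes t)) (trans (edges-yes (touched-τ t)) (ττ x))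
    go (no n)  = trans (cong (edges xs) (edges-no n)) (edges-no n)

  partial-inj : ∀ xs → Inj (σ ∘ edges xs)
  partial-inj xs eq = involutive⇒inj (edges-involutive xs) (σ-inj eq)

  Up : Fin m → Set
  Up x = toℕ x < toℕ (τ x)

  -- `bound` is Euler's inequality F + V ≤ 2K + E for the map built so far. Surjectivity of `comp`
  -- keeps `K` from exceeding the true number of components, so that connectedness finally forces K
  -- ≤ 1.
  record Components (xs : List (Fin m)) : Set where
    field
      K     : ℕ
      comp  : Fin m → Fin K
      onto  : ∀ i → ∃ λ x → comp x ≡ i
      inv-σ : ∀ x → comp (σ x) ≡ comp x
      inv-τ : ∀ {x} → x ∈ xs → comp (τ x) ≡ comp x
      bound : numCycles (σ ∘ edges xs) + numCycles σ ≤ 2 * K + length xs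

  touched-comp : ∀ {xs} (C : Components xs) → ∀ {x} → Touched xs x → Components.comp C (τ x) ≡ Components.comp C x
  touched-comp C (inj₁ i) = Components.inv-τ C i
  touched-comp C {x} (inj₂ i) = trans (sym (Components.inv-τ C i)) (cong (Components.comp C) (ττ x))

  start : Components []
  start = record
    { K = numCycles σ ; comp = Count.cycleLabel σ-inj ; onto = Count.cycleLabel-surjective σ-inj
    ; inv-σ = λ x → sym (Count.cycleLabel-exact σ-inj (1 , refl)) ; inv-τ = λ ()
    ; bound = begin
        numCycles (σ ∘ edges []) + numCycles σ ≤⟨ +-monoˡ-≤ (numCycles σ)
          (numCycles-≗ (partial-inj []) σ-inj (λ x → cong σ (edges-no {[]} λ { (inj₁ ()) ; (inj₂ ()) }))) ⟩
        numCycles σ + numCycles σ ≡⟨ cong (numCycles σ +_) (+-identityʳ _) ⟨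
        2 * numCycles σ           ≡⟨ +-identityʳ _ ⟨
        2 * numCycles σ + 0       ∎ }
    where open ≤-Reasoning

  swap-edge : ∀ {x xs} → x ∉ xs → τ x ∉ xs → Swapped (σ ∘ edges xs) (σ ∘ edges (x ∷ xs)) x (τ x)
  swap-edge {x} {xs} x∉ τx∉ = swapped
    (cong σ (trans (edges-yes (inj₁ (here refl))) (sym (edges-no λ
      { (inj₁ i) → τx∉ i ; (inj₂ i) → x∉ (subst (_∈ xs) (ττ x) i) }))))
    (cong σ (trans (edges-yes (inj₂ (here (ττ x)))) (trans (ττ x) (sym (edges-no λ
      { (inj₁ i) → x∉ i ; (inj₂ i) → τx∉ i })))))
    (λ {z} z≢x z≢τx → cong σ (off z z≢x z≢τx (touched? xs z)))
    where
    off : ∀ z → z ≢ x → z ≢ τ x → Dec (Touched xs z) → edges (x ∷ xs) z ≡ edges xs z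
    off z p q (yes (inj₁ i)) = trans (edges-yes (inj₁ (there i))) (sym (edges-yes (inj₁ i)))
    off z p q (yes (inj₂ i)) = trans (edges-yes (inj₂ (there i))) (sym (edges-yes (inj₂ i)))
    off z p q (no n) = trans (edges-no {x ∷ xs} λ
      { (inj₁ (here e)) → p e ; (inj₁ (there i)) → n (inj₁ i)
      ; (inj₂ (here e)) → q (trans (sym (ττ z)) (cong τ e)) ; (inj₂ (there i)) → n (inj₂ i) }) (sym (edges-no n))

  -- An edge within a component adds at most one face, which E absorbs. An edge between two
  -- components merges their faces: F and K both drop by one and E rises by one, so the two sides
  -- drop alike.
  extend : ∀ {x xs} → x ∉ xs → τ x ∉ xs → Components xs → Components (x ∷ xs)
  extend {x} {xs} x∉ τx∉ C with C.comp (τ x) ≟ C.comp x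
    where module C = Components C
  ... | yes same = record
    { K = C.K ; comp = C.comp ; onto = C.onto ; inv-σ = C.inv-σ
    ; inv-τ = λ { (here refl) → same ; (there i) → C.inv-τ i }
    ; bound = begin
        numCycles (σ ∘ edges (x ∷ xs)) + numCycles σ  ≤⟨ +-monoˡ-≤ (numCycles σ) T.numCycles-weak ⟩
        suc (numCycles (σ ∘ edges xs) + numCycles σ)  ≤⟨ s≤s C.bound ⟩
        suc (2 * C.K + length xs)                     ≡⟨ +-suc (2 * C.K) _ ⟨
        2 * C.K + suc (length xs)                     ∎ }
    where
    open ≤-Reasoning
    module C = Components C
    module T = Transposition (partial-inj xs) (partial-inj (x ∷ xs)) (swap-edge x∉ τx∉)
  ... | no diff = merge C.K C.comp C.onto C.inv-σ C.inv-τ C.bound diff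
    where
    open ≤-Reasoning
    module C = Components C
    module T = Transposition (partial-inj xs) (partial-inj (x ∷ xs)) (swap-edge x∉ τx∉)
    apart : ¬ Orb (σ ∘ edges xs) x (τ x)
    apart o = diff (sym (orb-invariant (λ z → C.comp x ≡ C.comp z)
      (λ {z} e → trans e (sym (trans (C.inv-σ _) (keep z (touched? xs z))))) refl o))
      where
      keep : ∀ z → Dec (Touched xs z) → C.comp (edges xs z) ≡ C.comp z
      keep z (yes t) = trans (cong C.comp (edges-yes t)) (touched-comp C t)
      keep z (no n)  = cong C.comp (edges-no n)
    merge : ∀ K (h : Fin m → Fin K) → (∀ i → ∃ λ z → h z ≡ i) → (∀ z → h (σ z) ≡ h z) →
            (∀ {z} → z ∈ xs → h (τ z) ≡ h z) →
            numCycles (σ ∘ edges xs) + numCycles σ ≤ 2 * K + length xs → h (τ x) ≢ h x → Components (x ∷ xs)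
    merge zero h _ _ _ _ _ with h x
    ... | ()
    merge (suc K) h onto iσ iτ bd ne = record
      { K = K ; comp = h′ ; onto = onto′
      ; inv-σ = λ z → h′-cong (iσ z)
      ; inv-τ = λ { (here refl) → trans h′τx (sym h′x) ; (there i) → h′-cong (iτ i) }
      ; bound = ≤-pred (begin
          suc (numCycles (σ ∘ edges (x ∷ xs)) + numCycles σ) ≤⟨ +-monoˡ-≤ (numCycles σ) (T.numCycles-join apart) ⟩
          numCycles (σ ∘ edges xs) + numCycles σ             ≤⟨ bd ⟩
          2 * suc K + length xs  ≡⟨ solve 2 (λ k l → con 2 :* (con 1 :+ k) :+ l := con 1 :+ (con 2 :* k :+ (con 1 :+ l))) refl K (length xs) ⟩
          suc (2 * K + suc (length xs)) ∎) }
      where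
      open +-*-Solver
      pick : ∀ i → Dec (h (τ x) ≡ i) → Fin K
      pick i (yes _) = punchOut ne
      pick i (no n)  = punchOut n
      pick-no : ∀ i (d : Dec (h (τ x) ≡ i)) (n : h (τ x) ≢ i) → pick i d ≡ punchOut n
      pick-no i (yes p) n = ⊥-elim (n p)
      pick-no i (no p)  n = punchOut-cong (h (τ x)) refl
      h′ : Fin m → Fin K
      h′ z = pick (h z) (h (τ x) ≟ h z)
      h′-cong : ∀ {a b} → h a ≡ h b → h′ a ≡ h′ b
      h′-cong {a} {b} e = cong (λ i → pick i (h (τ x) ≟ i)) e
      h′x : h′ x ≡ punchOut ne
      h′x = pick-no (h x) (h (τ x) ≟ h x) ne
      h′τx : h′ (τ x) ≡ punchOut ne
      h′τx with h (τ x) ≟ h (τ x)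
      ... | yes _ = refl
      ... | no n  = ⊥-elim (n refl)
      onto′ : ∀ i → ∃ λ z → h′ z ≡ i
      onto′ i with onto (punchIn (h (τ x)) i)
      ... | z , e = z , trans (cong (λ j → pick j (h (τ x) ≟ j)) e)
                          (trans (pick-no (punchIn (h (τ x)) i) (h (τ x) ≟ punchIn (h (τ x)) i) (punchInᵢ≢i (h (τ x)) i ∘ sym)) (punchOut-punchIn (h (τ x))))

  ups : List (Fin m)
  ups = filterᵇ (λ x → ⌊ suc (toℕ x) ≤? toℕ (τ x) ⌋) (allFin m)

  up⁺ : ∀ {x} → Up x → x ∈ ups
  up⁺ {x} u = ∈-filterᵇ⁺ _ (∈-allFin x) (reflect u)
    where
    reflect : Up x → ⌊ suc (toℕ x) ≤? toℕ (τ x) ⌋ ≡ true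
    reflect u with suc (toℕ x) ≤? toℕ (τ x)
    ... | yes _ = refl
    ... | no n  = ⊥-elim (n u)

  up⁻ : ∀ {x} → x ∈ ups → Up x
  up⁻ {x} i = reflect (proj₂ (∈-filterᵇ⁻ _ (allFin m) i))
    where
    reflect : ⌊ suc (toℕ x) ≤? toℕ (τ x) ⌋ ≡ true → Up x
    reflect e with suc (toℕ x) ≤? toℕ (τ x)
    ... | yes u = u

  up-not-down : ∀ {x} → Up x → ¬ Up (τ x)
  up-not-down {x} u v = <-asym u (subst (toℕ (τ x) <_) (cong toℕ (ττ x)) v)

  build : ∀ xs → Unique xs → (∀ {x} → x ∈ xs → Up x) → Components xs
  build []       _        _  = start
  build (x ∷ xs) (al ∷ u) up = extend (All≢⇒∉ al)
    (λ i → up-not-down (up (here refl)) (up (there i))) (build xs u (up ∘ there))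

  ups-unique : Unique ups
  ups-unique = filterᵇ-unique _ (allFin⁺ m)

  all-touched : ∀ x → Touched ups x
  all-touched x with <-cmp (toℕ x) (toℕ (τ x))
  ... | tri< lt _ _ = inj₁ (up⁺ lt)
  ... | tri≈ _ e _  = ⊥-elim (τ≢ x (sym (toℕ-injective e)))
  ... | tri> _ _ gt = inj₂ (up⁺ (subst (λ z → toℕ (τ x) < toℕ z) (sym (ττ x)) gt))

  2ups≤ : length ups + length ups ≤ m
  2ups≤ = subst₂ _≤_ (trans (length-++ ups) (cong (length ups +_) (length-map τ ups))) (length-allFin m)
    (length-⊆ (Uniq.++⁺ ups-unique (map-unique τ ups-unique (λ _ _ → τ-inj))
       (λ (i , j) → let (y , k , e) = ∈-map⁻ τ j in up-not-down (up⁻ k) (subst Up e (up⁻ i))))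
       (λ _ → ∈-allFin _))

  components≤1 : Connected σ τ → (C : Components ups) → Components.K C ≤ 1
  components≤1 con C = go K comp onto inv-σ (λ x → touched-comp C (all-touched x))
    where
    open Components C
    go : ∀ K (h : Fin m → Fin K) → (∀ i → ∃ λ z → h z ≡ i) → (∀ z → h (σ z) ≡ h z) → (∀ z → h (τ z) ≡ h z) → K ≤ 1
    go zero          _ _ _ _ = z≤n
    go (suc zero)    _ _ _ _ = s≤s z≤n
    go (suc (suc K)) h onto iσ iτ = ⊥-elim (true≢false (begin
      true                 ≡⟨ cong (_== zero) (proj₂ (onto zero)) ⟨
      (h z₀ == zero)       ≡⟨ con (λ z → h z == zero) (λ z → cong (_== zero) (iσ z)) (λ z → cong (_== zero) (iτ z)) z₀ z₁ ⟩
      (h z₁ == zero)       ≡⟨ cong (_== zero) (proj₂ (onto (suc zero))) ⟩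
      false                ∎))
      where
      open ≡-Reasoning
      z₀ z₁ : Fin m
      z₀ = proj₁ (onto zero)
      z₁ = proj₁ (onto (suc zero))

  vertices : m ≤ 4 * numCycles σ
  vertices = begin
    m                              ≡⟨ length-allFin m ⟨
    length (allFin m)              ≤⟨ length-⊆ (allFin⁺ m) (λ {x} _ → on-vertex x) ⟩
    length (concatMap star (reps σ)) ≡⟨ length-concatMap star (reps σ) ⟩
    sum (map (λ _ → 4) (reps σ))   ≡⟨ sum-const 4 (reps σ) ⟩
    numCycles σ * 4                ≡⟨ *-comm (numCycles σ) 4 ⟩
    4 * numCycles σ                ∎
    where
    open ≤-Reasoning
    star : Fin m → List (Fin m)
    star r = r ∷ σ r ∷ σ (σ r) ∷ σ (σ (σ r)) ∷ []
    on-vertex : ∀ x → x ∈ concatMap star (reps σ)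
    on-vertex x = ∈-concatMap star (Count.rep∈ σ-inj x) (place (Cycles.orb-sym σ-inj (Cycles.rep-orb σ-inj x)))
      where
      r : Fin m
      r = Cycles.rep σ-inj x
      small : ∀ k → k < 4 → iter k σ r ≡ x → x ∈ star r
      small 0 _ e = here (sym e)
      small 1 _ e = there (here (sym e))
      small 2 _ e = there (there (here (sym e)))
      small 3 _ e = there (there (there (here (sym e))))
      small (suc (suc (suc (suc k)))) (s≤s (s≤s (s≤s (s≤s ())))) _
      place : Orb σ r x → x ∈ star r
      place (i , e) = small (i % 4) (m%n<n i 4) (trans (sym (iter-mod σ (σ⁴ r) i)) e)

  euler : Connected σ τ → 4 * numCycles (σ ∘ τ) ≤ m + 8
  euler conn = +-cancelʳ-≤ (m + m) _ _ (begin
    4 * f + (m + m)                  ≤⟨ +-monoʳ-≤ (4 * f) (+-monoˡ-≤ m vertices) ⟩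
    4 * f + (4 * v + m)              ≡⟨ solve 3 (λ f v m → con 4 :* f :+ (con 4 :* v :+ m) := con 4 :* (f :+ v) :+ m) refl f v m ⟩
    4 * (f + v) + m                  ≤⟨ +-monoˡ-≤ m (*-monoʳ-≤ 4 faces) ⟩
    4 * (2 + e) + m                  ≡⟨ solve 2 (λ e m → con 4 :* (con 2 :+ e) :+ m := (m :+ con 8) :+ ((e :+ e) :+ (e :+ e))) refl e m ⟩
    (m + 8) + ((e + e) + (e + e))    ≤⟨ +-monoʳ-≤ (m + 8) (+-mono-≤ 2ups≤ 2ups≤) ⟩
    (m + 8) + (m + m)                ∎)
    where
    open ≤-Reasoning
    open +-*-Solver
    C : Components ups
    C = build ups ups-unique up⁻
    f v e : ℕ
    f = numCycles (σ ∘ τ)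
    v = numCycles σ
    e = length ups
    faces : f + v ≤ 2 + e
    faces = begin
      f + v                              ≤⟨ +-monoˡ-≤ v (numCycles-≗ φ-inj (partial-inj ups)
                                             (λ x → cong σ (sym (edges-yes (all-touched x))))) ⟩
      numCycles (σ ∘ edges ups) + v      ≤⟨ Components.bound C ⟩
      2 * Components.K C + e             ≤⟨ +-monoˡ-≤ e (*-monoʳ-≤ 2 (components≤1 conn C)) ⟩
      2 + e                              ∎

-- The two directions of travel along a closed curve

module Curve {m} {χ τ : Fin m → Fin m} (χχ : ∀ x → χ (χ x) ≡ x) (χ≢ : ∀ x → χ x ≢ x)
             (ττ : ∀ x → τ (τ x) ≡ x) (τ≢ : ∀ x → τ x ≢ x) where

  ρ : Fin m → Fin m
  ρ x = χ (τ x)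

  ρ-inj : Inj ρ
  ρ-inj = involutive⇒inj {f = τ} ττ ∘ involutive⇒inj {f = χ} χχ

  -- A walk from `x` to `τ x` would read the same backwards. Stripping its first and last step
  -- leaves such a walk from `ρ x`, and so on down to a fixed point of τ or χ.
  no-reversal : ∀ i x → iter i ρ x ≢ τ x
  no-reversal zero          x e = τ≢ x (sym e)
  no-reversal (suc zero)    x e = χ≢ (τ x) e
  no-reversal (suc (suc i)) x e = no-reversal i (ρ x) (begin
    iter i ρ (ρ x)                 ≡⟨ iter-comm ρ i x ⟩
    iter (suc i) ρ x               ≡⟨ ττ _ ⟨
    τ (τ (iter (suc i) ρ x))       ≡⟨ cong τ (χχ _) ⟨
    τ (χ (ρ (iter (suc i) ρ x)))   ≡⟨ cong (τ ∘ χ) e ⟩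
    τ (ρ x)                        ∎)
    where open ≡-Reasoning

  reverse : ∀ {x y} → Orb ρ x y → Orb ρ (τ x) (τ y)
  reverse = orb-map τ λ x → Cycles.orb-sym ρ-inj (1 , trans (cong χ (ττ _)) (χχ _))

  -- By `no-reversal`, `x` and `τ x` lie on different cycles. If there are only two, every flag is
  -- on one of them, and an invariant colour is constant along a cycle and under τ.
  two-cycles⇒connected : numCycles ρ ≡ 2 → Connected χ τ
  two-cycles⇒connected two c iχ iτ x y = pick (subst (Covers (Orb ρ)) two (Count.cycleCover ρ-inj))
    where
    along : ∀ {z} → Orb ρ z y → c z ≡ c y
    along {z} = orb-invariant (λ w → c z ≡ c w) (λ e → trans e (sym (trans (iχ _) (iτ _)))) refl
    choose : ∀ (i j k : Fin 2) → i ≢ j → i ≡ k ⊎ j ≡ k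
    choose zero       zero       _          ne = ⊥-elim (ne refl)
    choose zero       (suc zero) zero       _  = inj₁ refl
    choose zero       (suc zero) (suc zero) _  = inj₂ refl
    choose (suc zero) zero       zero       _  = inj₂ refl
    choose (suc zero) zero       (suc zero) _  = inj₁ refl
    choose (suc zero) (suc zero) _          ne = ⊥-elim (ne refl)
    pick : Covers (Orb ρ) 2 → c x ≡ c y
    pick (covers lab sep) with choose (lab x) (lab (τ x)) (lab y)
                                 (λ e → let (i , r) = sep e in no-reversal i x r)
    ... | inj₁ e = along (sep e)
    ... | inj₂ e = trans (sym (iτ x)) (along (sep e))

  module _ (con : Connected χ τ) (x₀ : Fin m) where
    open Cycles ρ-inj

    onCurve : Fin m → Bool
    onCurve y = inCycle ρ x₀ y ∨ inCycle ρ (τ x₀) y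

    P : Fin m → Set
    P y = Orb ρ x₀ y ⊎ Orb ρ (τ x₀) y

    onCurve⁺ : ∀ {y} → P y → onCurve y ≡ true
    onCurve⁺ (inj₁ o) rewrite inCycle⁺ o = refl
    onCurve⁺ {y} (inj₂ o) rewrite inCycle⁺ o with inCycle ρ x₀ y
    ... | true  = refl
    ... | false = refl

    onCurve⁻ : ∀ {y} → onCurve y ≡ true → P y
    onCurve⁻ {y} e with inCycle ρ x₀ y in eq
    ... | true  = inj₁ (inCycle⁻ eq)
    ... | false = inj₂ (inCycle⁻ e)

    P-τ : ∀ {y} → P y → P (τ y)
    P-τ (inj₁ o) = inj₂ (reverse o)
    P-τ {y} (inj₂ o) = inj₁ (subst (λ z → Orb ρ z (τ y)) (ττ x₀) (reverse o))

    P-χ : ∀ {y} → P y → P (χ y)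
    P-χ {y} p with P-τ p
    ... | inj₁ o = inj₁ (subst (Orb ρ x₀) (cong χ (ττ y)) (orb-step o))
    ... | inj₂ o = inj₂ (subst (Orb ρ (τ x₀)) (cong χ (ττ y)) (orb-step o))

    invariant : ∀ {f : Fin m → Fin m} → (∀ x → f (f x) ≡ x) → (∀ {y} → P y → P (f y)) → Inv onCurve f
    invariant {f} ff cl y with onCurve y in e
    ... | true  = onCurve⁺ (cl (onCurve⁻ e))
    ... | false = ≢true⇒≡false λ e′ → true≢false (trans (sym (onCurve⁺ (subst P (ff y) (cl (onCurve⁻ e′))))) e)

    everywhere : ∀ y → P y
    everywhere y = onCurve⁻ (trans (con onCurve (invariant χχ P-χ) (invariant ττ P-τ) y x₀) (onCurve⁺ (inj₁ orb-refl)))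

    connected⇒two-cycles : numCycles ρ ≡ 2
    connected⇒two-cycles = ≤-antisym (Count.numCycles≤ ρ-inj (covers lab sep)) (low (numCycles ρ) (Count.cycleCover ρ-inj))
      where
      lab : Fin m → Fin 2
      lab y with orb? x₀ y
      ... | yes _ = zero
      ... | no  _ = suc zero
      other : ∀ {y} → ¬ Orb ρ x₀ y → Orb ρ (τ x₀) y
      other {y} n with everywhere y
      ... | inj₁ o = ⊥-elim (n o)
      ... | inj₂ o = o
      sep : ∀ {x y} → lab x ≡ lab y → Orb ρ x y
      sep {x} {y} e with orb? x₀ x | orb? x₀ y
      ... | yes p | yes q = orb-trans (orb-sym p) q
      ... | no p  | no q  = orb-trans (orb-sym (other p)) (other q)
      low : ∀ K → Covers (Orb ρ) K → 2 ≤ K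
      low 0 (covers l _) with l x₀
      ... | ()
      low 1 (covers l s) with s {x₀} {τ x₀} (one (l x₀) (l (τ x₀)))
        where
        one : ∀ (i j : Fin 1) → i ≡ j
        one zero zero = refl
      ... | i , e = ⊥-elim (no-reversal i x₀ e)
      low (suc (suc K)) _ = s≤s (s≤s z≤n)

    -- The two ρ-cycles are the two directions of travel; one of them is declared to be forward.
    orient : Fin m → Bool
    orient y = inCycle ρ x₀ y

    orient-τ : ∀ y → orient (τ y) ≡ not (orient y)
    orient-τ y with orient y in e
    ... | true  = ≢true⇒≡false λ e′ → let (i , r) = orb-trans (orb-sym (inCycle⁻ e)) (inCycle⁻ e′) in no-reversal i y r
    ... | false with everywhere y
    ...   | inj₁ o = ⊥-elim (true≢false (trans (sym (inCycle⁺ o)) e))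
    ...   | inj₂ o = inCycle⁺ (subst (λ z → Orb ρ z (τ y)) (ττ x₀) (reverse o))

    orient-χ : ∀ y → orient (χ y) ≡ not (orient y)
    orient-χ y = trans same (orient-τ y)
      where
      step : Orb ρ (τ y) (χ y)
      step = 1 , cong χ (ττ y)
      same : orient (χ y) ≡ orient (τ y)
      same with orient (τ y) in e
      ... | true  = inCycle⁺ (orb-trans (inCycle⁻ e) step)
      ... | false = ≢true⇒≡false λ e′ → true≢false (trans (sym (inCycle⁺ (orb-trans (inCycle⁻ e′) (orb-sym step)))) e)

-- An arc has one end of each orientation: f reverses o except at the ends of the arcs, where it is the identity.

balance : ∀ {m} (c o : Fin m → Bool) {f τ : Fin m → Fin m} → Inj f → Inj τ → Inv c f → Inv c τ →
          (∀ x → o (τ x) ≡ not (o x)) → (∀ x → c x ≡ true → o x ≡ false → o (f x) ≡ true) →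
          ∀ e → c e ≡ true → o e ≡ true → f e ≡ e → ⊥
balance {m} c o {f} {τ} f-inj τ-inj cf cτ oτ of e ce oe fe = 1+n≰n (≤-trans outs ins)
  where
  out inn : List (Fin m)
  out = filterᵇ (λ x → c x ∧ o x) (allFin m)
  inn = filterᵇ (λ x → c x ∧ not (o x)) (allFin m)
  out⁻ : ∀ {x} → x ∈ out → c x ≡ true × o x ≡ true
  out⁻ i = ∧-true⁻ (proj₂ (∈-filterᵇ⁻ _ (allFin m) i))
  inn⁻ : ∀ {x} → x ∈ inn → c x ≡ true × o x ≡ false
  inn⁻ {x} i = let (p , q) = ∧-true⁻ {c x} (proj₂ (∈-filterᵇ⁻ _ (allFin m) i)) in p , not-true⁻ q
  ins : length out ≤ length inn
  ins = length-injection τ (filterᵇ-unique _ (allFin⁺ m))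
    (λ {x} i → ∈-filterᵇ⁺ _ (∈-allFin _) (∧-true⁺ (trans (cτ x) (proj₁ (out⁻ i)))
      (cong not (trans (oτ x) (cong not (proj₂ (out⁻ i))))))) (λ _ _ → τ-inj)
  -- On the colour class, `f` sends backward flags injectively to forward ones and misses `e`, which
  -- is forward and its own image. But τ shows that forward flags are no more numerous than backward
  -- ones.
  outs : suc (length inn) ≤ length out
  outs = subst (_≤ length out) (cong suc (length-map f inn))
    (length-⊆ (∉⇒All≢ _ (λ i → let (z , j , eq) = ∈-map⁻ f i in
                 true≢false (trans (sym oe) (trans (cong o (f-inj (trans fe eq))) (proj₂ (inn⁻ j)))))
               ∷ map-unique f (filterᵇ-unique _ (allFin⁺ m)) (λ _ _ → f-inj))
      λ { (here refl) → ∈-filterᵇ⁺ _ (∈-allFin _) (∧-true⁺ ce oe)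
        ; (there i) → let (z , j , eq) = ∈-map⁻ f i ; (cz , oz) = inn⁻ j in
            subst (_∈ out) (sym eq) (∈-filterᵇ⁺ _ (∈-allFin _) (∧-true⁺ (trans (cf z) cz) (of z cz oz))) })

-- Transitivity by words of bounded length

module Transitive {m} {σ τ : Fin m → Fin m} (fv : FourValent σ τ) (con : Connected σ τ) where
  open FourValent fv

  ∨-true : ∀ a b c → (a ≡ true ⊎ b ≡ true ⊎ c ≡ true) → a ∨ b ∨ c ≡ true
  ∨-true true  b     c _ = refl
  ∨-true false true  c _ = refl
  ∨-true false false c (inj₂ (inj₂ e)) = e

  ∨-true⁻ : ∀ a b c → a ∨ b ∨ c ≡ true → (a ≡ true ⊎ b ≡ true ⊎ c ≡ true)
  ∨-true⁻ true  b     c _ = inj₁ refl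
  ∨-true⁻ false true  c _ = inj₂ (inj₁ refl)
  ∨-true⁻ false false c e = inj₂ (inj₂ e)

  reach-mono : ∀ j x y → reach σ τ j x y ≡ true → reach σ τ (suc j) x y ≡ true
  reach-mono j x y e = ∨-true (reach σ τ j x y) (reach σ τ j (σ x) y) _ (inj₁ e)

  reach-refl : ∀ j x → reach σ τ j x x ≡ true
  reach-refl zero    x = ≡⇒== refl
  reach-refl (suc j) x = reach-mono j x x (reach-refl j x)

  reach-σ : ∀ j x y → reach σ τ j x y ≡ true → reach σ τ (suc j) x (σ y) ≡ true
  reach-σ zero x y e = ∨-true (x == σ y) (σ x == σ y) _ (inj₂ (inj₁ (≡⇒== (cong σ (==⇒≡ e)))))
  reach-σ (suc j) x y e with ∨-true⁻ (reach σ τ j x y) (reach σ τ j (σ x) y) _ e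
  ... | inj₁ p        = ∨-true (reach σ τ (suc j) x (σ y)) (reach σ τ (suc j) (σ x) (σ y)) _ (inj₁ (reach-σ j x y p))
  ... | inj₂ (inj₁ p) = ∨-true (reach σ τ (suc j) x (σ y)) (reach σ τ (suc j) (σ x) (σ y)) _ (inj₂ (inj₁ (reach-σ j _ y p)))
  ... | inj₂ (inj₂ p) = ∨-true (reach σ τ (suc j) x (σ y)) (reach σ τ (suc j) (σ x) (σ y)) _ (inj₂ (inj₂ (reach-σ j _ y p)))

  reach-τ : ∀ j x y → reach σ τ j x y ≡ true → reach σ τ (suc j) x (τ y) ≡ true
  reach-τ zero x y e = ∨-true (x == τ y) (σ x == τ y) _ (inj₂ (inj₂ (≡⇒== (cong τ (==⇒≡ e)))))
  reach-τ (suc j) x y e with ∨-true⁻ (reach σ τ j x y) (reach σ τ j (σ x) y) _ e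
  ... | inj₁ p        = ∨-true (reach σ τ (suc j) x (τ y)) (reach σ τ (suc j) (σ x) (τ y)) _ (inj₁ (reach-τ j x y p))
  ... | inj₂ (inj₁ p) = ∨-true (reach σ τ (suc j) x (τ y)) (reach σ τ (suc j) (σ x) (τ y)) _ (inj₂ (inj₁ (reach-τ j _ y p)))
  ... | inj₂ (inj₂ p) = ∨-true (reach σ τ (suc j) x (τ y)) (reach σ τ (suc j) (σ x) (τ y)) _ (inj₂ (inj₂ (reach-τ j _ y p)))

  module _ (x : Fin m) where
    ball : ℕ → List (Fin m)
    ball j = filterᵇ (reach σ τ j x) (allFin m)

    ∈-ball : ∀ j {y} → reach σ τ j x y ≡ true → y ∈ ball j
    ∈-ball j e = ∈-filterᵇ⁺ _ (∈-allFin _) e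

    ball⁻ : ∀ j {y} → y ∈ ball j → reach σ τ j x y ≡ true
    ball⁻ j i = proj₂ (∈-filterᵇ⁻ (reach σ τ j x) (allFin m) i)

    closedAt : ℕ → Fin m → Bool
    closedAt j y = not (reach σ τ j x y) ∨ (reach σ τ j x (σ y) ∧ reach σ τ j x (τ y))

    grow : ∀ j y → reach σ τ j x y ≡ false → reach σ τ (suc j) x y ≡ true → suc (length (ball j)) ≤ length (ball (suc j))
    grow j y n e = length-⊆ {xs = y ∷ ball j}
      (∉⇒All≢ _ (λ i → true≢false (trans (sym (ball⁻ j i)) n)) ∷ filterᵇ-unique _ (allFin⁺ m))
      λ { (here refl) → ∈-ball (suc j) e ; (there i) → ∈-ball (suc j) (reach-mono j x _ (ball⁻ j i)) }

    closed⇒all : ∀ j → (∀ y → closedAt j y ≡ true) → ∀ y → reach σ τ j x y ≡ true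
    closed⇒all j cl y = trans (con (reach σ τ j x) (inv σ (λ e → proj₁ (fwd e)) (iter 3 σ) σ⁴ σback)
                                   (inv τ (λ e → proj₂ (fwd e)) τ ττ (λ e → proj₂ (fwd e))) y x) (reach-refl j x)
      where
      fwd : ∀ {y} → reach σ τ j x y ≡ true → reach σ τ j x (σ y) ≡ true × reach σ τ j x (τ y) ≡ true
      fwd {y} e with reach σ τ j x y | cl y
      ... | true | q = ∧-true⁻ q
      σback : ∀ {y} → reach σ τ j x y ≡ true → reach σ τ j x (iter 3 σ y) ≡ true
      σback e = proj₁ (fwd (proj₁ (fwd (proj₁ (fwd e)))))
      inv : ∀ (f : Fin m → Fin m) → (∀ {y} → reach σ τ j x y ≡ true → reach σ τ j x (f y) ≡ true) →
            ∀ (g : Fin m → Fin m) → (∀ y → g (f y) ≡ y) →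
            (∀ {y} → reach σ τ j x y ≡ true → reach σ τ j x (g y) ≡ true) → Inv (reach σ τ j x) f
      inv f ff g gf gg y with reach σ τ j x y in e
      ... | true  = ff e
      ... | false = ≢true⇒≡false λ e′ → true≢false (trans (sym (trans (cong (reach σ τ j x) (sym (gf y))) (gg e′))) e)

    -- A ball that is not closed under σ and τ gains a flag with the next letter, and a closed one
    -- is everything by connectedness. With m flags this must stop within m letters.
    spread : ∀ j → (∀ y → reach σ τ j x y ≡ true) ⊎ suc j ≤ length (ball j)
    spread zero = inj₂ (length-⊆ {xs = x ∷ []} ([] ∷ []) λ { (here refl) → ∈-ball 0 (reach-refl 0 x) })
    spread (suc j) with spread j
    ... | inj₁ al = inj₁ λ y → reach-mono j x y (al y)
    ... | inj₂ le with all (closedAt j) (allFin m) in eq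
    ...   | true  = inj₁ λ y → reach-mono j x y (closed⇒all j (λ z → all⁻ (closedAt j) eq (∈-allFin z)) y)
    ...   | false with all-false (closedAt j) (allFin m) eq
    ...     | y , _ , f with reach σ τ j x y in ey | reach σ τ j x (σ y) in eσ | reach σ τ j x (τ y) in eτ
    ...       | true | false | _     = inj₂ (≤-trans (s≤s le) (grow j (σ y) eσ (reach-σ j x y ey)))
    ...       | true | true  | false = inj₂ (≤-trans (s≤s le) (grow j (τ y) eτ (reach-τ j x y ey)))

    reach-all : ∀ y → reach σ τ m x y ≡ true
    reach-all with spread m
    ... | inj₁ al = al
    ... | inj₂ le = ⊥-elim (1+n≰n (≤-trans le (subst (length (ball m) ≤_) (length-allFin m)
                      (length-⊆ (filterᵇ-unique _ (allFin⁺ m)) (λ _ → ∈-allFin _)))))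

  transitive : isTransitive σ τ ≡ true
  transitive = all⁺ _ (allFin m) λ {x} _ → all⁺ _ (allFin m) λ {y} _ → reach-all x y

-- The head of a word is applied last.

module Words {H : Set} (f τ : H → H) where
  -- The idle letter pads short walks, so that one list of words of fixed length serves for all of
  -- them.
  letter : Fin 3 → H → H
  letter zero             = id
  letter (suc zero)       = f
  letter (suc (suc zero)) = τ

  run : ∀ {l} → Vec (Fin 3) l → H → H
  run []v      a = a
  run (i ∷v w) a = letter i (run w a)

  Reach : ℕ → H → H → Set
  Reach l a b = ∃ λ (w : Vec (Fin 3) l) → run w a ≡ b

  reach-0 : ∀ {a} → Reach 0 a a
  reach-0 = []v , refl

  reach-f : ∀ {l a b} → Reach l a b → Reach (suc l) a (f b)
  reach-f (w , e) = suc zero ∷v w , cong f e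

  reach-τ : ∀ {l a b} → Reach l a b → Reach (suc l) a (τ b)
  reach-τ (w , e) = suc (suc zero) ∷v w , cong τ e

  reach-pad : ∀ {l a b} k → Reach l a b → Reach (k + l) a b
  reach-pad zero    r = r
  reach-pad (suc k) r = let (w , e) = reach-pad k r in zero ∷v w , e

  reach-≤ : ∀ {l l′ a b} → l ≤ l′ → Reach l a b → Reach l′ a b
  reach-≤ {l} {l′} {a} {b} le r = subst (λ k → Reach k a b) (m∸n+n≡m le) (reach-pad (l′ ∸ l) r)

-- Bivalent vertices

-- The two Booleans are the flags of an added vertex of degree two; a rotation simply exchanges
-- them.
ext : {H : Set} → (H → H) → H ⊎ Bool → H ⊎ Bool
ext f = Sum.map f not

module Subdivision {H : Set} (_≟ᴴ_ : DecidableEquality H) where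

  -- The added vertex is placed on the edge of `y`: its flag `false` faces `y` and its flag `true`
  -- faces `τ y`.
  sub : (H → H) → H → H ⊎ Bool → H ⊎ Bool
  sub τ y (inj₂ false) = inj₁ y
  sub τ y (inj₂ true)  = inj₁ (τ y)
  sub τ y (inj₁ z) with z ≟ᴴ y | z ≟ᴴ τ y
  ... | yes _ | _     = inj₂ false
  ... | no _  | yes _ = inj₂ true
  ... | no _  | no _  = inj₁ (τ z)

  sub-cong : ∀ {τ τ′} → τ ≗ τ′ → ∀ y → sub τ y ≗ sub τ′ y
  sub-cong eq y (inj₂ false) = refl
  sub-cong eq y (inj₂ true)  = cong inj₁ (eq y)
  sub-cong {τ} {τ′} eq y (inj₁ z) with z ≟ᴴ y | z ≟ᴴ τ y | z ≟ᴴ τ′ y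
  ... | yes _ | _     | _     = refl
  ... | no _  | yes _ | yes _ = refl
  ... | no _  | no _  | no _  = cong inj₁ (eq z)
  ... | no _  | yes p | no n  = ⊥-elim (n (trans p (eq y)))
  ... | no _  | no n  | yes p = ⊥-elim (n (trans p (sym (eq y))))

  module _ {τ : H → H} {y : H} where

    sub-end : sub τ y (inj₁ y) ≡ inj₂ false
    sub-end with y ≟ᴴ y
    ... | yes _ = refl
    ... | no n  = ⊥-elim (n refl)

    sub-off : ∀ {z} → z ≢ y → z ≢ τ y → sub τ y (inj₁ z) ≡ inj₁ (τ z)
    sub-off {z} p q with z ≟ᴴ y | z ≟ᴴ τ y
    ... | yes e | _     = ⊥-elim (p e)
    ... | no _  | yes e = ⊥-elim (q e)
    ... | no _  | no _  = refl

    sub-old : ∀ {z w} → sub τ y (inj₁ z) ≡ inj₁ w → τ z ≡ w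
    sub-old {z} e with z ≟ᴴ y | z ≟ᴴ τ y
    ... | no _ | no _ = inj₁-injective e

  module Properties {τ : H → H} (ττ : ∀ x → τ (τ x) ≡ x) (τ≢ : ∀ x → τ x ≢ x) (y : H) where

    sub-end′ : sub τ y (inj₁ (τ y)) ≡ inj₂ true
    sub-end′ with τ y ≟ᴴ y | τ y ≟ᴴ τ y
    ... | yes e | _     = ⊥-elim (τ≢ y e)
    ... | no _  | yes _ = refl
    ... | no _  | no n  = ⊥-elim (n refl)

    data Place (z : H) : Set where
      at-y  : z ≡ y → Place z
      at-τy : z ≡ τ y → Place z
      off   : z ≢ y → z ≢ τ y → Place z

    place : ∀ z → Place z
    place z with z ≟ᴴ y | z ≟ᴴ τ y
    ... | yes e | _     = at-y e
    ... | no _  | yes e = at-τy e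
    ... | no p  | no q  = off p q

    sub-involutive : ∀ x → sub τ y (sub τ y x) ≡ x
    sub-involutive (inj₂ false) = sub-end
    sub-involutive (inj₂ true)  = sub-end′
    sub-involutive (inj₁ z) with place z
    ... | at-y refl  = cong (sub τ y) sub-end
    ... | at-τy refl = cong (sub τ y) sub-end′
    ... | off p q    = trans (cong (sub τ y) (sub-off p q)) (trans
          (sub-off (λ e → q (trans (sym (ττ z)) (cong τ e))) (λ e → p (trans (sym (ττ z)) (trans (cong τ e) (ττ y)))))
          (cong inj₁ (ττ z)))

    sub-fixfree : ∀ x → sub τ y x ≢ x
    sub-fixfree (inj₂ false) ()
    sub-fixfree (inj₂ true)  ()
    sub-fixfree (inj₁ z) e with place z
    ... | at-y refl  with trans (sym sub-end) e
    ... | ()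
    sub-fixfree (inj₁ z) e | at-τy refl with trans (sym sub-end′) e
    ... | ()
    sub-fixfree (inj₁ z) e | off p q = τ≢ z (inj₁-injective (trans (sym (sub-off p q)) e))

    subdivision : (f : H → H) → Retract (ext f ∘ sub τ y) (f ∘ τ)
    subdivision f = record { ι = inj₁ ; q = q ; ι-step = ι-step ; q-step = q-step ; q-ι = λ _ → refl ; ι-q = ι-q }
      where
      π : H ⊎ Bool → H ⊎ Bool
      π = ext f ∘ sub τ y
      -- A new flag is identified with the old flag that continues to the same place: `true` is
      -- followed by `τ y`, just as `y` is when the vertex is absent.
      q : H ⊎ Bool → H
      q (inj₁ z)     = z
      q (inj₂ true)  = y
      q (inj₂ false) = τ y
      ι-step : ∀ z → Orb π (inj₁ z) (inj₁ (f (τ z)))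
      ι-step z with place z
      ... | at-y refl  = 2 , cong (λ w → π (ext f w)) sub-end
      ... | at-τy refl = 2 , trans (cong (λ w → π (ext f w)) sub-end′) (cong (inj₁ ∘ f) (sym (ττ y)))
      ... | off p r    = 1 , cong (ext f) (sub-off p r)
      q-step : ∀ x → Orb (f ∘ τ) (q x) (q (π x))
      q-step (inj₂ true)  = 1 , refl
      q-step (inj₂ false) = 1 , cong f (ττ y)
      q-step (inj₁ z) with place z
      ... | at-y refl  = 0 , sym (cong (q ∘ ext f) sub-end)
      ... | at-τy refl = 0 , sym (cong (q ∘ ext f) sub-end′)
      ... | off p r    = 1 , sym (cong (q ∘ ext f) (sub-off p r))
      ι-q : ∀ x → Orb π (inj₁ (q x)) x
      ι-q (inj₁ z)     = orb-refl
      ι-q (inj₂ true)  = 1 , cong (ext f) sub-end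
      ι-q (inj₂ false) = 1 , cong (ext f) sub-end′

    -- In contrast to `q`, a new flag goes to the old flag at the other end of its half of the edge.
    -- This suits colourings that are constant along edges.
    collapse : H ⊎ Bool → H
    collapse (inj₁ z)     = z
    collapse (inj₂ false) = y
    collapse (inj₂ true)  = τ y

    collapse-sub : ∀ (c : H → Bool) → Inv c τ → Inv (c ∘ collapse) (sub τ y)
    collapse-sub c iτ (inj₂ false) = refl
    collapse-sub c iτ (inj₂ true)  = refl
    collapse-sub c iτ (inj₁ z) with place z
    ... | at-y refl  = cong (c ∘ collapse) sub-end
    ... | at-τy refl = cong (c ∘ collapse) sub-end′
    ... | off p q    = trans (cong (c ∘ collapse) (sub-off p q)) (iτ z)

    collapse-ext : ∀ (c : H → Bool) {g} → Inv c g → Inv c τ → Inv (c ∘ collapse) (ext g)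
    collapse-ext c ig iτ (inj₁ z)     = ig z
    collapse-ext c ig iτ (inj₂ false) = iτ y
    collapse-ext c ig iτ (inj₂ true)  = sym (iτ y)

    connected-down : ∀ {g} → Connected (ext g) (sub τ y) → Connected g τ
    connected-down conn c ig iτ a b =
      conn (c ∘ collapse) (collapse-ext c ig iτ) (collapse-sub c iτ) (inj₁ a) (inj₁ b)

    restrict-τ : ∀ {c : H ⊎ Bool → Bool} → c (inj₂ false) ≡ c (inj₂ true) → Inv c (sub τ y) → Inv (c ∘ inj₁) τ
    restrict-τ {c} same iτ z with place z
    ... | at-y refl  = trans (iτ (inj₂ true)) (trans (sym same) (sym (iτ (inj₂ false))))
    ... | at-τy refl = trans (cong (c ∘ inj₁) (ττ y)) (trans (iτ (inj₂ false)) (trans same (sym (iτ (inj₂ true)))))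
    ... | off p q    = trans (cong c (sym (sub-off p q))) (iτ (inj₁ z))

    connected-up : ∀ {g} → Connected g τ → Connected (ext g) (sub τ y)
    connected-up {g} conn c ig iτ a b = trans (base a) (sym (base b))
      where
      const : ∀ z → c (inj₁ z) ≡ c (inj₁ y)
      const z = conn (c ∘ inj₁) (λ w → ig (inj₁ w)) (restrict-τ {c} (ig (inj₂ true)) iτ) z y
      base : ∀ a → c a ≡ c (inj₁ y)
      base (inj₁ z)     = const z
      base (inj₂ false) = sym (iτ (inj₂ false))
      base (inj₂ true)  = trans (sym (iτ (inj₂ true))) (const (τ y))

    -- Passing the added vertex turns into a τ across the old edge, and moving along one half of
    -- that edge into an idle letter, so the length is kept.
    project : ∀ {g l a b} → Words.Reach (ext g) (sub τ y) l a b → Words.Reach g τ l (collapse a) (collapse b)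
    project {g} (w , refl) = go w
      where
      module B = Words g τ
      module A = Words (ext g) (sub τ y)
      go : ∀ {l a} (w : Vec (Fin 3) l) → B.Reach l (collapse a) (collapse (A.run w a))
      go []v = B.reach-0
      go {suc l} {a} (zero ∷v w) = B.reach-pad 1 (go w)
      go {suc l} {a} (suc zero ∷v w) with A.run w a | go {a = a} w
      ... | inj₁ z     | r = B.reach-f r
      ... | inj₂ false | r = B.reach-τ r
      ... | inj₂ true  | r = subst (B.Reach (suc l) _) (ττ y) (B.reach-τ r)
      go {suc l} {a} (suc (suc zero) ∷v w) with A.run w a | go {a = a} w
      ... | inj₂ false | r = B.reach-pad 1 r
      ... | inj₂ true  | r = B.reach-pad 1 r
      ... | inj₁ z     | r with place z
      ...   | at-y refl  = subst (B.Reach (suc l) _) (sym (cong collapse sub-end)) (B.reach-pad 1 r)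
      ...   | at-τy refl = subst (B.Reach (suc l) _) (sym (cong collapse sub-end′)) (B.reach-pad 1 r)
      ...   | off p q    = subst (B.Reach (suc l) _) (sym (cong collapse (sub-off p q))) (B.reach-τ r)

  sub-inj : ∀ {τ τ′ y y′} → (∀ x → τ (τ x) ≡ x) → (∀ x → τ x ≢ x) → (∀ x → τ′ (τ′ x) ≡ x) → (∀ x → τ′ x ≢ x) →
            sub τ y ≗ sub τ′ y′ → y ≡ y′ × τ ≗ τ′
  sub-inj {τ} {τ′} {y} {y′} ττ τ≢ ττ′ τ≢′ eq with inj₁-injective (eq (inj₂ false))
  ... | refl = refl , same
    where
    end : τ y ≡ τ′ y
    end = inj₁-injective (eq (inj₂ true))
    open Properties ττ τ≢ y
    same : τ ≗ τ′
    same z with place z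
    ... | at-y refl  = end
    ... | at-τy refl = trans (ττ y) (trans (sym (ττ′ y)) (cong τ′ (sym end)))
    ... | off p q    = inj₁-injective (trans (sym (sub-off p q)) (trans (eq (inj₁ z)) (sub-off p (λ e → q (trans e (sym end))))))

  record Suppressed (θ : H ⊎ Bool → H ⊎ Bool) : Set where
    field
      τ     : H → H
      ττ    : ∀ x → τ (τ x) ≡ x
      τ≢    : ∀ x → τ x ≢ x
      y     : H
      sub≗  : θ ≗ sub τ y

  abstract
    suppress : ∀ {θ} → (∀ x → θ (θ x) ≡ x) → (∀ x → θ x ≢ x) → θ (inj₂ false) ≢ inj₂ true → Suppressed θ
    suppress {θ} θθ θ≢ nl with θ (inj₂ false) in e₀ | θ (inj₂ true) in e₁
    ... | inj₂ false | _          = ⊥-elim (θ≢ _ e₀)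
    ... | inj₂ true  | _          = ⊥-elim (nl refl)
    ... | inj₁ y     | inj₂ true  = ⊥-elim (θ≢ _ e₁)
    ... | inj₁ y     | inj₂ false with trans (sym (trans (cong θ (sym e₁)) (θθ _))) e₀
    ...   | ()
    suppress {θ} θθ θ≢ nl | inj₁ y | inj₁ y′ = record { τ = τ ; ττ = ττ ; τ≢ = τ≢ ; y = y ; sub≗ = eq }
      where
      y≢y′ : y ≢ y′
      y≢y′ refl with trans (sym (θθ (inj₂ false))) (trans (cong θ (trans e₀ (sym e₁))) (θθ (inj₂ true)))
      ... | ()
      θy : θ (inj₁ y) ≡ inj₂ false
      θy = trans (cong θ (sym e₀)) (θθ _)
      θy′ : θ (inj₁ y′) ≡ inj₂ true
      θy′ = trans (cong θ (sym e₁)) (θθ _)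
      stay : ∀ z → z ≢ y → z ≢ y′ → ∃ λ w → θ (inj₁ z) ≡ inj₁ w
      stay z p q with θ (inj₁ z) in e
      ... | inj₁ w     = w , refl
      ... | inj₂ false = ⊥-elim (p (inj₁-injective (trans (sym (θθ _)) (trans (cong θ e) e₀))))
      ... | inj₂ true  = ⊥-elim (q (inj₁-injective (trans (sym (θθ _)) (trans (cong θ e) e₁))))
      τ : H → H
      τ z with z ≟ᴴ y | z ≟ᴴ y′
      ... | yes _ | _     = y′
      ... | no _  | yes _ = y
      ... | no p  | no q  = proj₁ (stay z p q)
      τy : τ y ≡ y′
      τy with y ≟ᴴ y
      ... | yes _ = refl
      ... | no n  = ⊥-elim (n refl)
      τy′ : τ y′ ≡ y
      τy′ with y′ ≟ᴴ y | y′ ≟ᴴ y′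
      ... | yes e | _     = ⊥-elim (y≢y′ (sym e))
      ... | no _  | yes _ = refl
      ... | no _  | no n  = ⊥-elim (n refl)
      τoff : ∀ {z} → z ≢ y → z ≢ y′ → θ (inj₁ z) ≡ inj₁ (τ z)
      τoff {z} p q with z ≟ᴴ y | z ≟ᴴ y′
      ... | yes e | _     = ⊥-elim (p e)
      ... | no _  | yes e = ⊥-elim (q e)
      ... | no p′ | no q′ = proj₂ (stay z p′ q′)
      split : ∀ z → (z ≡ y) ⊎ (z ≡ y′) ⊎ (z ≢ y × z ≢ y′)
      split z with z ≟ᴴ y | z ≟ᴴ y′
      ... | yes e | _     = inj₁ e
      ... | no _  | yes e = inj₂ (inj₁ e)
      ... | no p  | no q  = inj₂ (inj₂ (p , q))
      τz≢ : ∀ {z} → z ≢ y → z ≢ y′ → τ z ≢ y × τ z ≢ y′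
      τz≢ {z} p q = (λ e → bad (trans (cong (θ ∘ inj₁) (sym e)) (trans (cong θ (sym (τoff p q))) (θθ _))) θy)
                  , (λ e → bad (trans (cong (θ ∘ inj₁) (sym e)) (trans (cong θ (sym (τoff p q))) (θθ _))) θy′)
        where
        bad : ∀ {v : H ⊎ Bool} {b} → v ≡ inj₁ z → v ≢ inj₂ b
        bad refl ()
      ττ : ∀ x → τ (τ x) ≡ x
      ττ z with split z
      ... | inj₁ refl               = trans (cong τ τy) τy′
      ... | inj₂ (inj₁ refl)        = trans (cong τ τy′) τy
      ... | inj₂ (inj₂ (p , q))     = inj₁-injective (trans (sym (τoff (proj₁ (τz≢ p q)) (proj₂ (τz≢ p q))))
                                        (trans (cong θ (sym (τoff p q))) (θθ _)))
      τ≢ : ∀ x → τ x ≢ x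
      τ≢ z e with split z
      ... | inj₁ refl           = y≢y′ (trans (sym e) τy)
      ... | inj₂ (inj₁ refl)    = y≢y′ (trans (sym τy′) e)
      ... | inj₂ (inj₂ (p , q)) = θ≢ (inj₁ z) (trans (τoff p q) (cong inj₁ e))
      eq : θ ≗ sub τ y
      eq (inj₂ false) = e₀
      eq (inj₂ true)  = trans e₁ (cong inj₁ (sym τy))
      eq (inj₁ z) with split z
      ... | inj₁ refl           = trans θy (sym sub-end)
      ... | inj₂ (inj₁ refl)    = trans θy′ (sym (trans (cong (sub τ y ∘ inj₁) (sym τy)) (Properties.sub-end′ ττ τ≢ y)))
      ... | inj₂ (inj₂ (p , q)) = trans (τoff p q) (sym (sub-off p (λ e → q (trans e τy))))

  -- If its two flags were joined to each other, the added vertex would be a component by itself,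
  -- apart from the flag supplied in `H`.
  no-free-loop : ∀ {g θ} → (∀ x → θ (θ x) ≡ x) → Connected (ext g) θ → H → θ (inj₂ false) ≢ inj₂ true
  no-free-loop {g} {θ} θθ conn h e = true≢false (conn isNew (λ { (inj₁ _) → refl ; (inj₂ _) → refl }) inv (inj₂ false) (inj₁ h))
    where
    isNew : H ⊎ Bool → Bool
    isNew (inj₁ _) = false
    isNew (inj₂ _) = true
    e′ : θ (inj₂ true) ≡ inj₂ false
    e′ = trans (cong θ (sym e)) (θθ _)
    inv : Inv isNew θ
    inv (inj₂ false) = cong isNew e
    inv (inj₂ true)  = cong isNew e′
    inv (inj₁ z) with θ (inj₁ z) in ez
    ... | inj₁ _     = refl
    ... | inj₂ false with trans (sym (θθ (inj₁ z))) (trans (cong θ ez) e)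
    ...   | ()
    inv (inj₁ z) | inj₂ true with trans (sym (θθ (inj₁ z))) (trans (cong θ ez) e′)
    ...   | ()

-- Inserting new labels

-- The second label is counted among those that the first leaves free; the old flags keep their
-- order.
Tag₂ : ℕ → Set
Tag₂ k = Fin (2 + k) × Fin (1 + k)

insert : ∀ {k} → Tag₂ k → Fin k ⊎ Bool → Fin (2 + k)
insert (a , b) (inj₂ false) = a
insert (a , b) (inj₂ true)  = punchIn a b
insert (a , b) (inj₁ z)     = punchIn a (punchIn b z)

remove : ∀ {k} → Tag₂ k → Fin (2 + k) → Fin k ⊎ Bool
remove (a , b) w with a ≟ w
... | yes _ = inj₂ false
... | no p with b ≟ punchOut p
...   | yes _ = inj₂ true
...   | no r  = inj₁ (punchOut r)

insert-remove : ∀ {k} (t : Tag₂ k) w → insert t (remove t w) ≡ w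
insert-remove (a , b) w with a ≟ w
... | yes e = e
... | no p with b ≟ punchOut p
...   | yes e = trans (cong (punchIn a) e) (punchIn-punchOut p)
...   | no r  = trans (cong (punchIn a) (punchIn-punchOut r)) (punchIn-punchOut p)

insert-inj : ∀ {k} (t : Tag₂ k) → Inj (insert t)
insert-inj (a , b) {inj₂ false} {inj₂ false} e = refl
insert-inj (a , b) {inj₂ true}  {inj₂ true}  e = refl
insert-inj (a , b) {inj₁ z}     {inj₁ w}     e = cong inj₁ (punchIn-injective b z w (punchIn-injective a _ _ e))
insert-inj (a , b) {inj₂ false} {inj₂ true}  e = ⊥-elim (punchInᵢ≢i a _ (sym e))
insert-inj (a , b) {inj₂ false} {inj₁ z}     e = ⊥-elim (punchInᵢ≢i a _ (sym e))
insert-inj (a , b) {inj₂ true}  {inj₂ false} e = ⊥-elim (punchInᵢ≢i a _ e)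
insert-inj (a , b) {inj₁ z}     {inj₂ false} e = ⊥-elim (punchInᵢ≢i a _ e)
insert-inj (a , b) {inj₂ true}  {inj₁ z}     e = ⊥-elim (punchInᵢ≢i b z (punchIn-injective a _ _ (sym e)))
insert-inj (a , b) {inj₁ z}     {inj₂ true}  e = ⊥-elim (punchInᵢ≢i b z (punchIn-injective a _ _ e))

remove-insert : ∀ {k} (t : Tag₂ k) x → remove t (insert t x) ≡ x
remove-insert t x = insert-inj t (insert-remove t (insert t x))

choose-tag : ∀ {k} {a b : Fin (2 + k)} → a ≢ b → ∃ λ t → insert t (inj₂ false) ≡ a × insert t (inj₂ true) ≡ b
choose-tag {a = a} n = (a , punchOut n) , refl , punchIn-punchOut n

tag-unique : ∀ {k} (t t′ : Tag₂ k) → insert t (inj₂ false) ≡ insert t′ (inj₂ false) →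
             insert t (inj₂ true) ≡ insert t′ (inj₂ true) → t ≡ t′
tag-unique (a , b) (.a , b′) refl e = cong (a ,_) (punchIn-injective a b b′ e)

-- There are (m + 4)(m + 3)(m + 2)(m + 1) tags, which for m = 4n is the R(n) of the overview.
Tag : ℕ → Set
Tag m = Tag₂ (2 + m) × Tag₂ m

-- The four new flags come as two vertices of degree two, one on each strand of the smoothing. The
-- same flags thus serve the crossing and its smoothing; the patterns below number them in cyclic
-- order around the crossing.
Flags : ℕ → Set
Flags m = (Fin m ⊎ Bool) ⊎ Bool

pattern old y = inj₁ (inj₁ y)
pattern d₀ = inj₂ false
pattern d₁ = inj₂ true
pattern d₂ = inj₁ (inj₂ false)
pattern d₃ = inj₁ (inj₂ true)

abstract
  relabel : ∀ {m} → Tag m → Flags m → Fin (4 + m)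
  relabel (t , t′) (inj₂ b) = insert t (inj₂ b)
  relabel (t , t′) (inj₁ h) = insert t (inj₁ (insert t′ h))

  unlabel : ∀ {m} → Tag m → Fin (4 + m) → Flags m
  unlabel (t , t′) w = Sum.map₁ (remove t′) (remove t w)

  relabel-unlabel : ∀ {m} (t : Tag m) w → relabel t (unlabel t w) ≡ w
  relabel-unlabel (t , t′) w with remove t w in e
  ... | inj₁ z = trans (cong (insert t ∘ inj₁) (insert-remove t′ z)) (trans (cong (insert t) (sym e)) (insert-remove t w))
  ... | inj₂ b = trans (cong (insert t) (sym e)) (insert-remove t w)

  unlabel-relabel : ∀ {m} (t : Tag m) x → unlabel t (relabel t x) ≡ x
  unlabel-relabel (t , t′) (inj₂ b) = cong (Sum.map₁ (remove t′)) (remove-insert t (inj₂ b))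
  unlabel-relabel (t , t′) (inj₁ h) = trans (cong (Sum.map₁ (remove t′)) (remove-insert t (inj₁ (insert t′ h))))
                                            (cong inj₁ (remove-insert t′ h))

  relabel-inj : ∀ {m} (t : Tag m) → Inj (relabel t)
  relabel-inj t {x} {y} e = trans (sym (unlabel-relabel t x)) (trans (cong (unlabel t) e) (unlabel-relabel t y))

  unlabel-inj : ∀ {m} (t : Tag m) → Inj (unlabel t)
  unlabel-inj t {x} {y} e = trans (sym (relabel-unlabel t x)) (trans (cong (relabel t) e) (relabel-unlabel t y))

  choose-labels : ∀ {m} (e : Bool → Bool → Fin (4 + m)) → e false false ≢ e false true → e true false ≢ e true true →
                  (∀ b c → e false b ≢ e true c) →
                  ∃ λ t → (∀ b → relabel t (inj₂ b) ≡ e false b) × (∀ b → relabel t (inj₁ (inj₂ b)) ≡ e true b)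
  choose-labels {m} e n₀ n₁ apart with choose-tag n₀
  ... | t , p , q = (t , t′) , (λ { false → p ; true → q }) , (λ { false → lab false (proj₁ (proj₂ inner)) ; true → lab true (proj₂ (proj₂ inner)) })
    where
    at : ∀ b → insert t (inj₂ b) ≡ e false b
    at false = p
    at true  = q
    pull : ∀ b → ∃ λ z → insert t (inj₁ z) ≡ e true b
    pull b with remove t (e true b) in r
    ... | inj₁ z = z , trans (cong (insert t) (sym r)) (insert-remove t _)
    ... | inj₂ c = ⊥-elim (apart c b (trans (sym (at c)) (trans (cong (insert t) (sym r)) (insert-remove t _))))
    inner : ∃ λ t′ → insert t′ (inj₂ false) ≡ proj₁ (pull false) × insert t′ (inj₂ true) ≡ proj₁ (pull true)
    inner = choose-tag λ z → n₁ (trans (sym (proj₂ (pull false))) (trans (cong (insert t ∘ inj₁) z) (proj₂ (pull true))))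
    t′ : Tag₂ m
    t′ = proj₁ inner
    lab : ∀ b → insert t′ (inj₂ b) ≡ proj₁ (pull b) → relabel (t , t′) (inj₁ (inj₂ b)) ≡ e true b
    lab b z = trans (cong (insert t ∘ inj₁) z) (proj₂ (pull b))

  labels-unique : ∀ {m} (t t′ : Tag m) → relabel t d₀ ≡ relabel t′ d₀ → relabel t d₁ ≡ relabel t′ d₁ →
                  relabel t d₂ ≡ relabel t′ d₂ → relabel t d₃ ≡ relabel t′ d₃ → t ≡ t′
  labels-unique (s , t) (s′ , t′) e₀ e₁ e₂ e₃ with tag-unique s s′ e₀ e₁
  ... | refl = cong (s ,_) (tag-unique t t′ (inj₁-injective (insert-inj s e₂)) (inj₁-injective (insert-inj s e₃)))

conj : ∀ {m} → Tag m → (Flags m → Flags m) → Fin (4 + m) → Fin (4 + m)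
conj t f w = relabel t (f (unlabel t w))

conj-relabel : ∀ {m} (t : Tag m) f x → conj t f (relabel t x) ≡ relabel t (f x)
conj-relabel t f x = cong (relabel t ∘ f) (unlabel-relabel t x)

conj-∘ : ∀ {m} (t : Tag m) f g w → conj t f (conj t g w) ≡ conj t (f ∘ g) w
conj-∘ t f g w = conj-relabel t f (g (unlabel t w))

conj-inj : ∀ {m} (t : Tag m) {f} → Inj f → Inj (conj t f)
conj-inj t inj e = unlabel-inj t (inj (relabel-inj t e))

conj-retract : ∀ {m} (t : Tag m) f → Retract (conj t f) f
conj-retract t f = record
  { ι = relabel t ; q = unlabel t
  ; ι-step = λ x → 1 , conj-relabel t f x
  ; q-step = λ w → 1 , sym (unlabel-relabel t _)
  ; q-ι = unlabel-relabel t
  ; ι-q = λ w → 0 , relabel-unlabel t w }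

-- Transitivity and the condition on the cycles of σ²τ are both contained in `connected`; the module
-- `Curve` gives the translation.
record IsCurve {m} (σ τ : Fin m → Fin m) : Set where
  field
    fourValent : FourValent σ τ
    connected  : Connected (σ ∘ σ) τ
    planar     : 4 * numCycles (σ ∘ τ) ≡ m + 8   -- with m = 4n flags: n + 2 faces

-- Insertion of a crossing

_≟⁺_ : ∀ {m} → DecidableEquality (Fin m ⊎ Bool)
_≟⁺_ = Sumₚ.≡-dec _≟_ Bool._≟_

module Sub₀ {m} = Subdivision (Fin._≟_ {m})
module Sub₁ {m} = Subdivision (_≟⁺_ {m})

four : ∀ {m} → (Fin m → Fin m) → Flags m → Flags m
four σ (old y) = old (σ y)
four σ d₀ = d₁
four σ d₁ = d₂
four σ d₂ = d₃
four σ d₃ = d₀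

-- Here `d₀` is paired with `d₁` and `d₂` with `d₃`. Compared with `four`, only the images of `d₁`
-- and `d₃` change, and they trade places.
smooth : ∀ {m} → (Fin m → Fin m) → Flags m → Flags m
smooth σ = ext (ext σ)

smooth≡four : ∀ {m} (σ : Fin m → Fin m) w → w ≢ d₁ → w ≢ d₃ → smooth σ w ≡ four σ w
smooth≡four σ (old y) _ _ = refl
smooth≡four σ d₀ _ _ = refl
smooth≡four σ d₂ _ _ = refl
smooth≡four σ d₁ n _ = ⊥-elim (n refl)
smooth≡four σ d₃ _ n = ⊥-elim (n refl)

-- The second place may lie on an edge that the first vertex has already divided, hence its type
-- `Fin m ⊎ Bool`.
join : ∀ {m} → (Fin m → Fin m) → Fin m → Fin m ⊎ Bool → Flags m → Flags m
join τ y₂ y₁ = Sub₁.sub (Sub₀.sub τ y₂) y₁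

module Expansion {m} {σ τ : Fin m → Fin m} (fv : FourValent σ τ) (y₂ : Fin m) (y₁ : Fin m ⊎ Bool) (t : Tag m) where
  open FourValent fv

  module S₀ = Sub₀.Properties ττ τ≢ y₂
  τ₁ : Fin m ⊎ Bool → Fin m ⊎ Bool
  τ₁ = Sub₀.sub τ y₂
  module S₁ = Sub₁.Properties S₀.sub-involutive S₀.sub-fixfree y₁

  θ : Flags m → Flags m
  θ = join τ y₂ y₁

  θθ : ∀ w → θ (θ w) ≡ w
  θθ = S₁.sub-involutive

  σX τX φₛ : Fin (4 + m) → Fin (4 + m)
  σX = conj t (four σ)
  τX = conj t θ
  φₛ = conj t (smooth σ ∘ θ)

  φX-conj : ∀ w → σX (τX w) ≡ conj t (four σ ∘ θ) w
  φX-conj = conj-∘ t (four σ) θ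

  fourValent : FourValent σX τX
  fourValent = record
    { σ⁴  = λ w → begin
        σX (σX (σX (σX w)))                                 ≡⟨ cong (σX ∘ σX) (conj-∘ t (four σ) (four σ) w) ⟩
        σX (σX (conj t (four σ ∘ four σ) w))                ≡⟨ cong σX (conj-∘ t (four σ) (four σ ∘ four σ) w) ⟩
        σX (conj t (four σ ∘ four σ ∘ four σ) w)            ≡⟨ conj-∘ t (four σ) (four σ ∘ four σ ∘ four σ) w ⟩
        conj t (four σ ∘ four σ ∘ four σ ∘ four σ) w        ≡⟨ cong (relabel t) (four⁴ (unlabel t w)) ⟩
        relabel t (unlabel t w)                             ≡⟨ relabel-unlabel t w ⟩
        w                                                   ∎
    ; σ≢  = λ w e → four≢ (unlabel t w) (relabel-inj t (trans e (sym (relabel-unlabel t w))))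
    ; σσ≢ = λ w e → four²≢ (unlabel t w) (relabel-inj t (trans (sym (conj-∘ t (four σ) (four σ) w)) (trans e (sym (relabel-unlabel t w)))))
    ; ττ  = λ w → trans (conj-∘ t θ θ w) (trans (cong (relabel t) (θθ (unlabel t w))) (relabel-unlabel t w))
    ; τ≢  = λ w e → S₁.sub-fixfree (unlabel t w) (relabel-inj t (trans e (sym (relabel-unlabel t w)))) }
    where
    open ≡-Reasoning
    four⁴ : ∀ x → four σ (four σ (four σ (four σ x))) ≡ x
    four⁴ (old y) = cong (inj₁ ∘ inj₁) (σ⁴ y)
    four⁴ d₀ = refl
    four⁴ d₁ = refl
    four⁴ d₂ = refl
    four⁴ d₃ = refl
    four≢ : ∀ x → four σ x ≢ x
    four≢ (old y) e = σ≢ y (inj₁-injective (inj₁-injective e))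
    four≢ d₀ ()
    four≢ d₁ ()
    four≢ d₂ ()
    four≢ d₃ ()
    four²≢ : ∀ x → four σ (four σ x) ≢ x
    four²≢ (old y) e = σσ≢ y (inj₁-injective (inj₁-injective e))
    four²≢ d₀ ()
    four²≢ d₁ ()
    four²≢ d₂ ()
    four²≢ d₃ ()

  module X = FourValent fourValent

  smooth-inj : Inj (smooth σ)
  smooth-inj = ext-inj (ext-inj σ-inj)
    where
    ext-inj : ∀ {H : Set} {f : H → H} → Inj f → Inj (ext f)
    ext-inj inj {inj₁ x} {inj₁ y} e = cong inj₁ (inj (inj₁-injective e))
    ext-inj inj {inj₂ x} {inj₂ y} e = cong inj₂ (not-injective (inj₂-injective e))

  φₛ-inj : Inj φₛ
  φₛ-inj = conj-inj t {smooth σ ∘ θ} λ e → involutive⇒inj {f = θ} θθ (smooth-inj e)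

  smooth-cycles : numCycles φₛ ≡ numCycles (σ ∘ τ)
  smooth-cycles = retract-numCycles φₛ-inj φ-inj
    (conj-retract t (smooth σ ∘ θ) ∙ (S₁.subdivision (ext σ) ∙ S₀.subdivision σ))

  p₁ p₃ : Fin (4 + m)
  p₁ = relabel t (θ d₁)
  p₃ = relabel t (θ d₃)

  -- `four` and `smooth` differ by exchanging the images of `d₁` and `d₃`. After composition with
  -- the edges, the exchange takes place at the partners of these flags.
  smoothing : Swapped (σX ∘ τX) φₛ p₁ p₃
  smoothing = swapped
    (trans (φₛ-at d₁) (sym (φX-at d₃)))
    (trans (φₛ-at d₃) (sym (φX-at d₁)))
    (λ {w} n₁ n₃ → trans
      (cong (relabel t) (smooth≡four σ (θ (unlabel t w))
        (λ e → n₁ (back e)) (λ e → n₃ (back e))))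
      (sym (φX-conj w)))
    where
    φₛ-at : ∀ d → φₛ (relabel t (θ d)) ≡ relabel t (smooth σ d)
    φₛ-at d = trans (conj-relabel t (smooth σ ∘ θ) (θ d)) (cong (relabel t ∘ smooth σ) (θθ d))
    φX-at : ∀ d → σX (τX (relabel t (θ d))) ≡ relabel t (four σ d)
    φX-at d = trans (φX-conj _) (trans (conj-relabel t (four σ ∘ θ) (θ d)) (cong (relabel t ∘ four σ) (θθ d)))
    back : ∀ {w d} → θ (unlabel t w) ≡ d → w ≡ relabel t (θ d)
    back {w} refl = trans (sym (relabel-unlabel t w)) (cong (relabel t) (sym (θθ _)))

  private module T = Transposition X.φ-inj φₛ-inj smoothing

  faces-down : numCycles (σX ∘ τX) ≤ suc (numCycles (σ ∘ τ))
  faces-down = subst (λ k → numCycles (σX ∘ τX) ≤ suc k) smooth-cycles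
    (Transposition.numCycles-weak φₛ-inj X.φ-inj (swapped-sym smoothing))

  -- From `p₁` and `p₃` a face enters the crossing at the two corners that the smoothing opens. A
  -- face that meets both is cut in two.
  faces-split : Orb (σX ∘ τX) p₁ p₃ → suc (numCycles (σX ∘ τX)) ≤ numCycles (σ ∘ τ)
  faces-split o = subst (suc (numCycles (σX ∘ τX)) ≤_) smooth-cycles
    (numCycles-split X.φ-inj φₛ-inj smoothing p₁≢p₃ o)
    where
    p₁≢p₃ : p₁ ≢ p₃
    p₁≢p₃ e with involutive⇒inj {f = θ} θθ {d₁} {d₃} (relabel-inj t e)
    ... | ()

  faces-join : ¬ Orb (σX ∘ τX) p₁ p₃ → suc (numCycles (σ ∘ τ)) ≤ numCycles (σX ∘ τX)
  faces-join n = subst (λ k → suc k ≤ numCycles (σX ∘ τX)) smooth-cycles (T.numCycles-join n)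

  connected-down : Connected (smooth (σ ∘ σ)) θ → Connected (σ ∘ σ) τ
  connected-down conn = S₀.connected-down (S₁.connected-down {ext (σ ∘ σ)} conn)

  connected-up : Connected (σ ∘ σ) τ → Connected (smooth (σ ∘ σ)) θ
  connected-up conn = S₁.connected-up (S₀.connected-up conn)

join-inj : ∀ {m} {τ τ′ : Fin m → Fin m} {y₂ y₂′ y₁ y₁′} →
           (∀ x → τ (τ x) ≡ x) → (∀ x → τ x ≢ x) → (∀ x → τ′ (τ′ x) ≡ x) → (∀ x → τ′ x ≢ x) →
           join τ y₂ y₁ ≗ join τ′ y₂′ y₁′ → y₂ ≡ y₂′ × τ ≗ τ′
join-inj {y₂ = y₂} {y₂′} a b c d eq = Sub₀.sub-inj a b c d (proj₂ (Sub₁.sub-inj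
  (Sub₀.Properties.sub-involutive a b y₂) (Sub₀.Properties.sub-fixfree a b y₂)
  (Sub₀.Properties.sub-involutive c d y₂′) (Sub₀.Properties.sub-fixfree c d y₂′) eq))

conj-cancel : ∀ {m} (t : Tag m) {f g} → conj t f ≗ conj t g → f ≗ g
conj-cancel t {f} {g} eq x = relabel-inj t (trans (sym (conj-relabel t f x)) (trans (eq (relabel t x)) (conj-relabel t g x)))

-- Curls

module Curl {m} {σ τ : Fin m → Fin m} (cv : IsCurve σ τ) (y₂ : Fin m) (t : Tag m) where
  open IsCurve cv renaming (fourValent to fv)
  open FourValent fv
  -- The second vertex is put on the half edge next to the flag `d₃` of the first, so that `d₃` and
  -- `d₀` are joined and the edge of `y₂` crosses itself.
  open Expansion fv y₂ (inj₂ true) t public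

  monogon : σX (τX (relabel t d₀)) ≡ relabel t d₀
  monogon = trans (φX-conj _) (conj-relabel t (four σ ∘ θ) d₀)

  θd₃ : θ d₃ ≡ d₀
  θd₃ = Sub₁.sub-end {τ = τ₁} {y = inj₂ true}

  curve : IsCurve σX τX
  curve = record
    { fourValent = fourValent
    ; connected = conn
    ; planar = trans (cong (4 *_) (≤-antisym faces-down (faces-join apart)))
                     (trans (*-suc 4 (numCycles (σ ∘ τ))) (cong (4 +_) planar)) }
    where
    -- `p₃` is the flag `d₀`, which forms the monogon, a face of its own.
    apart : ¬ Orb (σX ∘ τX) p₁ p₃
    apart o with trans (sym (θθ d₁)) (cong θ (trans (sym (relabel-inj t (fixed (Cycles.orb-sym X.φ-inj o)))) θd₃))
      where
      fixed : Orb (σX ∘ τX) p₃ p₁ → p₃ ≡ p₁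
      fixed = orb-invariant (λ w → p₃ ≡ w) (λ { refl → sym (trans (cong (σX ∘ τX ∘ relabel t) θd₃) (trans monogon (cong (relabel t) (sym θd₃)))) }) refl
    ... | ()
    conn : Connected (σX ∘ σX) τX
    conn c iχ iτ a b = trans (at a) (trans (connected-up connected (c ∘ relabel t) inv iθ _ _) (sym (at b)))
      where
      at : ∀ a → c a ≡ c (relabel t (unlabel t a))
      at a = cong c (sym (relabel-unlabel t a))
      iθ : Inv (c ∘ relabel t) θ
      iθ x = trans (cong c (sym (conj-relabel t θ x))) (iτ (relabel t x))
      iχ′ : Inv (c ∘ relabel t) (four σ ∘ four σ)
      iχ′ x = trans (cong c (sym (trans (cong σX (conj-relabel t (four σ) x)) (conj-relabel t (four σ) _)))) (iχ (relabel t x))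
      -- The edge between `d₃` and `d₀` links the two strands through the crossing, so all four new
      -- flags have the same colour.
      inv : Inv (c ∘ relabel t) (smooth (σ ∘ σ))
      inv (old y) = iχ′ (old y)
      inv d₀ = trans (sym (iχ′ d₁)) (iθ d₀)
      inv d₁ = trans (sym (iθ d₀)) (iχ′ d₁)
      inv d₂ = trans (iθ d₀) (sym (iχ′ d₀))
      inv d₃ = trans (iχ′ d₀) (sym (iθ d₀))

-- Curling at τ y lengthens the face of y by one.

module CurlFace {m} {σ τ : Fin m → Fin m} (cv : IsCurve σ τ) (y : Fin m) (t : Tag m) where
  open IsCurve cv using () renaming (fourValent to fv)
  open FourValent fv
  open Curl cv (τ y) t public

  private
    τ₁d₃ : τ₁ (inj₂ true) ≡ inj₁ y
    τ₁d₃ = cong inj₁ (ττ y)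

  θ-y : θ (old y) ≡ d₁
  θ-y = trans (cong (θ ∘ inj₁) (sym τ₁d₃)) S₁.sub-end′

  θ-d₂ : θ d₂ ≡ old (τ y)
  θ-d₂ = Sub₁.sub-off {τ = τ₁} {y = inj₂ true} {z = inj₂ false} (λ ()) (λ e → case trans e τ₁d₃ of λ ())

  θ-off : ∀ {z} → z ≢ y → z ≢ τ y → θ (old z) ≡ old (τ z)
  θ-off p q = trans (Sub₁.sub-off (λ ()) (λ e → p (inj₁-injective (trans e τ₁d₃))))
    (cong inj₁ (Sub₀.sub-off q (λ e → p (trans e (ττ y)))))

-- Removal of a crossing

-- `x` is given the name `d₂`. The corner of its face lies between `σ (σ (σ x))`, named `d₁`, and
-- `d₂`, and is thus one of the two corners that `smooth` opens.
module Vertex {m} {σ τ : Fin (4 + m) → Fin (4 + m)} (fv : FourValent σ τ) (x : Fin (4 + m)) where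
  open FourValent fv

  private
    corner : Bool → Bool → Fin (4 + m)
    corner false false = σ (σ x)
    corner false true  = σ (σ (σ x))
    corner true  false = x
    corner true  true  = σ x

    chosen = choose-labels corner (λ e → σ≢ _ (sym e)) (λ e → σ≢ _ (sym e)) apart
      where
      apart : ∀ b c → corner false b ≢ corner true c
      apart false false e = σσ≢ x e
      apart false true  e = σ≢ x (σ-inj e)
      apart true  false e = σ³≢ x e
      apart true  true  e = σσ≢ x (σ-inj e)

  t : Tag m
  t = proj₁ chosen

  at₀ : relabel t d₀ ≡ σ (σ x)
  at₀ = proj₁ (proj₂ chosen) false
  at₁ : relabel t d₁ ≡ σ (σ (σ x))
  at₁ = proj₁ (proj₂ chosen) true
  at₂ : relabel t d₂ ≡ x
  at₂ = proj₂ (proj₂ chosen) false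
  at₃ : relabel t d₃ ≡ σ x
  at₃ = proj₂ (proj₂ chosen) true

  abstract
    stays : ∀ y → ∃ λ w → σ (relabel t (old y)) ≡ relabel t (old w)
    stays y = go (unlabel t (σ (relabel t (old y)))) refl
      where
      go : ∀ d → unlabel t (σ (relabel t (old y))) ≡ d → ∃ λ w → σ (relabel t (old y)) ≡ relabel t (old w)
      from : ∀ {d} p → unlabel t (σ (relabel t (old y))) ≡ d → relabel t d ≡ σ (relabel t p) → old y ≡ p
      from p e q = relabel-inj t {old y} {p} (σ-inj (trans (sym (relabel-unlabel t _)) (trans (cong (relabel t) e) q)))
      go (old w) e = w , trans (sym (relabel-unlabel t _)) (cong (relabel t) e)
      go d₀ e = case from d₃ e (trans at₀ (cong σ (sym at₃))) of λ ()
      go d₁ e = case from d₀ e (trans at₁ (cong σ (sym at₀))) of λ ()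
      go d₂ e = case from d₁ e (trans at₂ (trans (sym (σ⁴ x)) (cong σ (sym at₁)))) of λ ()
      go d₃ e = case from d₂ e (trans at₃ (cong σ (sym at₂))) of λ ()

  σY : Fin m → Fin m
  σY y = proj₁ (stays y)

  σ-relabel : ∀ w → σ (relabel t w) ≡ relabel t (four σY w)
  σ-relabel (old y) = proj₂ (stays y)
  σ-relabel d₀ = trans (cong σ at₀) (sym at₁)
  σ-relabel d₁ = trans (cong σ at₁) (trans (σ⁴ x) (sym at₂))
  σ-relabel d₂ = trans (cong σ at₂) (sym at₃)
  σ-relabel d₃ = trans (cong σ at₃) (sym at₀)

  σ≗ : σ ≗ conj t (four σY)
  σ≗ w = trans (cong σ (sym (relabel-unlabel t w))) (σ-relabel (unlabel t w))

  θ : Flags m → Flags m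
  θ w = unlabel t (τ (relabel t w))

  τ-relabel : ∀ w → τ (relabel t w) ≡ relabel t (θ w)
  τ-relabel w = sym (relabel-unlabel t _)

  τ≗ : τ ≗ conj t θ
  τ≗ w = trans (cong τ (sym (relabel-unlabel t w))) (τ-relabel (unlabel t w))

  θθ : ∀ w → θ (θ w) ≡ w
  θθ w = relabel-inj t (trans (sym (τ-relabel (θ w))) (trans (cong τ (sym (τ-relabel w))) (ττ _)))

  θ≢ : ∀ w → θ w ≢ w
  θ≢ w e = τ≢ (relabel t w) (trans (τ-relabel w) (cong (relabel t) e))

  private
    old-inj : ∀ {a b} → relabel t (old a) ≡ relabel t (old b) → a ≡ b
    old-inj e = inj₁-injective (inj₁-injective (relabel-inj t e))

  σY⁴ : ∀ y → σY (σY (σY (σY y))) ≡ y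
  σY⁴ y = old-inj (trans (sym (σ-relabel (old _))) (trans (cong σ (sym (σ-relabel (old _))))
    (trans (cong (σ ∘ σ) (sym (σ-relabel (old _)))) (trans (cong (σ ∘ σ ∘ σ) (sym (σ-relabel (old y)))) (σ⁴ _)))))

  fourValentY : ∀ {τY} → (∀ y → τY (τY y) ≡ y) → (∀ y → τY y ≢ y) → FourValent σY τY
  fourValentY a b = record
    { σ⁴  = σY⁴
    ; σ≢  = λ y e → σ≢ _ (trans (σ-relabel (old y)) (cong (relabel t ∘ inj₁ ∘ inj₁) e))
    ; σσ≢ = λ y e → σσ≢ _ (trans (cong σ (σ-relabel (old y))) (trans (σ-relabel (old _)) (cong (relabel t ∘ inj₁ ∘ inj₁) e)))
    ; ττ  = a ; τ≢ = b }

record Reduction {m} (σ τ : Fin (4 + m) → Fin (4 + m)) (x : Fin (4 + m)) : Set where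
  field
    t     : Tag m
    σY τY : Fin m → Fin m
    fvY   : FourValent σY τY
    y₂    : Fin m
    y₁    : Fin m ⊎ Bool
    σ≗    : σ ≗ conj t (four σY)
    τ≗    : τ ≗ conj t (join τY y₂ y₁)
    at₂   : relabel t d₂ ≡ x

connected-≗ : ∀ {F : Set} {χ τ τ′ : F → F} → τ ≗ τ′ → Connected χ τ → Connected χ τ′
connected-≗ eq conn c iχ iτ = conn c iχ (λ x → trans (cong c (eq x)) (iτ x))

agree : Bool → Bool → Bool
agree true  b = b
agree false b = not b

agree-refl : ∀ b → agree b b ≡ true
agree-refl true  = refl
agree-refl false = refl

agree-not : ∀ a b → agree a (not b) ≡ not (agree a b)
agree-not true  b = refl
agree-not false b = refl

agree-≢ : ∀ {a b} → b ≢ a → agree a b ≡ false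
agree-≢ {true}  {true}  n = ⊥-elim (n refl)
agree-≢ {true}  {false} n = refl
agree-≢ {false} {true}  n = refl
agree-≢ {false} {false} n = ⊥-elim (n refl)

planar-down : ∀ {m f f′} → 4 * f ≡ (4 + m) + 8 → f ≤ suc f′ → m + 8 ≤ 4 * f′
planar-down {m} {f} {f′} pl le = +-cancelˡ-≤ 4 _ _ (begin
  4 + (m + 8)   ≡⟨ pl ⟨
  4 * f         ≤⟨ *-monoʳ-≤ 4 le ⟩
  4 * suc f′    ≡⟨ *-suc 4 f′ ⟩
  4 + 4 * f′    ∎)
  where open ≤-Reasoning

planar-clash : ∀ {m f f′} → 4 * f ≡ (4 + m) + 8 → suc f ≤ f′ → ¬ 4 * f′ ≤ m + 8
planar-clash {m} {f} {f′} pl le eu = 1+n≰n (begin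
  suc (4 * f)   ≤⟨ +-monoˡ-≤ (4 * f) {1} {4} (s≤s z≤n) ⟩
  4 + 4 * f     ≡⟨ *-suc 4 f ⟨
  4 * suc f     ≤⟨ *-monoʳ-≤ 4 le ⟩
  4 * f′        ≤⟨ eu ⟩
  m + 8         ≤⟨ m≤n+m (m + 8) 4 ⟩
  (4 + m) + 8   ≡⟨ pl ⟨
  4 * f         ∎)
  where open ≤-Reasoning

faces-≗ : ∀ {m} {σ τ σ′ τ′ : Fin m → Fin m} → FourValent σ τ → FourValent σ′ τ′ → σ ≗ σ′ → τ ≗ τ′ →
          numCycles (σ ∘ τ) ≤ numCycles (σ′ ∘ τ′)
faces-≗ {σ′ = σ′} fv fv′ eσ eτ = numCycles-≗ (FourValent.φ-inj fv) (FourValent.φ-inj fv′)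
  (λ x → trans (eσ _) (cong σ′ (eτ x)))

_≟ᶠ_ : ∀ {m} (a b : Flags m) → Dec (a ≡ b)
_≟ᶠ_ = Sumₚ.≡-dec _≟⁺_ Bool._≟_

-- As long as it does not arrive at d₃, the face walk from d₂ to d₁ survives the smoothing.

module FaceWalk {m} {σ τ : Fin (4 + m) → Fin (4 + m)} (σ-inj : Inj σ) (σ⁴ : ∀ x → σ (σ (σ (σ x))) ≡ x)
  (t : Tag m) (σY : Fin m → Fin m) (θ : Flags m → Flags m)
  (σ-relabel : ∀ w → σ (relabel t w) ≡ relabel t (four σY w)) (τ-relabel : ∀ w → τ (relabel t w) ≡ relabel t (θ w))
  (x : Fin (4 + m)) (at₁ : relabel t d₁ ≡ σ (σ (σ x))) (at₂ : relabel t d₂ ≡ x) (at₃ : relabel t d₃ ≡ σ x)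
  (avoid : ∀ i → τ (iter i (σ ∘ τ) x) ≢ σ x) where

  module W = Words (smooth σY) θ

  Found : ℕ → Set
  Found k = ∃ λ l → l ≤ k × W.Reach l d₂ d₁

  Here : ℕ → Set
  Here i = ∃ λ w → relabel t w ≡ iter i (σ ∘ τ) x × W.Reach (2 * i) d₂ w

  step : ∀ i → Here i → Found (suc (2 * i)) ⊎ Here (suc i)
  step i (w , e , r) = go (θ w ≟ᶠ d₁) (θ w ≟ᶠ d₃)
    where
    go : Dec (θ w ≡ d₁) → Dec (θ w ≡ d₃) → Found (suc (2 * i)) ⊎ Here (suc i)
    go (yes p) _ = inj₁ (suc (2 * i) , ≤-refl , subst (W.Reach (suc (2 * i)) d₂) p (W.reach-τ r))
    go (no _) (yes p) = ⊥-elim (avoid i (trans (cong τ (sym e)) (trans (τ-relabel w) (trans (cong (relabel t) p) at₃))))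
    go (no p) (no q) = inj₂ (smooth σY (θ w)
      , trans (cong (relabel t) (smooth≡four σY (θ w) p q)) (trans (sym (σ-relabel (θ w))) (cong σ (trans (sym (τ-relabel w)) (cong τ e))))
      , subst (λ l → W.Reach l d₂ (smooth σY (θ w))) (sym (*-suc 2 i)) (W.reach-f (W.reach-τ r)))

  walk : ∀ i → Found (2 * i) ⊎ Here i
  walk zero = inj₂ (d₂ , at₂ , W.reach-0)
  walk (suc i) = go (walk i)
    where
    go : Found (2 * i) ⊎ Here i → Found (2 * suc i) ⊎ Here (suc i)
    go (inj₁ (l , le , r)) = inj₁ (l , ≤-trans le (*-monoʳ-≤ 2 (n≤1+n i)) , r)
    go (inj₂ h) = [ (λ (l , le , r) → inj₁ (l , ≤-trans le (subst (suc (2 * i) ≤_) (sym (*-suc 2 i)) (n≤1+n _)) , r)) , inj₂ ]′ (step i h)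

  found : ∀ d → iter (suc d) (σ ∘ τ) x ≡ x → Found (suc (2 * d))
  found d per = go (walk d)
    where
    go : Found (2 * d) ⊎ Here d → Found (suc (2 * d))
    go (inj₁ (l , le , r)) = l , m≤n⇒m≤1+n le , r
    -- The edge by which the face returns to `x` arrives at `σ (σ (σ x))`, which is `d₁`; so the
    -- target is reached at the latest here.
    go (inj₂ (w , e , r)) = suc (2 * d) , ≤-refl , subst (W.Reach (suc (2 * d)) d₂) last (W.reach-τ r)
      where
      last : θ w ≡ d₁
      last = relabel-inj t (trans (sym (τ-relabel w)) (trans (cong τ e) (trans (σ-inj (trans per (sym (σ⁴ x)))) (sym at₁))))

-- Smoothing a crossing at a corner x through which the orientation passes coherently

module Coherent {m} {σ τ : Fin (4 + m) → Fin (4 + m)} (cv : IsCurve σ τ) (y₀ : Fin m)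
                (o : Fin (4 + m) → Bool) (oτ : ∀ x → o (τ x) ≡ not (o x)) (oχ : ∀ x → o (σ (σ x)) ≡ not (o x))
                (x : Fin (4 + m)) (coh : o (σ x) ≡ o x) where
  open IsCurve cv
  open FourValent fourValent
  module V = Vertex fourValent x
  open V

  -- If `d₀` and `d₂` have one colour, the colouring also respects the crossing, and the curve is
  -- connected. Otherwise the flags coloured like `d₂` form a part of the curve whose only ends are
  -- `x` and `σ x`. Coherence makes both ends point the same way, against `balance`.
  smooth-connected : Connected (smooth (σY ∘ σY)) θ
  smooth-connected c iχ iθ = go (c d₀ Bool.≟ c d₂)
    where
    go : Dec (c d₀ ≡ c d₂) → ∀ a b → c a ≡ c b
    go (yes same) a b = trans (cong c (sym (unlabel-relabel t a))) (trans
      (connected (c ∘ unlabel t) inv inv-τ (relabel t a) (relabel t b)) (cong c (unlabel-relabel t b)))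
      where
      χ-inv : ∀ w → c (four σY (four σY w)) ≡ c w
      χ-inv (old y) = iχ (old y)
      χ-inv d₀ = sym same
      χ-inv d₁ = trans (iχ d₂) (trans (sym same) (sym (iχ d₀)))
      χ-inv d₂ = same
      χ-inv d₃ = trans (iχ d₀) (trans same (sym (iχ d₂)))
      inv : Inv (c ∘ unlabel t) (σ ∘ σ)
      inv w = trans (cong (c ∘ unlabel t) (trans (cong σ (σ≗ w)) (σ-relabel _)))
                (trans (cong c (unlabel-relabel t _)) (χ-inv (unlabel t w)))
      inv-τ : Inv (c ∘ unlabel t) τ
      inv-τ w = trans (cong (c ∘ unlabel t) (τ≗ w)) (trans (cong c (unlabel-relabel t _)) (iθ (unlabel t w)))
    go (no diff) a b = ⊥-elim (balance c₁ o₁ (conj-inj t (involutive⇒inj {f = cut} cut-involutive)) τ-inj cf cτ oτ₁ of x ce (agree-refl (o x)) fe)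
      where
      cut : Flags m → Flags m
      cut (old y) = old (σY (σY y))
      cut w       = w
      cut-involutive : ∀ w → cut (cut w) ≡ w
      cut-involutive (old y) = cong (inj₁ ∘ inj₁) (σY⁴ y)
      cut-involutive d₀ = refl
      cut-involutive d₁ = refl
      cut-involutive d₂ = refl
      cut-involutive d₃ = refl
      c₁ o₁ : Fin (4 + m) → Bool
      c₁ w = agree (c d₂) (c (unlabel t w))
      o₁ w = agree (o x) (o w)
      c₁-false : ∀ {w d} → unlabel t w ≡ d → c d ≡ c d₀ → c₁ w ≢ true
      c₁-false e e′ tr = true≢false (trans (sym tr) (trans (cong (agree (c d₂)) (trans (cong c e) e′)) (agree-≢ diff)))
      cf : Inv c₁ (conj t cut)
      cf w = cong (agree (c d₂)) (trans (cong c (unlabel-relabel t _)) (cut-inv (unlabel t w)))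
        where
        cut-inv : ∀ w → c (cut w) ≡ c w
        cut-inv (old y) = iχ (old y)
        cut-inv d₀ = refl
        cut-inv d₁ = refl
        cut-inv d₂ = refl
        cut-inv d₃ = refl
      cτ : Inv c₁ τ
      cτ w = cong (agree (c d₂)) (trans (cong (c ∘ unlabel t) (τ≗ w)) (trans (cong c (unlabel-relabel t _)) (iθ (unlabel t w))))
      oτ₁ : ∀ w → o₁ (τ w) ≡ not (o₁ w)
      oτ₁ w = trans (cong (agree (o x)) (oτ w)) (agree-not (o x) (o w))
      ce : c₁ x ≡ true
      ce = trans (cong (agree (c d₂) ∘ c) (trans (cong (unlabel t) (sym at₂)) (unlabel-relabel t d₂))) (agree-refl (c d₂))
      fe : conj t cut x ≡ x
      fe = trans (cong (conj t cut) (sym at₂)) (trans (conj-relabel t cut d₂) at₂)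
      back : ∀ {w d} → unlabel t w ≡ d → w ≡ relabel t d
      back {w} e = trans (sym (relabel-unlabel t w)) (cong (relabel t) e)
      of : ∀ w → c₁ w ≡ true → o₁ w ≡ false → o₁ (conj t cut w) ≡ true
      of w cw ow with unlabel t w in e
      ... | old y = trans (cong o₁ (sym two)) (trans (cong (agree (o x)) (oχ w)) (trans (agree-not (o x) (o w)) (cong not ow)))
        where
        two : σ (σ w) ≡ relabel t (old (σY (σY y)))
        two = trans (cong (σ ∘ σ) (back e)) (trans (cong σ (σ-relabel (old y))) (σ-relabel _))
      ... | d₀ = ⊥-elim (c₁-false e refl (trans (cong (agree (c d₂) ∘ c) e) cw))
      ... | d₁ = ⊥-elim (c₁-false e (iχ d₀) (trans (cong (agree (c d₂) ∘ c) e) cw))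
      ... | d₂ = ⊥-elim (true≢false (trans (sym (agree-refl (o x))) (trans (cong o₁ (sym (trans (back e) at₂))) ow)))
      ... | d₃ = ⊥-elim (true≢false (trans (sym (trans (cong (agree (o x)) coh) (agree-refl (o x)))) (trans (cong o₁ (sym (trans (back e) at₃))) ow)))

  private
    s₁ : Sub₁.Suppressed θ
    s₁ = Sub₁.suppress θθ θ≢ (Sub₁.no-free-loop {g = ext (σY ∘ σY)} θθ smooth-connected (inj₂ false))
    module A = Sub₁.Suppressed s₁

    conn₁ : Connected (ext (σY ∘ σY)) A.τ
    conn₁ = Sub₁.Properties.connected-down A.ττ A.τ≢ A.y (connected-≗ A.sub≗ smooth-connected)

    s₀ : Sub₀.Suppressed A.τ
    s₀ = Sub₀.suppress A.ττ A.τ≢ (Sub₀.no-free-loop {g = σY ∘ σY} A.ττ conn₁ y₀)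
    module B = Sub₀.Suppressed s₀

    θ≗join : θ ≗ join B.τ B.y A.y
    θ≗join w = trans (A.sub≗ w) (Sub₁.sub-cong B.sub≗ A.y w)

  fvY : FourValent σY B.τ
  fvY = fourValentY B.ττ B.τ≢

  reduction : Reduction σ τ x
  reduction = record
    { t = t ; σY = σY ; τY = B.τ ; fvY = fvY ; y₂ = B.y ; y₁ = A.y ; σ≗ = σ≗
    ; τ≗ = λ w → trans (τ≗ w) (cong (relabel t) (θ≗join (unlabel t w))) ; at₂ = at₂ }

  private
    module R = Reduction reduction
    module E = Expansion fvY B.y A.y t

    faces-X : numCycles (σ ∘ τ) ≡ numCycles (E.σX ∘ E.τX)
    faces-X = ≤-antisym (faces-≗ fourValent E.fourValent R.σ≗ R.τ≗)
                        (faces-≗ E.fourValent fourValent (λ w → sym (R.σ≗ w)) (λ w → sym (R.τ≗ w)))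

    connY : Connected (σY ∘ σY) B.τ
    connY = Sub₀.Properties.connected-down B.ττ B.τ≢ B.y (connected-≗ B.sub≗ conn₁)

    eulerY : 4 * numCycles (σY ∘ B.τ) ≤ m + 8
    eulerY = Euler.euler fvY (connected-σ connY)

  -- The smoothing loses at most one face, which bounds the number of faces from below; Euler's
  -- inequality for the connected result is the matching upper bound.
  curveY : IsCurve σY B.τ
  curveY = record
    { fourValent = fvY ; connected = connY
    ; planar = ≤-antisym eulerY (planar-down planar (subst (_≤ suc (numCycles (σY ∘ B.τ))) (sym faces-X) E.faces-down)) }

  -- The face at x does not return through the opposite corner: smoothing would split it.
  not-opposite : ∀ i → τ (iter i (σ ∘ τ) x) ≢ σ x
  not-opposite i e = planar-clash planar split eulerY
    where
    p₁ : τ (σ (σ (σ x))) ≡ E.p₁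
    p₁ = trans (cong τ (sym at₁)) (trans (τ-relabel d₁) (cong (relabel t) (θ≗join d₁)))
    p₃ : iter i (σ ∘ τ) x ≡ E.p₃
    p₃ = trans (trans (sym (ττ _)) (cong τ e)) (trans (cong τ (sym at₃)) (trans (τ-relabel d₃) (cong (relabel t) (θ≗join d₃))))
    to-x : σ (τ (τ (σ (σ (σ x))))) ≡ x
    to-x = trans (cong σ (ττ _)) (σ⁴ x)
    on-face : Orb (σ ∘ τ) (τ (σ (σ (σ x)))) (iter i (σ ∘ τ) x)
    on-face = orb-trans (1 , to-x) (i , refl)
    split : suc (numCycles (σ ∘ τ)) ≤ numCycles (σY ∘ B.τ)
    split = subst (λ k → suc k ≤ numCycles (σY ∘ B.τ)) (sym faces-X) (E.faces-split
      (orb-map id (λ w → 1 , sym (trans (R.σ≗ _) (cong E.σX (R.τ≗ w)))) (subst₂ (Orb (σ ∘ τ)) p₁ p₃ on-face)))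

  -- The face walk takes at most 2d + 1 letters to `d₁`. When the second vertex is collapsed, `d₁`
  -- becomes the partner of the second place, and one more τ reaches the place itself.
  linked : ∀ d → iter (suc d) (σ ∘ τ) x ≡ x →
           Words.Reach (ext σY) (Sub₀.sub B.τ B.y) (2 + 2 * d) (inj₂ false) A.y
  linked d per = finish (FaceWalk.found {τ = τ} σ-inj σ⁴ t σY E.θ σ-relabel τ-rel x at₁ at₂ at₃ not-opposite d per)
    where
    module Q = Words (ext σY) (Sub₀.sub B.τ B.y)
    τ-rel : ∀ w → τ (relabel t w) ≡ relabel t (E.θ w)
    τ-rel w = trans (τ-relabel w) (cong (relabel t) (θ≗join w))
    finish : (∃ λ l → l ≤ suc (2 * d) × Words.Reach (smooth σY) E.θ l d₂ d₁) → Q.Reach (2 + 2 * d) (inj₂ false) A.y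
    finish (l , le , r) = Q.reach-≤ (s≤s le)
      (subst (Q.Reach (suc l) (inj₂ false)) (E.S₀.sub-involutive A.y) (Q.reach-τ (E.S₁.project {g = ext σY} r)))

-- Smoothing a crossing at a corner of a bigon

-- With this second place, `join` connects `d₂` to `y` and `d₁` to the next flag `σ y` around the
-- same vertex, which closes a bigon. So nothing remains to be chosen.
bigonEnd : ∀ {m} → (Fin m → Fin m) → (Fin m → Fin m) → Fin m → Fin m ⊎ Bool
bigonEnd σ τ y = Sub₀.sub τ y (inj₁ (σ y))

-- Connectedness is not part of this, since the smoothing may split the curve; it is recovered in
-- `Twist` after a second smoothing.
record BigonReduction {m} (σ τ : Fin (4 + m) → Fin (4 + m)) (x : Fin (4 + m)) : Set where
  field
    t     : Tag m
    σY τY : Fin m → Fin m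
    fvY   : FourValent σY τY
    y     : Fin m
    σ-relabel : ∀ w → σ (relabel t w) ≡ relabel t (four σY w)
    τ-relabel : ∀ w → τ (relabel t w) ≡ relabel t (join τY y (bigonEnd σY τY y) w)
    at₂   : relabel t d₂ ≡ x
    at-y  : relabel t (old y) ≡ τ x

module Bigon {m} {σ τ : Fin (4 + m) → Fin (4 + m)} (fv : FourValent σ τ) (x : Fin (4 + m))
             (bigon : σ (τ (σ (τ x))) ≡ x)
             (n₁ : τ x ≢ σ x) (n₂ : τ x ≢ σ (σ x)) (n₃ : τ x ≢ σ (σ (σ x))) where
  open FourValent fv
  private
    module V = Vertex fv x
  open V

  private
    next : ∃ λ p → θ d₂ ≡ old p
    next = go (θ d₂) refl
      where
      to : ∀ {d} → θ d₂ ≡ d → τ x ≡ relabel t d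
      to e = trans (cong τ (sym at₂)) (trans (τ-relabel d₂) (cong (relabel t) e))
      go : ∀ d → θ d₂ ≡ d → ∃ λ p → θ d₂ ≡ old p
      go (old p) e = p , e
      go d₀ e = ⊥-elim (n₂ (trans (to e) at₀))
      go d₁ e = ⊥-elim (n₃ (trans (to e) at₁))
      go d₂ e = ⊥-elim (θ≢ d₂ e)
      go d₃ e = ⊥-elim (n₁ (trans (to e) at₃))

    p : Fin m
    p = proj₁ next
    θd₂ : θ d₂ ≡ old p
    θd₂ = proj₂ next

    at-p : relabel t (old p) ≡ τ x
    at-p = trans (cong (relabel t) (sym θd₂)) (trans (sym (τ-relabel d₂)) (cong τ at₂))

    θd₁ : θ d₁ ≡ old (σY p)
    θd₁ = relabel-inj t (begin
      relabel t (θ d₁)            ≡⟨ τ-relabel d₁ ⟨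
      τ (relabel t d₁)            ≡⟨ cong τ at₁ ⟩
      τ (σ (σ (σ x)))             ≡⟨ cong τ (σ-inj (trans bigon (sym (σ⁴ x)))) ⟨
      τ (τ (σ (τ x)))             ≡⟨ ττ _ ⟩
      σ (τ x)                     ≡⟨ cong σ at-p ⟨
      σ (relabel t (old p))       ≡⟨ σ-relabel (old p) ⟩
      relabel t (old (σY p))      ∎)
      where open ≡-Reasoning

    s₁ : Sub₁.Suppressed θ
    s₁ = Sub₁.suppress θθ θ≢ λ e → case trans (sym (θθ d₀)) (trans (cong θ e) θd₁) of λ ()
    module A = Sub₁.Suppressed s₁

    τ₁d₂ : A.τ (inj₂ false) ≡ inj₁ p
    τ₁d₂ = Sub₁.sub-old {y = A.y} (trans (sym (A.sub≗ d₂)) θd₂)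

    s₀ : Sub₀.Suppressed A.τ
    s₀ = Sub₀.suppress A.ττ A.τ≢ λ e → case trans (sym e) τ₁d₂ of λ ()
    module B = Sub₀.Suppressed s₀

    y≡p : B.y ≡ p
    y≡p = inj₁-injective (trans (sym (B.sub≗ (inj₂ false))) τ₁d₂)

    end : A.y ≡ bigonEnd σY B.τ p
    end = begin
      A.y                          ≡⟨ A.ττ A.y ⟨
      A.τ (A.τ A.y)                ≡⟨ cong A.τ (inj₁-injective (trans (sym (A.sub≗ d₁)) θd₁)) ⟩
      A.τ (inj₁ (σY p))            ≡⟨ B.sub≗ (inj₁ (σY p)) ⟩
      Sub₀.sub B.τ B.y (inj₁ (σY p)) ≡⟨ cong (λ y → Sub₀.sub B.τ y (inj₁ (σY p))) y≡p ⟩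
      bigonEnd σY B.τ p            ∎
      where open ≡-Reasoning

    θ≗join : ∀ w → θ w ≡ join B.τ p (bigonEnd σY B.τ p) w
    θ≗join w = trans (A.sub≗ w) (trans (Sub₁.sub-cong B.sub≗ A.y w)
      (cong₂ (λ y z → Sub₁.sub (Sub₀.sub B.τ y) z w) y≡p end))

  bigonReduction : BigonReduction σ τ x
  bigonReduction = record
    { t = t ; σY = σY ; τY = B.τ ; fvY = fourValentY B.ττ B.τ≢ ; y = p
    ; σ-relabel = σ-relabel
    ; τ-relabel = λ w → trans (τ-relabel w) (cong (relabel t) (θ≗join w))
    ; at₂ = at₂ ; at-y = at-p }

-- The listed flags form a colour class, which by connectedness is everything. This serves to rule
-- out curves that are too small for the configuration considered.
closed-list : ∀ {m} {χ τ : Fin m → Fin m} → (∀ x → χ (χ x) ≡ x) → (∀ x → τ (τ x) ≡ x) → Connected χ τ →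
              ∀ x xs → (∀ {z} → z ∈ x ∷ xs → χ z ∈ x ∷ xs) → (∀ {z} → z ∈ x ∷ xs → τ z ∈ x ∷ xs) → m ≤ suc (length xs)
closed-list {m} {χ} {τ} χχ ττ conn x xs cχ cτ = subst (_≤ suc (length xs)) (length-allFin m)
  (length-⊆ (allFin⁺ m) λ {z} _ → mem⁻ (trans (conn mem (inv χχ cχ) (inv ττ cτ) z x) (mem⁺ (here refl))))
  where
  open import Data.List.Membership.DecPropositional (Fin._≟_ {m}) using (_∈?_)
  mem : Fin m → Bool
  mem z = ⌊ z ∈? (x ∷ xs) ⌋
  mem⁺ : ∀ {z} → z ∈ x ∷ xs → mem z ≡ true
  mem⁺ {z} i with z ∈? (x ∷ xs)
  ... | yes _ = refl
  ... | no n  = ⊥-elim (n i)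
  mem⁻ : ∀ {z} → mem z ≡ true → z ∈ x ∷ xs
  mem⁻ {z} e with z ∈? (x ∷ xs)
  ... | yes i = i
  inv : ∀ {f : Fin m → Fin m} → (∀ x → f (f x) ≡ x) → (∀ {z} → z ∈ x ∷ xs → f z ∈ x ∷ xs) → Inv mem f
  inv {f} ff cl z with mem z in e
  ... | true  = mem⁺ (cl (mem⁻ e))
  ... | false = ≢true⇒≡false λ e′ → true≢false (trans (sym (mem⁺ (subst (_∈ x ∷ xs) (ff z) (cl (mem⁻ e′))))) e)

module Pullback {m} {σ τ : Fin (4 + m) → Fin (4 + m)} {x : Fin (4 + m)}
                (R : BigonReduction σ τ x)
                (c : Fin m → Bool) (iτ : Inv c (BigonReduction.τY R)) where
  open BigonReduction R
  open FourValent fvY using () renaming (ττ to ττY; τ≢ to τ≢Y)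
  private
    module S₀ = Sub₀.Properties ττY τ≢Y y
    module S₁ = Sub₁.Properties S₀.sub-involutive S₀.sub-fixfree (bigonEnd σY τY y)

    c₀ : Fin m ⊎ Bool → Bool
    c₀ = c ∘ S₀.collapse

    i₀ : Inv c₀ (Sub₀.sub τY y)
    i₀ = S₀.collapse-sub c iτ

    cS : Flags m → Bool
    cS = c₀ ∘ S₁.collapse

  abstract
    -- Each removed flag takes the colour of the edge on which its strand lies. The result is
    -- constant on the smoothed strands but need not agree across the removed crossing.
    pull : Fin (4 + m) → Bool
    pull = cS ∘ unlabel t

    pull-relabel : ∀ w → pull (relabel t w) ≡ cS w
    pull-relabel w = cong cS (unlabel-relabel t w)

  pull-old : ∀ w → pull (relabel t (old w)) ≡ c w
  pull-old w = pull-relabel (old w)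

  pull-τ : Inv pull τ
  pull-τ w = begin
    pull (τ w)                                    ≡⟨ cong (pull ∘ τ) (relabel-unlabel t w) ⟨
    pull (τ (relabel t (unlabel t w)))            ≡⟨ cong pull (τ-relabel (unlabel t w)) ⟩
    pull (relabel t (join τY y _ (unlabel t w)))  ≡⟨ pull-relabel _ ⟩
    cS (join τY y _ (unlabel t w))                ≡⟨ S₁.collapse-sub c₀ i₀ (unlabel t w) ⟩
    cS (unlabel t w)                              ≡⟨ pull-relabel _ ⟨
    pull (relabel t (unlabel t w))                ≡⟨ cong pull (relabel-unlabel t w) ⟩
    pull w                                        ∎
    where open ≡-Reasoning

  at₃ : relabel t d₃ ≡ σ x
  at₃ = trans (sym (σ-relabel d₂)) (cong σ at₂)
  at₀ : relabel t d₀ ≡ σ (σ x)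
  at₀ = trans (sym (σ-relabel d₃)) (cong σ at₃)
  at₁ : relabel t d₁ ≡ σ (σ (σ x))
  at₁ = trans (sym (σ-relabel d₀)) (cong σ at₀)

  pull-strand : pull x ≡ pull (σ x)
  pull-strand = trans (cong pull (sym at₂)) (trans (trans (pull-relabel d₂) (trans (sym (iτ y)) (sym (pull-relabel d₃)))) (cong pull at₃))

  pull-strand′ : pull (σ (σ x)) ≡ pull (σ (σ (σ x)))
  pull-strand′ = trans (cong pull (sym at₀)) (trans (trans (pull-relabel d₀)
    (trans (sym (i₀ (bigonEnd σY τY y))) (sym (pull-relabel d₁)))) (cong pull at₁))

  view : ∀ {w} → w ≢ x → w ≢ σ x → w ≢ σ (σ x) → w ≢ σ (σ (σ x)) → ∃ λ u → w ≡ relabel t (old u)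
  view {w} n₂ n₃ n₀ n₁ = go (unlabel t w) refl
    where
    back : ∀ {d} → unlabel t w ≡ d → w ≡ relabel t d
    back e = trans (sym (relabel-unlabel t w)) (cong (relabel t) e)
    go : ∀ d → unlabel t w ≡ d → ∃ λ u → w ≡ relabel t (old u)
    go (old u) e = u , back e
    go d₀ e = ⊥-elim (n₀ (trans (back e) at₀))
    go d₁ e = ⊥-elim (n₁ (trans (back e) at₁))
    go d₂ e = ⊥-elim (n₂ (trans (back e) at₂))
    go d₃ e = ⊥-elim (n₃ (trans (back e) at₃))

  old≢ : ∀ u → relabel t (old u) ≢ x × relabel t (old u) ≢ σ x × relabel t (old u) ≢ σ (σ x) × relabel t (old u) ≢ σ (σ (σ x))
  old≢ u = (λ e → case relabel-inj t (trans e (sym at₂)) of λ ()) , (λ e → case relabel-inj t (trans e (sym at₃)) of λ ())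
         , (λ e → case relabel-inj t (trans e (sym at₀)) of λ ()) , (λ e → case relabel-inj t (trans e (sym at₁)) of λ ())

τY-old : ∀ {m} {σ τ : Fin (4 + m) → Fin (4 + m)} {x} (R : BigonReduction σ τ x) → let open BigonReduction R in
         ∀ {a b} → τ (relabel t (old a)) ≡ relabel t (old b) → τY a ≡ b
τY-old R e = Sub₀.sub-old {y = y} (Sub₁.sub-old {y = bigonEnd σY τY y}
  (relabel-inj t (trans (sym (τ-relabel (old _))) e)))
  where open BigonReduction R

-- Two consecutive bigons: three crossings in a row are replaced by one.

module Twist {m} {σ τ : Fin (4 + (4 + m)) → Fin (4 + (4 + m))} (cv : IsCurve σ τ) (y₀ : Fin m) (x : Fin (4 + (4 + m)))
             (b₁ : σ (τ (σ (τ x))) ≡ x) (n₁ : σ (τ x) ≢ x)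
             (b₂ : σ (τ (σ (τ (σ (σ x))))) ≡ σ (σ x)) (n₂ : σ (τ (σ (σ x))) ≢ σ (σ x)) where
  open IsCurve cv
  open FourValent fourValent

  z a′ : Fin (4 + (4 + m))
  z = σ (τ x)
  a′ = τ (σ (σ x))

  σ³z : σ (σ (σ z)) ≡ τ x
  σ³z = σ⁴ (τ x)

  τz : τ z ≡ σ (σ (σ x))
  τz = σ-inj (trans b₁ (sym (σ⁴ x)))

  τσ³x : τ (σ (σ (σ x))) ≡ z
  τσ³x = trans (cong τ (sym τz)) (ττ z)

  τσa′ : τ (σ a′) ≡ σ x
  τσa′ = σ-inj b₂

  rotate : ∀ {v w} → σ (σ (σ v)) ≡ w → v ≡ σ w
  rotate e = trans (sym (σ⁴ _)) (cong σ e)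

  -- Otherwise the crossing of `x` would be closed under τ and be the whole curve, which has at
  -- least eight flags.
  τx≢σx : τ x ≢ σ x
  τx≢σx e = ≤⇒≯ (closed-list {χ = σ ∘ σ} σ⁴ ττ connected x (σ x ∷ σ (σ x) ∷ σ (σ (σ x)) ∷ []) cχ cτ) (s≤s (s≤s (s≤s (s≤s (s≤s z≤n)))))
    where
    cχ : ∀ {w} → w ∈ x ∷ σ x ∷ σ (σ x) ∷ σ (σ (σ x)) ∷ [] → σ (σ w) ∈ x ∷ σ x ∷ σ (σ x) ∷ σ (σ (σ x)) ∷ []
    cχ (here refl) = there (there (here refl))
    cχ (there (here refl)) = there (there (there (here refl)))
    cχ (there (there (here refl))) = here (σ⁴ x)
    cχ (there (there (there (here refl)))) = there (here (cong σ (σ⁴ x)))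
    z≡ : z ≡ σ (σ x)
    z≡ = cong σ e
    cτ : ∀ {w} → w ∈ x ∷ σ x ∷ σ (σ x) ∷ σ (σ (σ x)) ∷ [] → τ w ∈ x ∷ σ x ∷ σ (σ x) ∷ σ (σ (σ x)) ∷ []
    cτ (here refl) = there (here e)
    cτ (there (here refl)) = here (trans (cong τ (sym e)) (ττ x))
    cτ (there (there (here refl))) = there (there (there (here (trans (cong τ (sym z≡)) τz))))
    cτ (there (there (there (here refl)))) = there (there (here (trans τσ³x z≡)))

  x≢0 : x ≢ z
  x≢0 e = n₁ (sym e)
  x≢1 : x ≢ σ z
  x≢1 e = τ≢ z (trans τz (trans (cong (σ ∘ σ ∘ σ) e) (σ⁴ z)))
  x≢2 : x ≢ σ (σ z)
  x≢2 e = τx≢σx (sym (trans (cong σ e) σ³z))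
  x≢3 : x ≢ σ (σ (σ z))
  x≢3 e = τ≢ x (sym (trans e σ³z))

  first : BigonReduction σ τ z
  first = Bigon.bigonReduction fourValent z
    (cong (σ ∘ τ) (trans (cong σ τz) (σ⁴ x)))
    (λ e → x≢2 (rotate (trans (sym τz) e))) (λ e → x≢3 (rotate (trans (sym τz) e)))
    (λ e → x≢0 (σ-inj (σ-inj (σ-inj (trans (sym τz) e)))))

  module Second (R : BigonReduction σ τ z) where
    open BigonReduction R
    private
      module Y = FourValent fvY
      module P = Pullback R (λ _ → true) (λ _ → refl)

    ι : Fin (4 + m) → Fin (4 + (4 + m))
    ι w = relabel t (old w)

    ι-σ : ∀ {w u} → w ≡ ι u → σ w ≡ ι (σY u)
    ι-σ e = trans (cong σ e) (σ-relabel (old _))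

    ι-inj : ∀ {u w} → ι u ≡ ι w → u ≡ w
    ι-inj e = inj₁-injective (inj₁-injective (relabel-inj t e))

    v : Fin (4 + m)
    v = σY (σY (σY y))

    at-σ³x : σ (σ (σ x)) ≡ ι y
    at-σ³x = trans (sym τz) (sym at-y)
    at-x : x ≡ ι (σY y)
    at-x = trans (sym (σ⁴ x)) (ι-σ at-σ³x)
    at-σx : σ x ≡ ι (σY (σY y))
    at-σx = ι-σ at-x
    at-v : σ (σ x) ≡ ι v
    at-v = ι-σ at-σx

    -- Otherwise both bigons would lead to the crossing of `z`, and the curve would consist of two
    -- crossings. These have eight flags, and `y₀` provides for a ninth.
    a′≢1 : a′ ≢ σ z
    a′≢1 e = ≤⇒≯ (closed-list {χ = σ ∘ σ} σ⁴ ττ connected x rest cχ cτ) (s≤s (s≤s (s≤s (s≤s (s≤s (s≤s (s≤s (s≤s (0<m y₀)))))))))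
      where
      0<m : ∀ {k} → Fin k → 0 < k
      0<m {suc k} _ = s≤s z≤n
      rest : List (Fin (4 + (4 + m)))
      rest = σ x ∷ σ (σ x) ∷ σ (σ (σ x)) ∷ z ∷ σ z ∷ σ (σ z) ∷ σ (σ (σ z)) ∷ []
      cχ : ∀ {w} → w ∈ x ∷ rest → σ (σ w) ∈ x ∷ rest
      cχ (here refl) = there (there (here refl))
      cχ (there (here refl)) = there (there (there (here refl)))
      cχ (there (there (here refl))) = here (σ⁴ x)
      cχ (there (there (there (here refl)))) = there (here (cong σ (σ⁴ x)))
      cχ (there (there (there (there (here refl))))) = there (there (there (there (there (there (here refl))))))
      cχ (there (there (there (there (there (here refl)))))) = there (there (there (there (there (there (there (here refl)))))))
      cχ (there (there (there (there (there (there (here refl))))))) = there (there (there (there (here (σ⁴ z)))))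
      cχ (there (there (there (there (there (there (there (here refl)))))))) = there (there (there (there (there (here (cong σ (σ⁴ z)))))))
      τσz : τ (σ z) ≡ σ (σ x)
      τσz = trans (cong τ (sym e)) (ττ _)
      τσσz : τ (σ (σ z)) ≡ σ x
      τσσz = trans (cong (τ ∘ σ) (sym e)) τσa′
      cτ : ∀ {w} → w ∈ x ∷ rest → τ w ∈ x ∷ rest
      cτ (here refl) = there (there (there (there (there (there (there (here (sym σ³z))))))))
      cτ (there (here refl)) = there (there (there (there (there (there (here (trans (cong τ (sym τσσz)) (ττ _))))))))
      cτ (there (there (here refl))) = there (there (there (there (there (here e)))))
      cτ (there (there (there (here refl)))) = there (there (there (there (here τσ³x))))
      cτ (there (there (there (there (here refl))))) = there (there (there (here τz)))
      cτ (there (there (there (there (there (here refl)))))) = there (there (here τσz))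
      cτ (there (there (there (there (there (there (here refl))))))) = there (here τσσz)
      cτ (there (there (there (there (there (there (there (here refl)))))))) = here (trans (cong τ σ³z) (ττ x))

    a′-old : ∃ λ p′ → a′ ≡ ι p′
    a′-old = P.view
      (λ e → σ≢ x (sym (σ-inj (σ-inj (trans (trans (sym (ττ _)) (cong τ e)) τz)))))
      a′≢1
      (λ e → σ≢ x (trans (sym τσa′) (trans (cong (τ ∘ σ) e) (trans (cong τ σ³z) (ττ x)))))
      (λ e → σσ≢ x (trans (sym (ττ _)) (trans (cong τ (trans e σ³z)) (ττ x))))

    p′ : Fin (4 + m)
    p′ = proj₁ a′-old
    at-a′ : a′ ≡ ι p′
    at-a′ = proj₂ a′-old

    τYv : τY v ≡ p′
    τYv = τY-old R (trans (cong τ (sym at-v)) at-a′)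

    τYσp′ : τY (σY p′) ≡ σY (σY y)
    τYσp′ = τY-old R (trans (cong τ (sym (ι-σ at-a′))) (trans τσa′ at-σx))

    -- The middle crossing survives the first removal as the vertex of `y`. There `v` is the former
    -- `σ (σ x)`, the corner of the other bigon.
    second : BigonReduction σY τY v
    second = Bigon.bigonReduction fvY v
      (trans (cong (σY ∘ τY ∘ σY) τYv) (cong σY τYσp′))
      (λ e → x≢2 (rotate (cong σ (τ-inj (trans (trans at-a′ (cong ι (trans (trans (sym τYv) e) (Y.σ⁴ y)))) at-y)))))
      (λ e → τ≢ z (trans τz (cong σ (trans (sym (ττ _)) (cong τ
        (trans at-a′ (trans (cong ι (trans (trans (sym τYv) e) (cong σY (Y.σ⁴ y)))) (sym at-x))))))))
      (λ e → n₂ (cong σ (trans at-a′ (trans (cong ι (trans (trans (sym τYv) e) (cong (σY ∘ σY) (Y.σ⁴ y)))) (sym at-σx)))))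

    module Third (R₂ : BigonReduction σY τY v) where
      private
        module Z = BigonReduction R₂

      module Colour (c : Fin m → Bool) (iχ : Inv c (Z.σY ∘ Z.σY)) (iτ : Inv c Z.τY) where
        private
          module P₂ = Pullback R₂ c iτ
          module P₁ = Pullback R P₂.pull P₂.pull-τ
          C : Fin (4 + (4 + m)) → Bool
          C = P₁.pull

        strand₁ : C z ≡ C (σ z)
        strand₁ = P₁.pull-strand
        strand₂ : C (σ (σ z)) ≡ C (σ (σ (σ z)))
        strand₂ = P₁.pull-strand′

        C-ι : ∀ {w u} → w ≡ ι u → C w ≡ P₂.pull u
        C-ι e = trans (cong C e) (P₁.pull-old _)

        strand₃ : C (σ (σ x)) ≡ C (σ (σ (σ x)))
        strand₃ = trans (C-ι at-v) (trans P₂.pull-strand (sym (trans (C-ι at-σ³x) (cong P₂.pull (sym (Y.σ⁴ y))))))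
        strand₄ : C x ≡ C (σ x)
        strand₄ = trans (C-ι at-x) (trans (cong P₂.pull (cong σY (sym (Y.σ⁴ y)))) (trans P₂.pull-strand′
                    (trans (cong P₂.pull (cong (σY ∘ σY) (Y.σ⁴ y))) (sym (C-ι at-σx)))))

        away : ∀ {w} → w ≢ z → w ≢ σ z → w ≢ σ (σ z) → w ≢ σ (σ (σ z)) →
               w ≢ x → w ≢ σ x → w ≢ σ (σ x) → w ≢ σ (σ (σ x)) → C (σ (σ w)) ≡ C w
        away a b c′ d e f g h with P₁.view a b c′ d
        ... | u , refl with P₂.view {u}
              (λ { refl → g (sym at-v) })
              (λ { refl → h (sym (ι-σ at-v)) })
              (λ { refl → e (sym (trans (sym (σ⁴ x)) (ι-σ (ι-σ at-v)))) })
              (λ { refl → f (sym (trans (sym (cong σ (σ⁴ x))) (ι-σ (ι-σ (ι-σ at-v))))) })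
        ...   | r , refl = trans (C-ι (ι-σ (ι-σ refl))) (trans (cong P₂.pull (trans (cong σY (Z.σ-relabel (old r))) (Z.σ-relabel _)))
                  (trans (P₂.pull-old _) (trans (iχ r) (sym (trans (C-ι refl) (P₂.pull-old r))))))

        open import Data.List.Membership.DecPropositional (Fin._≟_ {4 + (4 + m)}) using (_∈?_)

        B : List (Fin (4 + (4 + m)))
        B = τ x ∷ x ∷ z ∷ σ (σ (σ x)) ∷ []

        B-τ : ∀ {w} → w ∈ B → τ w ∈ B
        B-τ (here refl) = there (here (ττ x))
        B-τ (there (here refl)) = here refl
        B-τ (there (there (here refl))) = there (there (there (here τz)))
        B-τ (there (there (there (here refl)))) = there (there (here τσ³x))

        -- The flags opposite to those of the bigon lie outside it, so the colours that `C̃` borrows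
        -- from them are unmodified values of `C`.
        B-apart : ∀ {w} → w ∈ B → σ (σ w) ∉ B
        B-apart (here refl) i = σz∉ i
          where
          σz∉ : σ z ∉ B
          σz∉ (here e) = σσ≢ z (σ-inj (trans σ³z (sym e)))
          σz∉ (there (here e)) = x≢1 (sym e)
          σz∉ (there (there (here e))) = σ≢ z e
          σz∉ (there (there (there (here e)))) = x≢2 (rotate (sym e))
        B-apart (there (here refl)) (here e) = x≢1 (trans (sym (σ⁴ x)) (trans (cong (σ ∘ σ) (trans e (sym σ³z))) (cong σ (σ⁴ z))))
        B-apart (there (here refl)) (there (here e)) = σσ≢ x e
        B-apart (there (here refl)) (there (there (here e))) = x≢2 (rotate (cong σ e))
        B-apart (there (here refl)) (there (there (there (here e)))) = σ≢ x (sym (σ-inj (σ-inj e)))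
        B-apart (there (there (here refl))) (here e) = σ≢ z (sym (σ-inj (σ-inj (trans e (sym σ³z)))))
        B-apart (there (there (here refl))) (there (here e)) = x≢2 (sym e)
        B-apart (there (there (here refl))) (there (there (here e))) = σσ≢ z e
        B-apart (there (there (here refl))) (there (there (there (here e)))) = x≢3 (rotate (sym e))
        B-apart (there (there (there (here refl)))) i = σx∉ (subst (_∈ B) (cong σ (σ⁴ x)) i)
          where
          σx∉ : σ x ∉ B
          σx∉ (here e) = τx≢σx (sym e)
          σx∉ (there (here e)) = σ≢ x e
          σx∉ (there (there (here e))) = x≢3 (rotate (trans (cong (σ ∘ σ ∘ σ) (trans (sym (σ⁴ x)) (cong (σ ∘ σ ∘ σ) e))) (cong (σ ∘ σ) (σ⁴ z))))
          σx∉ (there (there (there (here e)))) = σσ≢ x (sym (σ-inj e))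

        -- Both twists join the outer ends in the same way, but the strands along the bigon trade places:
        -- its four flags take the colour found across their crossing.
        C̃ : Fin (4 + (4 + m)) → Bool
        C̃ w with w ∈? B
        ... | yes _ = C (σ (σ w))
        ... | no  _ = C w

        C̃-yes : ∀ {w} → w ∈ B → C̃ w ≡ C (σ (σ w))
        C̃-yes {w} i with w ∈? B
        ... | yes _ = refl
        ... | no n  = ⊥-elim (n i)

        C̃-no : ∀ {w} → w ∉ B → C̃ w ≡ C w
        C̃-no {w} n with w ∈? B
        ... | yes i = ⊥-elim (n i)
        ... | no _  = refl

        C̃-χ : Inv C̃ (σ ∘ σ)
        C̃-χ w = go (w ∈? B) (σ (σ w) ∈? B)
          where
          go : Dec (w ∈ B) → Dec (σ (σ w) ∈ B) → C̃ (σ (σ w)) ≡ C̃ w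
          go (yes i) _ = trans (C̃-no (B-apart i)) (sym (C̃-yes i))
          go (no n) (yes j) = trans (C̃-yes j) (trans (cong C (σ⁴ w)) (sym (C̃-no n)))
          go (no n) (no k) = trans (C̃-no k) (trans (away
            (λ e → n (there (there (here e))))
            (λ e → k (here (trans (cong (σ ∘ σ) e) σ³z)))
            (λ e → k (there (there (here (trans (cong (σ ∘ σ) e) (σ⁴ z))))))
            (λ e → n (here (trans e σ³z)))
            (λ e → n (there (here e)))
            (λ e → k (there (there (there (here (cong (σ ∘ σ) e))))))
            (λ e → k (there (here (trans (cong (σ ∘ σ) e) (σ⁴ x)))))
            (λ e → n (there (there (there (here e)))))) (sym (C̃-no n)))

        -- `C` follows the smoothed strands, here from the crossing of `z` along an edge of the
        -- bigon to that of `x`. Hence the colours borrowed at the two ends of the other edge agree.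
        swap₁ : C (σ z) ≡ C (σ (σ x))
        swap₁ = trans (sym strand₁) (trans (sym (P₁.pull-τ z)) (trans (cong C τz) (sym strand₃)))

        swap₂ : C (σ (σ z)) ≡ C (σ (σ (σ (σ (σ x)))))
        swap₂ = trans strand₂ (trans (cong C σ³z) (trans (P₁.pull-τ x) (trans strand₄ (cong C (cong σ (sym (σ⁴ x)))))))

        C̃-τ : Inv C̃ τ
        C̃-τ w = go (w ∈? B)
          where
          values : ∀ {w} → w ∈ B → C (σ (σ (τ w))) ≡ C (σ (σ w))
          values (here refl) = trans (cong (C ∘ σ ∘ σ) (ττ x)) (sym swap₁)
          values (there (here refl)) = swap₁
          values (there (there (here refl))) = trans (cong (C ∘ σ ∘ σ) τz) (sym swap₂)
          values (there (there (there (here refl)))) = trans (cong (C ∘ σ ∘ σ) τσ³x) swap₂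
          go : Dec (w ∈ B) → C̃ (τ w) ≡ C̃ w
          go (yes i) = trans (C̃-yes (B-τ i)) (trans (values i) (sym (C̃-yes i)))
          go (no n)  = trans (C̃-no (λ i → n (subst (_∈ B) (ττ w) (B-τ i)))) (trans (P₁.pull-τ w) (sym (C̃-no n)))

        outside : ∀ r → ι (relabel Z.t (old r)) ∉ B
        outside r (here e) = proj₂ (proj₂ (proj₂ (P₁.old≢ _))) (trans e (sym σ³z))
        outside r (there (here e)) = proj₁ (proj₂ (proj₂ (P₂.old≢ r))) (ι-inj (trans e (trans (sym (σ⁴ x)) (ι-σ (ι-σ at-v)))))
        outside r (there (there (here e))) = proj₁ (P₁.old≢ _) e
        outside r (there (there (there (here e)))) = proj₁ (proj₂ (P₂.old≢ r)) (ι-inj (trans e (ι-σ at-v)))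

        value : ∀ r → c r ≡ C̃ (ι (relabel Z.t (old r)))
        value r = sym (trans (C̃-no (outside r)) (trans (C-ι refl) (P₂.pull-old r)))

        constant : ∀ a b → c a ≡ c b
        constant a b = trans (value a) (trans (connected C̃ C̃-χ C̃-τ (ι (relabel Z.t (old a))) (ι (relabel Z.t (old b)))) (sym (value b)))

      connZ : Connected (Z.σY ∘ Z.σY) Z.τY
      connZ = Colour.constant

      private
        module E₁ = Expansion fvY y (bigonEnd σY τY y) t
        module E₂ = Expansion Z.fvY Z.y (bigonEnd Z.σY Z.τY Z.y) Z.t

        faces₁ : numCycles (σ ∘ τ) ≤ suc (numCycles (σY ∘ τY))
        faces₁ = ≤-trans (faces-≗ fourValent E₁.fourValent
          (λ w → trans (cong σ (sym (relabel-unlabel t w))) (σ-relabel _))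
          (λ w → trans (cong τ (sym (relabel-unlabel t w))) (τ-relabel _))) E₁.faces-down

        faces₂ : numCycles (σY ∘ τY) ≤ suc (numCycles (Z.σY ∘ Z.τY))
        faces₂ = ≤-trans (faces-≗ fvY E₂.fourValent
          (λ w → trans (cong σY (sym (relabel-unlabel Z.t w))) (Z.σ-relabel _))
          (λ w → trans (cong τY (sym (relabel-unlabel Z.t w))) (Z.τ-relabel _))) E₂.faces-down

        planar-down₂ : ∀ {k f g h} → 4 * f ≡ (4 + (4 + k)) + 8 → f ≤ suc g → g ≤ suc h → k + 8 ≤ 4 * h
        planar-down₂ {k} {f} {g} {h} pl le le′ = +-cancelˡ-≤ 4 _ _ (≤-trans (planar-down {4 + k} pl le)
          (≤-trans (*-monoʳ-≤ 4 le′) (≤-reflexive (*-suc 4 h))))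

      -- The two removals lose at most two faces together. Euler's inequality is applied only to the
      -- final map, because nothing is known about the connectedness of the one in between.
      curveZ : IsCurve Z.σY Z.τY
      curveZ = record { fourValent = Z.fvY ; connected = connZ
        ; planar = ≤-antisym (Euler.euler Z.fvY (connected-σ connZ)) (planar-down₂ planar faces₁ faces₂) }

-- The Boolean predicate of plane curves

-- The conjunction of `isPlaneCurve`, with the numbers of flags and faces as separate parameters:
-- sizes like `4 + m` and `suc f` are then at hand, while `4 * suc n` does not compute to
-- `4 + 4 * n`.
isCurveᵇ : ∀ {m} → ℕ → Maps m → Bool
isCurveᵇ f (σ , τ) =
  isFourCycles σ ∧ isFPFInvolution τ ∧ isTransitive σ τ
  ∧ (numCycles (στ σ τ) ≡ᵇ f)
  ∧ (numCycles (λ x → σ (σ (τ x))) ≡ᵇ 2)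

isCurve⁻ : ∀ {m f} {σ τ : Fin m → Fin m} → 4 * f ≡ m + 8 → isCurveᵇ f (σ , τ) ≡ true → IsCurve σ τ
isCurve⁻ {m} {f} {σ} {τ} f-eq e = record
  { fourValent = fv
  ; connected  = Curve.two-cycles⇒connected {χ = σ ∘ σ} {τ} σ⁴ σσ≢ ττ τ≢ (≡ᵇ-true⁻ _ 2 two)
  ; planar     = trans (cong (4 *_) (≡ᵇ-true⁻ (numCycles (στ σ τ)) f faces)) f-eq }
  where
  split₁ : isFourCycles σ ≡ true × isFPFInvolution τ ∧ isTransitive σ τ ∧ (numCycles (στ σ τ) ≡ᵇ f) ∧ (numCycles (λ x → σ (σ (τ x))) ≡ᵇ 2) ≡ true
  split₁ = ∧-true⁻ e
  split₂ : isFPFInvolution τ ≡ true × isTransitive σ τ ∧ (numCycles (στ σ τ) ≡ᵇ f) ∧ (numCycles (λ x → σ (σ (τ x))) ≡ᵇ 2) ≡ true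
  split₂ = ∧-true⁻ (proj₂ split₁)
  split₃ : isTransitive σ τ ≡ true × (numCycles (στ σ τ) ≡ᵇ f) ∧ (numCycles (λ x → σ (σ (τ x))) ≡ᵇ 2) ≡ true
  split₃ = ∧-true⁻ (proj₂ split₂)
  faces : (numCycles (στ σ τ) ≡ᵇ f) ≡ true
  faces = proj₁ (∧-true⁻ (proj₂ split₃))
  two : (numCycles (λ x → σ (σ (τ x))) ≡ᵇ 2) ≡ true
  two = proj₂ (∧-true⁻ {numCycles (στ σ τ) ≡ᵇ f} (proj₂ split₃))
  four-at : ∀ x → (iter 4 σ x == x) ≡ true × not (σ x == x) ∧ not (iter 2 σ x == x) ≡ true
  four-at x = ∧-true⁻ (all⁻ (λ x → (iter 4 σ x == x) ∧ not (σ x == x) ∧ not (iter 2 σ x == x)) (proj₁ split₁) (∈-allFin x))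
  four-at′ : ∀ x → not (σ x == x) ≡ true × not (iter 2 σ x == x) ≡ true
  four-at′ x = ∧-true⁻ (proj₂ (four-at x))
  inv-at : ∀ x → (τ (τ x) == x) ≡ true × not (τ x == x) ≡ true
  inv-at x = ∧-true⁻ (all⁻ (λ x → (τ (τ x) == x) ∧ not (τ x == x)) (proj₁ split₂) (∈-allFin x))
  fv : FourValent σ τ
  fv = record
    { σ⁴  = λ x → ==⇒≡ (proj₁ (four-at x))
    ; σ≢  = λ x → ==false⇒≢ (not-true⁻ (proj₁ (four-at′ x)))
    ; σσ≢ = λ x → ==false⇒≢ (not-true⁻ (proj₂ (four-at′ x)))
    ; ττ  = λ x → ==⇒≡ (proj₁ (inv-at x))
    ; τ≢  = λ x → ==false⇒≢ (not-true⁻ (proj₂ (inv-at x))) }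
  open FourValent fv

isCurve⁺ : ∀ {m f} {σ τ : Fin m → Fin m} → 4 * f ≡ m + 8 → Fin m → IsCurve σ τ → isCurveᵇ f (σ , τ) ≡ true
isCurve⁺ {m} {f} {σ} {τ} f-eq x₀ cv =
  ∧-true⁺ (all⁺ _ (allFin m) λ {x} _ → ∧-true⁺ (≡⇒== (σ⁴ x)) (∧-true⁺ (cong not (≢⇒==false (σ≢ x))) (cong not (≢⇒==false (σσ≢ x)))))
  (∧-true⁺ (all⁺ _ (allFin m) λ {x} _ → ∧-true⁺ (≡⇒== (ττ x)) (cong not (≢⇒==false (τ≢ x))))
  (∧-true⁺ (Transitive.transitive fourValent (connected-σ connected))
  (∧-true⁺ (≡ᵇ-true⁺ {numCycles (στ σ τ)} {f} (*-cancelˡ-≡ (numCycles (στ σ τ)) f 4 (trans planar (sym f-eq))))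
           (≡ᵇ-true⁺ (Curve.connected⇒two-cycles {χ = σ ∘ σ} {τ} σ⁴ σσ≢ ττ τ≢ connected x₀)))))
  where
  open IsCurve cv
  open FourValent fourValent

fourValent-≗ : ∀ {m} {σ τ σ′ τ′ : Fin m → Fin m} → σ ≗ σ′ → τ ≗ τ′ → FourValent σ τ → FourValent σ′ τ′
fourValent-≗ {σ = σ} {τ} {σ′} {τ′} eσ eτ fv = record
  { σ⁴  = λ x → trans (sym (trans (cong (σ ∘ σ) (two x)) (two _))) (σ⁴ x)
  ; σ≢  = λ x e → σ≢ x (trans (eσ x) e)
  ; σσ≢ = λ x e → σσ≢ x (trans (two x) e)
  ; ττ  = λ x → trans (sym (trans (cong τ (eτ x)) (eτ _))) (ττ x)
  ; τ≢  = λ x e → τ≢ x (trans (eτ x) e) }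
  where
  open FourValent fv
  two : ∀ x → σ (σ x) ≡ σ′ (σ′ x)
  two x = trans (cong σ (eσ x)) (eσ _)

isCurve-≗ : ∀ {m} {σ τ σ′ τ′ : Fin m → Fin m} → σ ≗ σ′ → τ ≗ τ′ → IsCurve σ τ → IsCurve σ′ τ′
isCurve-≗ {σ = σ} {σ′ = σ′} eσ eτ cv = record
  { fourValent = fv′
  ; connected = λ c iχ iτ → connected c (λ x → trans (cong c (trans (cong σ (eσ x)) (eσ _))) (iχ x)) (λ x → trans (cong c (eτ x)) (iτ x))
  ; planar = trans (cong (4 *_) (≤-antisym (faces-≗ fv′ fourValent (λ x → sym (eσ x)) (λ x → sym (eτ x)))
                                           (faces-≗ fourValent fv′ eσ eτ))) planar }
  where
  open IsCurve cv
  fv′ = fourValent-≗ eσ eτ fourValent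

curves : ∀ m → ℕ → List (Code m)
curves m f = filterᵇ (isCurveᵇ f ∘ decode) (codes m)

curves-unique : ∀ m f → Unique (curves m f)
curves-unique m f = filterᵇ-unique _ (codes-unique m)

∈-curves⁻ : ∀ {m f} → 4 * f ≡ m + 8 → ∀ {v w} → (v , w) ∈ curves m f → IsCurve (lookup v) (lookup w)
∈-curves⁻ {m} {f} f-eq i = isCurve⁻ f-eq (proj₂ (∈-filterᵇ⁻ (isCurveᵇ f ∘ decode) (codes m) i))

∈-curves⁺ : ∀ {m f} → 4 * f ≡ m + 8 → Fin m → ∀ {σ τ} → IsCurve σ τ → encode (σ , τ) ∈ curves m f
∈-curves⁺ {m} {f} f-eq x₀ {σ} {τ} cv = ∈-filterᵇ⁺ (isCurveᵇ f ∘ decode) (∈-codes _)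
  (isCurve⁺ f-eq x₀ (isCurve-≗ (λ x → sym (lookup∘tabulate σ x)) (λ x → sym (lookup∘tabulate τ x)) cv))

code-ext : ∀ {m} (c c′ : Code m) → proj₁ (decode c) ≗ proj₁ (decode c′) → proj₂ (decode c) ≗ proj₂ (decode c′) → c ≡ c′
code-ext (v , w) (v′ , w′) p q = cong₂ _,_ (lookup-ext v v′ p) (lookup-ext w w′ q)

encode-inj : ∀ {m} (f g f′ g′ : Fin m → Fin m) → encode (f , g) ≡ encode (f′ , g′) → f ≗ f′ × g ≗ g′
encode-inj f g f′ g′ e =
  (λ x → trans (sym (lookup∘tabulate f x)) (trans (cong (λ c → lookup (proj₁ c) x) e) (lookup∘tabulate f′ x))) ,
  (λ x → trans (sym (lookup∘tabulate g x)) (trans (cong (λ c → lookup (proj₂ c) x) e) (lookup∘tabulate g′ x)))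

tags₂ : ∀ k → List (Tag₂ k)
tags₂ k = pairs (allFin (2 + k)) (allFin (1 + k))

tags : ∀ m → List (Tag m)
tags m = pairs (tags₂ (2 + m)) (tags₂ m)

tags-unique : ∀ m → Unique (tags m)
tags-unique m = pairs-unique (pairs-unique (allFin⁺ _) (allFin⁺ _)) (pairs-unique (allFin⁺ _) (allFin⁺ _))

∈-tags : ∀ {m} (t : Tag m) → t ∈ tags m
∈-tags ((a , b) , c , d) = ∈-pairs⁺ (∈-pairs⁺ (∈-allFin a) (∈-allFin b)) (∈-pairs⁺ (∈-allFin c) (∈-allFin d))

-- Lengths of cycles

module Lengths {m} {π : Fin m → Fin m} (inj : Inj π) where
  open Cycles inj

  cyc : Fin m → List (Fin m)
  cyc x = filterᵇ (inCycle π x) (allFin m)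

  cyc-unique : ∀ x → Unique (cyc x)
  cyc-unique x = filterᵇ-unique _ (allFin⁺ m)

  cyc⁺ : ∀ {x y} → Orb π x y → y ∈ cyc x
  cyc⁺ o = ∈-filterᵇ⁺ _ (∈-allFin _) (inCycle⁺ o)

  cyc⁻ : ∀ {x y} → y ∈ cyc x → Orb π x y
  cyc⁻ {x} i = inCycle⁻ (proj₂ (∈-filterᵇ⁻ (inCycle π x) (allFin m) i))

  cycleLength-list : ∀ {x xs} → Unique xs → (∀ {y} → y ∈ xs → Orb π x y) → (∀ {y} → Orb π x y → y ∈ xs) →
                     cycleLength π x ≡ length xs
  cycleLength-list u to from = ≤-antisym (length-⊆ (cyc-unique _) (from ∘ cyc⁻)) (length-⊆ u (cyc⁺ ∘ to))

  cycleLength-orb : ∀ {x y} → Orb π x y → cycleLength π x ≡ cycleLength π y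
  cycleLength-orb {x} {y} o = cycleLength-list (cyc-unique y) (λ i → orb-trans o (cyc⁻ i)) (λ p → cyc⁺ (orb-trans (orb-sym o) p))

  short-period : ∀ {x k} → cycleLength π x ≤ k → ∃ λ d → suc d ≤ k × iter (suc d) π x ≡ x
  short-period {x} {k} le with Fin.pigeonhole (s≤s le) (λ (i : Fin (suc k)) → Any.index (cyc⁺ {x} (toℕ i , refl)))
  ... | i , j , i<j , eq = go (toℕ j ∸ toℕ i) refl
    where
    same : iter (toℕ i) π x ≡ iter (toℕ j) π x
    same = trans (lookup-index (cyc⁺ {x} (toℕ i , refl))) (trans (cong (List.lookup (cyc x)) eq) (sym (lookup-index (cyc⁺ {x} (toℕ j , refl)))))
    go : ∀ n → toℕ j ∸ toℕ i ≡ n → ∃ λ d → suc d ≤ k × iter (suc d) π x ≡ x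
    go zero    e = ⊥-elim (<⇒≢ (m<n⇒0<n∸m i<j) (sym e))
    go (suc d) e = d , subst (_≤ k) e (≤-trans (m∸n≤m (toℕ j) (toℕ i)) (≤-pred (toℕ<n j)))
                     , subst (λ n → iter n π x ≡ x) e (cancel i<j same)

  count-cycles : ∀ k → length (filterᵇ (λ y → cycleLength π y ≡ᵇ k) (allFin m)) ≤ numCyclesOfLength k π * k
  count-cycles k = ≤-trans (length-⊆ (filterᵇ-unique _ (allFin⁺ m)) into)
    (≤-trans (≤-reflexive (length-concatMap cyc long))
    (≤-trans (sum-mono (length ∘ cyc) (λ _ → k) long (λ i → ≤-reflexive (long⁻ i))) (≤-reflexive (sum-const k long))))
    where
    p : Fin m → Bool
    p x = isCycleRep π x ∧ (cycleLength π x ≡ᵇ k)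
    long : List (Fin m)
    long = filterᵇ p (allFin m)
    long⁻ : ∀ {x} → x ∈ long → cycleLength π x ≡ k
    long⁻ {x} i = ≡ᵇ-true⁻ _ k (proj₂ (∧-true⁻ {isCycleRep π x} (proj₂ (∈-filterᵇ⁻ p (allFin m) i))))
    into : ∀ {y} → y ∈ filterᵇ (λ y → cycleLength π y ≡ᵇ k) (allFin m) → y ∈ concatMap cyc long
    into {y} i = ∈-concatMap cyc
      (∈-filterᵇ⁺ p (∈-allFin (rep y)) (∧-true⁺ (rep-isRep y) (≡ᵇ-true⁺ (trans (sym (cycleLength-orb (rep-orb y)))
        (≡ᵇ-true⁻ _ k (proj₂ (∈-filterᵇ⁻ (λ y → cycleLength π y ≡ᵇ k) (allFin m) i))))))) (cyc⁺ (orb-sym (rep-orb y)))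

-- Curls produce faces of every degree

-- A curl also lengthens the face on the far side of its edge. Marking only edges that border
-- another face there makes the degree grow by exactly one, and the condition survives the curl.
faceᵇ : ∀ {m} → ℕ → Code m → Fin m → Bool
faceᵇ j (v , w) y = (cycleLength (στ (lookup v) (lookup w)) y ≡ᵇ j) ∧ not (inCycle (στ (lookup v) (lookup w)) y (lookup w y))

marked : ∀ m → ℕ → ℕ → List (Code m × Fin m)
marked m f j = fibres (faceᵇ j) (curves m f) (allFin m)

∈-fibres⁻ : ∀ {A B : Set} (p : A → B → Bool) xs ys {x y} → (x , y) ∈ fibres p xs ys → x ∈ xs × p x y ≡ true
∈-fibres⁻ p xs ys i = let (j , e) = ∈-filterᵇ⁻ _ (pairs xs ys) i in proj₁ (∈-pairs⁻ xs ys j) , e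

∈-fibres⁺ : ∀ {A B : Set} (p : A → B → Bool) {xs ys x y} → x ∈ xs → y ∈ ys → p x y ≡ true → (x , y) ∈ fibres p xs ys
∈-fibres⁺ p i j e = ∈-filterᵇ⁺ _ (∈-pairs⁺ i j) e

fibres-unique : ∀ {A B : Set} (p : A → B → Bool) {xs ys} → Unique xs → Unique ys → Unique (fibres p xs ys)
fibres-unique p u v = filterᵇ-unique _ (pairs-unique u v)

length-filterᵇ : ∀ {A : Set} (p : A → Bool) xs → length (filterᵇ p xs) ≤ length xs
length-filterᵇ p []       = z≤n
length-filterᵇ p (x ∷ xs) with p x
... | true  = s≤s (length-filterᵇ p xs)
... | false = m≤n⇒m≤1+n (length-filterᵇ p xs)

marked≤ : ∀ m f j → length (marked m f j) ≤ length (curves m f) * m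
marked≤ m f j = ≤-trans (length-filterᵇ _ (pairs (curves m f) (allFin m)))
  (≤-reflexive (trans (length-pairs (curves m f) _) (cong (length (curves m f) *_) (length-allFin m))))

insertCode : ∀ {m} → Code m → Fin m → Fin m ⊎ Bool → Tag m → Code (4 + m)
insertCode (v , w) y₂ y₁ t = encode (conj t (four (lookup v)) , conj t (join (lookup w) y₂ y₁))

module _ {m} {v w v′ w′ : Vec (Fin m) m} (fv : FourValent (lookup v) (lookup w)) (fv′ : FourValent (lookup v′) (lookup w′))
         {y y′ : Fin m} {z z′ : Fin m ⊎ Bool} {t t′ : Tag m}
         (eq : insertCode (v , w) y z t ≡ insertCode (v′ , w′) y′ z′ t′) where

  private
    σ-same : conj t (four (lookup v)) ≗ conj t′ (four (lookup v′))
    σ-same = proj₁ (encode-inj (conj t (four (lookup v))) (conj t (join (lookup w) y z)) (conj t′ (four (lookup v′))) (conj t′ (join (lookup w′) y′ z′)) eq)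
    τ-same : conj t (join (lookup w) y z) ≗ conj t′ (join (lookup w′) y′ z′)
    τ-same = proj₂ (encode-inj (conj t (four (lookup v))) (conj t (join (lookup w) y z)) (conj t′ (four (lookup v′))) (conj t′ (join (lookup w′) y′ z′)) eq)

    next : ∀ {d} → relabel t d ≡ relabel t′ d → relabel t (four (lookup v) d) ≡ relabel t′ (four (lookup v′) d)
    next {d} e = trans (sym (conj-relabel t (four (lookup v)) d)) (trans (σ-same _)
      (trans (cong (conj t′ (four (lookup v′))) e) (conj-relabel t′ (four (lookup v′)) d)))

  -- σ runs through the four flags of the new crossing, so the label of one determines the others.
  insert-tag : relabel t d₁ ≡ relabel t′ d₁ → t ≡ t′
  insert-tag e₁ = labels-unique t t′ e₀ e₁ e₂ e₃
    where
    e₂ = next {d₁} e₁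
    e₃ = next {d₂} e₂
    e₀ = next {d₃} e₃

  insert-tag₀ : relabel t d₀ ≡ relabel t′ d₀ → t ≡ t′
  insert-tag₀ e₀ = insert-tag (next {d₀} e₀)

  insert-cancel : t ≡ t′ → (v , w) ≡ (v′ , w′) × y ≡ y′
  insert-cancel refl = code-ext (v , w) (v′ , w′)
      (λ x → inj₁-injective (inj₁-injective (conj-cancel t {four (lookup v)} {four (lookup v′)} σ-same (old x)))) (proj₂ both) , proj₁ both
    where
    both : y ≡ y′ × lookup w ≗ lookup w′
    both = join-inj (FourValent.ττ fv) (FourValent.τ≢ fv) (FourValent.ττ fv′) (FourValent.τ≢ fv′)
      (conj-cancel t {join (lookup w) y z} {join (lookup w′) y′ z′} τ-same)

module Decoded {m} (v w : Vec (Fin m) m) (cv : IsCurve (lookup v) (lookup w)) (y₂ : Fin m) (t : Tag m) where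
  open Curl cv y₂ t public

  code : Code (4 + m)
  code = insertCode (v , w) y₂ (inj₂ true) t

  σ′ τ′ φ′ : Fin (4 + m) → Fin (4 + m)
  σ′ = lookup (proj₁ code)
  τ′ = lookup (proj₂ code)
  φ′ = στ σ′ τ′

  σ′≗ : ∀ x → σ′ x ≡ σX x
  σ′≗ = lookup∘tabulate σX
  τ′≗ : ∀ x → τ′ x ≡ τX x
  τ′≗ = lookup∘tabulate τX

  φ′≗ : ∀ x → φ′ x ≡ relabel t (four (lookup v) (θ (unlabel t x)))
  φ′≗ x = trans (σ′≗ _) (trans (cong σX (τ′≗ x)) (φX-conj x))

  φ′-relabel : ∀ x → φ′ (relabel t x) ≡ relabel t (four (lookup v) (θ x))
  φ′-relabel x = trans (φ′≗ _) (cong (relabel t ∘ four (lookup v) ∘ θ) (unlabel-relabel t x))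

  τ′-relabel : ∀ x → τ′ (relabel t x) ≡ relabel t (θ x)
  τ′-relabel x = trans (τ′≗ _) (conj-relabel t θ x)

  curve′ : IsCurve σ′ τ′
  curve′ = isCurve-≗ (λ x → sym (σ′≗ x)) (λ x → sym (τ′≗ x)) curve

  φ′-inj : Inj φ′
  φ′-inj = FourValent.φ-inj (IsCurve.fourValent curve′)

  faceᵇ⁺ : ∀ {j x xs} → Unique xs → (∀ {y} → y ∈ xs → Orb φ′ x y) → (∀ {y} → Orb φ′ x y → y ∈ xs) →
           length xs ≡ j → τ′ x ∉ xs → faceᵇ j code x ≡ true
  faceᵇ⁺ u to from len n = ∧-true⁺ (≡ᵇ-true⁺ (trans (Lengths.cycleLength-list φ′-inj u to from) len))
    (cong not (≢true⇒≡false λ e → n (from (Cycles.inCycle⁻ φ′-inj e))))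

  member : ∀ {f} → 4 * f ≡ m + 8 → code ∈ curves (4 + m) (suc f)
  member {f} f-eq = ∈-curves⁺ (trans (*-suc 4 f) (cong (4 +_) f-eq)) zero curve

-- A curl at any flag is marked at its monogon. This mark locates the new crossing, hence its
-- labels, and after their removal the old curve and the flag.
monogons : ∀ {m f} → 4 * f ≡ m + 8 →
           (length (curves m f) * m) * length (tags m) ≤ length (marked (4 + m) (suc f) 1)
monogons {m} {f} f-eq = subst (_≤ length (marked (4 + m) (suc f) 1)) size
  (length-injection g (pairs-unique (pairs-unique (curves-unique m f) (allFin⁺ m)) (tags-unique m)) into inj)
  where
  dom : List ((Code m × Fin m) × Tag m)
  dom = pairs (pairs (curves m f) (allFin m)) (tags m)
  size : length dom ≡ (length (curves m f) * m) * length (tags m)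
  size = trans (length-pairs (pairs (curves m f) (allFin m)) (tags m)) (cong (_* length (tags m))
    (trans (length-pairs (curves m f) (allFin m)) (cong (length (curves m f) *_) (length-allFin m))))
  g : (Code m × Fin m) × Tag m → Code (4 + m) × Fin (4 + m)
  g ((c , y) , t) = insertCode c y (inj₂ true) t , relabel t d₀
  curve-of : ∀ {v w y t} → (((v , w) , y) , t) ∈ dom → IsCurve (lookup v) (lookup w)
  curve-of i = ∈-curves⁻ f-eq (proj₁ (∈-pairs⁻ (curves m f) (allFin m) (proj₁ (∈-pairs⁻ _ (tags m) i))))
  into : ∀ {a} → a ∈ dom → g a ∈ marked (4 + m) (suc f) 1
  into {((v , w) , y) , t} i = ∈-fibres⁺ (faceᵇ 1) (D.member f-eq) (∈-allFin _)
    (D.faceᵇ⁺ {xs = relabel t d₀ ∷ []} ([] ∷ []) (λ { (here refl) → orb-refl })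
      (orb-invariant (_∈ relabel t d₀ ∷ []) (λ { (here refl) → here (D.φ′-relabel d₀) }) (here refl)) refl
      λ { (here e) → case relabel-inj t (trans (sym (D.τ′-relabel d₀)) e) of λ () })
    where module D = Decoded v w (curve-of i) y t
  inj : ∀ {a b} → a ∈ dom → b ∈ dom → g a ≡ g b → a ≡ b
  inj {((v , w) , y) , t} {((v′ , w′) , y′) , t′} i j e = go (insert-tag₀ {v = v} {w} {v′} {w′} fv fv′ (cong proj₁ e) (cong proj₂ e))
    where
    fv = IsCurve.fourValent (curve-of i)
    fv′ = IsCurve.fourValent (curve-of j)
    go : t ≡ t′ → (((v , w) , y) , t) ≡ (((v′ , w′) , y′) , t′)
    go te = cong₂ _,_ (let (p , q) = insert-cancel {v = v} {w} {v′} {w′} fv fv′ (cong proj₁ e) te in cong₂ _,_ p q) te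

-- The face now passes `d₂` between `y` and its successor and is unchanged elsewhere, since `τ y`
-- lies on another face. The mark stays at `y`; its partner is now `d₁`, which locates the new
-- crossing and makes the map injective.
lengthen : ∀ {m f} j → 4 * f ≡ m + 8 →
           length (marked m f j) * length (tags m) ≤ length (marked (4 + m) (suc f) (suc j))
lengthen {m} {f} j f-eq = subst (_≤ length (marked (4 + m) (suc f) (suc j))) (length-pairs (marked m f j) (tags m))
  (length-injection g (pairs-unique (fibres-unique (faceᵇ j) (curves-unique m f) (allFin⁺ m)) (tags-unique m)) into inj)
  where
  dom : List ((Code m × Fin m) × Tag m)
  dom = pairs (marked m f j) (tags m)
  g : (Code m × Fin m) × Tag m → Code (4 + m) × Fin (4 + m)
  g (((v , w) , y) , t) = insertCode (v , w) (lookup w y) (inj₂ true) t , relabel t (old y)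
  source : ∀ {v w y t} → (((v , w) , y) , t) ∈ dom → (v , w) ∈ curves m f × faceᵇ j (v , w) y ≡ true
  source i = ∈-fibres⁻ (faceᵇ j) (curves m f) (allFin m) (proj₁ (∈-pairs⁻ _ (tags m) i))
  curve-of : ∀ {v w y t} → (((v , w) , y) , t) ∈ dom → IsCurve (lookup v) (lookup w)
  curve-of i = ∈-curves⁻ f-eq (proj₁ (source i))
  into : ∀ {a} → a ∈ dom → g a ∈ marked (4 + m) (suc f) (suc j)
  into {((v , w) , y) , t} i = ∈-fibres⁺ (faceᵇ (suc j)) (D.member f-eq) (∈-allFin _)
    (D.faceᵇ⁺ {xs = relabel t d₂ ∷ map ι (L.cyc y)} uniq to from
      (cong suc (trans (length-map ι (L.cyc y)) len)) fresh)
    where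
    σ τ φ : Fin m → Fin m
    σ = lookup v
    τ = lookup w
    φ = στ σ τ
    module D = Decoded v w (curve-of i) (τ y) t
    module F = CurlFace (curve-of i) y t
    φ-inj : Inj φ
    φ-inj = FourValent.φ-inj (IsCurve.fourValent (curve-of i))
    module L = Lengths φ-inj
    module Cy = Cycles φ-inj
    len : cycleLength φ y ≡ j
    len = ≡ᵇ-true⁻ _ j (proj₁ (∧-true⁻ (proj₂ (source i))))
    τy∉ : ¬ Orb φ y (τ y)
    τy∉ o = true≢false (trans (sym (Cy.inCycle⁺ o)) (not-true⁻ (proj₂ (∧-true⁻ {cycleLength φ y ≡ᵇ j} (proj₂ (source i))))))
    ι : Fin m → Fin (4 + m)
    ι z = relabel t (old z)
    ι-inj : Inj ι
    ι-inj e = inj₁-injective (inj₁-injective (relabel-inj t e))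
    φ-y : D.φ′ (ι y) ≡ relabel t d₂
    φ-y = trans (D.φ′-relabel (old y)) (cong (relabel t ∘ four σ) F.θ-y)
    φ-d₂ : D.φ′ (relabel t d₂) ≡ ι (φ y)
    φ-d₂ = trans (D.φ′-relabel d₂) (cong (relabel t ∘ four σ) F.θ-d₂)
    φ-off : ∀ {z} → z ≢ y → Orb φ y z → D.φ′ (ι z) ≡ ι (φ z)
    φ-off n o = trans (D.φ′-relabel (old _)) (cong (relabel t ∘ four σ) (F.θ-off n (λ { refl → τy∉ o })))
    uniq : Unique (relabel t d₂ ∷ map ι (L.cyc y))
    uniq = ∉⇒All≢ _ (λ k → let (_ , _ , e) = ∈-map⁻ ι k in case relabel-inj t e of λ ())
           ∷ map-unique ι (L.cyc-unique y) (λ _ _ → ι-inj)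
    to-ι : ∀ {z} → Orb φ y z → Orb D.φ′ (ι y) (ι z)
    to-ι (n , refl) = go n
      where
      go : ∀ n → Orb D.φ′ (ι y) (ι (iter n φ y))
      go zero = orb-refl
      go (suc n) with iter n φ y ≟ y
      ... | yes e = 2 , trans (cong D.φ′ φ-y) (trans φ-d₂ (cong (ι ∘ φ) (sym e)))
      ... | no ne = orb-trans (go n) (1 , φ-off ne (n , refl))
    to : ∀ {x} → x ∈ relabel t d₂ ∷ map ι (L.cyc y) → Orb D.φ′ (ι y) x
    to (here refl) = 1 , φ-y
    to (there k) = let (z , l , e) = ∈-map⁻ ι k in subst (Orb D.φ′ (ι y)) (sym e) (to-ι (L.cyc⁻ l))
    from : ∀ {x} → Orb D.φ′ (ι y) x → x ∈ relabel t d₂ ∷ map ι (L.cyc y)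
    from = orb-invariant (_∈ relabel t d₂ ∷ map ι (L.cyc y)) step (there (∈-map⁺ ι (L.cyc⁺ orb-refl)))
      where
      step : ∀ {x} → x ∈ relabel t d₂ ∷ map ι (L.cyc y) → D.φ′ x ∈ relabel t d₂ ∷ map ι (L.cyc y)
      step (here refl) = there (subst (_∈ map ι (L.cyc y)) (sym φ-d₂) (∈-map⁺ ι (L.cyc⁺ (1 , refl))))
      step (there k) = go (∈-map⁻ ι k)
        where
        go : ∀ {x} → (∃ λ z → z ∈ L.cyc y × x ≡ ι z) → D.φ′ x ∈ relabel t d₂ ∷ map ι (L.cyc y)
        go (z , l , refl) with z ≟ y
        ... | yes refl = here φ-y
        ... | no ne = there (subst (_∈ map ι (L.cyc y)) (sym (φ-off ne (L.cyc⁻ l))) (∈-map⁺ ι (L.cyc⁺ (orb-step (L.cyc⁻ l)))))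
    fresh : D.τ′ (ι y) ∉ relabel t d₂ ∷ map ι (L.cyc y)
    fresh k = bad (subst (_∈ relabel t d₂ ∷ map ι (L.cyc y)) (trans (D.τ′-relabel (old y)) (cong (relabel t) F.θ-y)) k)
      where
      bad : relabel t d₁ ∉ relabel t d₂ ∷ map ι (L.cyc y)
      bad (here e) = case relabel-inj t e of λ ()
      bad (there k) = let (_ , _ , e) = ∈-map⁻ ι k in case relabel-inj t e of λ ()
  inj : ∀ {a b} → a ∈ dom → b ∈ dom → g a ≡ g b → a ≡ b
  inj {((v , w) , y) , t} {((v′ , w′) , y′) , t′} i k e = go (insert-tag {v = v} {w} {v′} {w′} fv fv′ (cong proj₁ e) first)
    where
    fv = IsCurve.fourValent (curve-of i)
    fv′ = IsCurve.fourValent (curve-of k)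
    module D = Decoded v w (curve-of i) (lookup w y) t
    module D′ = Decoded v′ w′ (curve-of k) (lookup w′ y′) t′
    module F = CurlFace (curve-of i) y t
    module F′ = CurlFace (curve-of k) y′ t′
    first : relabel t d₁ ≡ relabel t′ d₁
    first = begin
      relabel t d₁                  ≡⟨ cong (relabel t) F.θ-y ⟨
      relabel t (D.θ (old y))       ≡⟨ D.τ′-relabel (old y) ⟨
      D.τ′ (relabel t (old y))      ≡⟨ cong (λ a → lookup (proj₂ (proj₁ a)) (proj₂ a)) e ⟩
      D′.τ′ (relabel t′ (old y′))   ≡⟨ D′.τ′-relabel (old y′) ⟩
      relabel t′ (D′.θ (old y′))    ≡⟨ cong (relabel t′) F′.θ-y ⟩
      relabel t′ d₁                 ∎
      where open ≡-Reasoning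
    go : t ≡ t′ → (((v , w) , y) , t) ≡ (((v′ , w′) , y′) , t′)
    go refl = cong (_, t) (cong₂ _,_ (proj₁ (insert-cancel {v = v} {w} {v′} {w′} fv fv′ (cong proj₁ e) refl))
      (inj₁-injective (inj₁-injective (relabel-inj t (cong proj₂ e)))))

faceTotal : ∀ m → ℕ → ℕ → ℕ
faceTotal m f k = sum (map (λ c → numCyclesOfLength k (στ (proj₁ (decode c)) (proj₂ (decode c)))) (curves m f))

marked≤faces : ∀ {m f} k → 4 * f ≡ m + 8 → length (marked m f k) ≤ k * faceTotal m f k
marked≤faces {m} {f} k f-eq = begin
  length (marked m f k)                                            ≡⟨ length-fibres (faceᵇ k) (curves m f) (allFin m) ⟩
  sum (map (λ c → length (filterᵇ (faceᵇ k c) (allFin m))) (curves m f)) ≤⟨ sum-mono _ _ (curves m f) at ⟩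
  sum (map (λ c → k * numCyclesOfLength k (φ c)) (curves m f))     ≡⟨ sum-* k (λ c → numCyclesOfLength k (φ c)) (curves m f) ⟩
  k * faceTotal m f k                                              ∎
  where
  open ≤-Reasoning
  φ : Code m → Fin m → Fin m
  φ c = στ (proj₁ (decode c)) (proj₂ (decode c))
  at : ∀ {c} → c ∈ curves m f → length (filterᵇ (faceᵇ k c) (allFin m)) ≤ k * numCyclesOfLength k (φ c)
  at {c} i = begin
    length (filterᵇ (faceᵇ k c) (allFin m)) ≤⟨ length-⊆ (filterᵇ-unique _ (allFin⁺ m)) (λ {y} l →
        ∈-filterᵇ⁺ (λ y → cycleLength (φ c) y ≡ᵇ k) (∈-allFin y)
          (proj₁ (∧-true⁻ (proj₂ (∈-filterᵇ⁻ (faceᵇ k c) (allFin m) l))))) ⟩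
    length (filterᵇ (λ y → cycleLength (φ c) y ≡ᵇ k) (allFin m))
      ≤⟨ Lengths.count-cycles (FourValent.φ-inj (IsCurve.fourValent (∈-curves⁻ f-eq i))) k ⟩
    numCyclesOfLength k (φ c) * k ≡⟨ *-comm _ k ⟩
    k * numCyclesOfLength k (φ c) ∎

-- Discharging: every plane curve has linearly many reducible corners

agree-true⁻ : ∀ {a b} → agree a b ≡ true → b ≡ a
agree-true⁻ {true}  e = e
agree-true⁻ {false} {false} e = refl

agree-true⁺ : ∀ {a b} → b ≡ a → agree a b ≡ true
agree-true⁺ {a} refl = agree-refl a

count : ∀ {m} → (Fin m → Bool) → ℕ
count {m} p = length (filterᵇ p (allFin m))

count-inj : ∀ {m} (p q : Fin m → Bool) (f : Fin m → Fin m) → Inj f → (∀ x → p x ≡ true → q (f x) ≡ true) → count p ≤ count q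
count-inj {m} p q f inj imp = length-injection f (filterᵇ-unique _ (allFin⁺ m))
  (λ i → ∈-filterᵇ⁺ q (∈-allFin _) (imp _ (proj₂ (∈-filterᵇ⁻ p (allFin m) i)))) (λ _ _ → inj)

count-not : ∀ {m} (p : Fin m → Bool) → count p + count (not ∘ p) ≡ m
count-not {m} p = begin
  count p + count (not ∘ p)                                                         ≡⟨ cong₂ _+_ (sum-indicator p (allFin m)) (sum-indicator (not ∘ p) (allFin m)) ⟨
  sum (map (indicator ∘ p) (allFin m)) + sum (map (indicator ∘ not ∘ p) (allFin m))  ≡⟨ sum-+ (indicator ∘ p) (indicator ∘ not ∘ p) (allFin m) ⟨
  sum (map (λ x → indicator (p x) + indicator (not (p x))) (allFin m))              ≡⟨ cong sum (map-cong (λ x → one (p x)) (allFin m)) ⟩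
  sum (map (λ _ → 1) (allFin m))                                                    ≡⟨ sum-ones (allFin m) ⟩
  length (allFin m)                                                                 ≡⟨ length-allFin m ⟩
  m                                                                                 ∎
  where
  open ≡-Reasoning
  one : ∀ b → indicator b + indicator (not b) ≡ 1
  one true  = refl
  one false = refl

count-∧ : ∀ {m} (a p q : Fin m → Bool) →
          count (λ x → a x ∧ p x) + count (λ x → a x ∧ q x) ≤ count (λ x → a x ∧ p x ∧ q x) + count a
count-∧ {m} a p q = begin
  count ap + count aq                                                     ≡⟨ cong₂ _+_ (sum-indicator ap (allFin m)) (sum-indicator aq (allFin m)) ⟨
  sum (map (indicator ∘ ap) (allFin m)) + sum (map (indicator ∘ aq) (allFin m)) ≡⟨ sum-+ (indicator ∘ ap) (indicator ∘ aq) (allFin m) ⟨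
  sum (map (λ x → indicator (ap x) + indicator (aq x)) (allFin m))        ≤⟨ sum-mono _ (λ x → indicator (apq x) + indicator (a x)) (allFin m) (λ {x} _ → le (a x) (p x) (q x)) ⟩
  sum (map (λ x → indicator (apq x) + indicator (a x)) (allFin m))        ≡⟨ sum-+ (indicator ∘ apq) (indicator ∘ a) (allFin m) ⟩
  sum (map (indicator ∘ apq) (allFin m)) + sum (map (indicator ∘ a) (allFin m)) ≡⟨ cong₂ _+_ (sum-indicator apq (allFin m)) (sum-indicator a (allFin m)) ⟩
  count apq + count a                                                     ∎
  where
  open ≤-Reasoning
  ap aq apq : Fin m → Bool
  ap x = a x ∧ p x
  aq x = a x ∧ q x
  apq x = a x ∧ p x ∧ q x
  le : ∀ a p q → indicator (a ∧ p) + indicator (a ∧ q) ≤ indicator (a ∧ p ∧ q) + indicator a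
  le false p q         = z≤n
  le true true  true   = ≤-refl
  le true true  false  = ≤-refl
  le true false true   = ≤-refl
  le true false false  = z≤n

cycle-weights : ∀ {m} {π : Fin m → Fin m} (inj : Inj π) (w : Fin m → ℕ) K →
                (∀ r → K ≤ sum (map w (Lengths.cyc inj r))) → numCycles π * K ≤ sum (map w (allFin m))
cycle-weights {m} {π} inj w K low = begin
  numCycles π * K                                ≡⟨ sum-const K (reps π) ⟨
  sum (map (λ _ → K) (reps π))                   ≤⟨ sum-mono _ _ (reps π) (λ {r} _ → low r) ⟩
  sum (map (λ r → sum (map w (cyc r))) (reps π)) ≡⟨ sum-concatMap w cyc (reps π) ⟨
  sum (map w (concatMap cyc (reps π)))           ≤⟨ sum-⊆ w (concatMap-unique cyc (reps-unique π) cyc-unique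
      (λ i j k l → rep-unique (∈-reps⁻ π i) (∈-reps⁻ π j) (orb-trans (cyc⁻ k) (orb-sym (cyc⁻ l))))) (λ _ → ∈-allFin _) ⟩
  sum (map w (allFin m))                         ∎
  where
  open ≤-Reasoning
  open Lengths inj
  open Cycles inj

module Discharge {M} {σ τ : Fin M → Fin M} (cv : IsCurve σ τ) (o : Fin M → Bool)
                 (oτ : ∀ x → o (τ x) ≡ not (o x)) (oχ : ∀ x → o (σ (σ x)) ≡ not (o x)) where
  open IsCurve cv
  open FourValent fourValent

  φ : Fin M → Fin M
  φ = στ σ τ

  coh alt bigon good twist : Fin M → Bool
  coh x = agree (o x) (o (σ x))
  alt x = not (coh x)
  bigon x = φ (φ x) == x
  good x = coh x ∧ (cycleLength φ x ≤ᵇ 47)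
  twist x = alt x ∧ bigon x ∧ bigon (σ (σ x))

  -- Opposite flags of a crossing have opposite orientation, so coherent and alternating corners
  -- take turns around it.
  coh-σ : ∀ x → coh (σ x) ≡ alt x
  coh-σ x = trans (cong (agree (o (σ x))) (oχ x)) (trans (agree-not (o (σ x)) (o x)) (cong not (agree-sym (o (σ x)) (o x))))
    where
    agree-sym : ∀ a b → agree a b ≡ agree b a
    agree-sym true  true  = refl
    agree-sym true  false = refl
    agree-sym false true  = refl
    agree-sym false false = refl

  alt-σσ : ∀ x → alt (σ (σ x)) ≡ alt x
  alt-σσ x = trans (cong not (coh-σ (σ x))) (trans (not-not (coh (σ x))) (coh-σ x))
    where
    not-not : ∀ b → not (not b) ≡ b
    not-not true  = refl
    not-not false = refl

  -- The corner of a monogon lies between the two ends of one edge, and the curve leaves by one and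
  -- arrives by the other.
  monogon-coherent : ∀ x → φ x ≡ x → coh x ≡ true
  monogon-coherent x e = agree-true⁺ (not-injective (begin
    not (o (σ x))       ≡⟨ oχ (σ x) ⟨
    o (σ (σ (σ x)))     ≡⟨ cong o (σ-inj (trans e (sym (σ⁴ x)))) ⟨
    o (τ x)             ≡⟨ oτ x ⟩
    not (o x)           ∎))
    where open ≡-Reasoning

  -- A face collects 48 from its flags if it has degree at least 48, or a good corner; otherwise it has
  -- only alternating corners, at least two of them, and collects 2 · 24 or at least 3 · 16.
  weight : Fin M → ℕ
  weight x = (1 + 48 * indicator (good x)) + (16 * indicator (alt x) + 8 * indicator (alt x ∧ bigon x))

  module L = Lengths φ-inj
  module C = Cycles φ-inj

  face-weight : ∀ r → 48 ≤ sum (map weight (L.cyc r))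
  face-weight r with 48 ≤? cycleLength φ r
  ... | yes le = ≤-trans le (≤-trans (≤-reflexive (sym (sum-ones (L.cyc r)))) (sum-mono _ weight (L.cyc r) (λ _ → s≤s z≤n)))
  ... | no nle with any coh (L.cyc r) in e
  ...   | true  = found (any⁻ coh (L.cyc r) e)
    where
    found : (∃ λ y → y ∈ L.cyc r × coh y ≡ true) → 48 ≤ sum (map weight (L.cyc r))
    found (y , i , c) = ≤-trans (≤-trans heavy (≤-reflexive (sym (+-identityʳ _)))) (sum-⊆ weight {y ∷ []} ([] ∷ []) (λ { (here refl) → i }))
      where
      good-y : good y ≡ true
      good-y = ∧-true⁺ c (≤ᵇ-true⁺ (≤-pred (subst (_< 48) (L.cycleLength-orb (L.cyc⁻ i)) (≰⇒> nle))))
      heavy : 48 ≤ weight y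
      heavy = ≤-trans (subst (λ b → 48 ≤ 1 + 48 * indicator b) (sym good-y) (n≤1+n 48)) (m≤m+n _ _)
  ...   | false = light
    where
    alt-on : ∀ {y} → Orb φ r y → alt y ≡ true
    alt-on o = cong not (≢true⇒≡false λ c → true≢false (trans (sym (any⁺ coh (L.cyc⁺ o) c)) e))
    φr≢r : φ r ≢ r
    φr≢r q = true≢false (trans (sym (alt-on orb-refl)) (cong not (monogon-coherent r q)))
    w17 : ∀ {y} → Orb φ r y → 17 ≤ weight y
    w17 {y} o = +-mono-≤ {1} {1 + 48 * indicator (good y)} (s≤s z≤n)
      (≤-trans (subst (λ b → 16 ≤ 16 * indicator b) (sym (alt-on o)) ≤-refl) (m≤m+n _ _))
    w24 : ∀ {y} → Orb φ r y → φ (φ y) ≡ y → 24 ≤ weight y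
    w24 {y} o q = ≤-trans (+-mono-≤ (subst (λ b → 16 ≤ 16 * indicator b) (sym (alt-on o)) ≤-refl)
                    (subst (λ b → 8 ≤ 8 * indicator b) (sym (∧-true⁺ (alt-on o) (≡⇒== q))) ≤-refl)) (m≤n+m _ (1 + 48 * indicator (good y)))
    light : 48 ≤ sum (map weight (L.cyc r))
    light with φ (φ r) ≟ r
    ... | yes q = ≤-trans (+-mono-≤ (w24 orb-refl q) (≤-trans (w24 (1 , refl) (cong φ q)) (≤-reflexive (sym (+-identityʳ _)))))
                    (sum-⊆ weight {r ∷ φ r ∷ []} ((φr≢r ∘ sym ∷ []) ∷ [] ∷ [])
                      λ { (here refl) → L.cyc⁺ orb-refl ; (there (here refl)) → L.cyc⁺ (1 , refl) })
    ... | no q  = ≤-trans (≤-trans (m≤n+m 48 3) (+-mono-≤ (w17 orb-refl) (+-mono-≤ (w17 (1 , refl)) (≤-trans (w17 (2 , refl)) (≤-reflexive (sym (+-identityʳ _)))))))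
                    (sum-⊆ weight {r ∷ φ r ∷ φ (φ r) ∷ []}
                      ((φr≢r ∘ sym ∷ q ∘ sym ∷ []) ∷ ((λ p → φr≢r (sym (φ-inj p))) ∷ []) ∷ [] ∷ [])
                      λ { (here refl) → L.cyc⁺ orb-refl ; (there (here refl)) → L.cyc⁺ (1 , refl) ; (there (there (here refl))) → L.cyc⁺ (2 , refl) })

  A Ab G H : ℕ
  A = count alt
  Ab = count (λ x → alt x ∧ bigon x)
  G = count good
  H = count twist

  total : sum (map weight (allFin M)) ≡ (M + 48 * G) + (16 * A + 8 * Ab)
  total = trans (sum-+ (λ x → 1 + 48 * indicator (good x)) (λ x → 16 * indicator (alt x) + 8 * indicator (alt x ∧ bigon x)) (allFin M))
    (cong₂ _+_
      (trans (sum-+ (λ _ → 1) (λ x → 48 * indicator (good x)) (allFin M))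
        (cong₂ _+_ (trans (sum-ones (allFin M)) (length-allFin M)) (scaled 48 good)))
      (trans (sum-+ (λ x → 16 * indicator (alt x)) (λ x → 8 * indicator (alt x ∧ bigon x)) (allFin M))
        (cong₂ _+_ (scaled 16 alt) (scaled 8 (λ x → alt x ∧ bigon x)))))
    where
    scaled : ∀ k (p : Fin M → Bool) → sum (map (λ x → k * indicator (p x)) (allFin M)) ≡ k * count p
    scaled k p = trans (sum-* k (indicator ∘ p) (allFin M)) (cong (k *_) (sum-indicator p (allFin M)))

  2A≤M : A + A ≤ M
  2A≤M = ≤-trans (+-monoˡ-≤ A (count-inj alt coh σ σ-inj (λ x e → trans (coh-σ x) e))) (≤-reflexive (count-not coh))

  -- A half turn of the crossing permutes the alternating corners, so at least as many face a bigon
  -- across the crossing as lie in one. Two subsets of the `A` corners overlap in the excess, and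
  -- the overlap is `twist`.
  2Ab≤ : Ab + Ab ≤ H + A
  2Ab≤ = ≤-trans (+-monoʳ-≤ Ab (count-inj (λ x → alt x ∧ bigon x) (λ x → alt x ∧ bigon (σ (σ x))) (σ ∘ σ) (σ-inj ∘ σ-inj)
      (λ x e → let (p , q) = ∧-true⁻ e in ∧-true⁺ (trans (alt-σσ x) p) (trans (cong bigon (σ⁴ x)) q))))
    (count-∧ alt bigon (bigon ∘ σ ∘ σ))

  -- Since 4f = M + 8, a charge of 48 per face exceeds 12 per flag. Apart from `G` and `H` the
  -- weights average at most 11: 1 is given to every flag, 8 comes from 16 on at most half of them,
  -- and 2 from 8 on at most a quarter. One unit per flag is left for the reducible corners.
  reducible : M ≤ 48 * G + 4 * H
  reducible = arithmetic (numCycles (σ ∘ τ)) M G H A Ab planar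
    (≤-trans (cycle-weights φ-inj weight 48 face-weight) (≤-reflexive total)) 2A≤M 2Ab≤
    where
    arithmetic : ∀ f M G H A B → 4 * f ≡ M + 8 → f * 48 ≤ (M + 48 * G) + (16 * A + 8 * B) → A + A ≤ M → B + B ≤ H + A →
                 M ≤ 48 * G + 4 * H
    arithmetic f M G H A B pl le a b = ≤-trans (m≤m+n M 96) (+-cancelʳ-≤ (11 * M) _ _ (begin
      (M + 96) + 11 * M                               ≡⟨ solve 1 (λ M → (M :+ con 96) :+ con 11 :* M := con 12 :* (M :+ con 8)) refl M ⟩
      12 * (M + 8)                                    ≡⟨ cong (12 *_) pl ⟨
      12 * (4 * f)                                    ≡⟨ solve 1 (λ f → con 12 :* (con 4 :* f) := f :* con 48) refl f ⟩
      f * 48                                          ≤⟨ le ⟩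
      (M + 48 * G) + (16 * A + 8 * B)                 ≡⟨ solve 4 (λ M G A B → (M :+ con 48 :* G) :+ (con 16 :* A :+ con 8 :* B) := (M :+ con 48 :* G) :+ (con 8 :* (A :+ A) :+ con 4 :* (B :+ B))) refl M G A B ⟩
      (M + 48 * G) + (8 * (A + A) + 4 * (B + B))      ≤⟨ +-monoʳ-≤ (M + 48 * G) (+-mono-≤ (*-monoʳ-≤ 8 a) (*-monoʳ-≤ 4 b)) ⟩
      (M + 48 * G) + (8 * M + 4 * (H + A))            ≡⟨ solve 4 (λ M G H A → (M :+ con 48 :* G) :+ (con 8 :* M :+ con 4 :* (H :+ A)) := (con 48 :* G :+ con 4 :* H :+ con 9 :* M) :+ con 2 :* (A :+ A)) refl M G H A ⟩
      (48 * G + 4 * H + 9 * M) + 2 * (A + A)          ≤⟨ +-monoʳ-≤ (48 * G + 4 * H + 9 * M) (*-monoʳ-≤ 2 a) ⟩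
      (48 * G + 4 * H + 9 * M) + 2 * M                ≡⟨ solve 3 (λ M G H → (con 48 :* G :+ con 4 :* H :+ con 9 :* M) :+ con 2 :* M := (con 48 :* G :+ con 4 :* H) :+ con 11 :* M) refl M G H ⟩
      (48 * G + 4 * H) + 11 * M                       ∎))
      where
      open ≤-Reasoning
      open +-*-Solver

-- Bounded-to-one reductions

-- Taking flag `zero` as base point makes the orientation a function of the code, so that good
-- corners and twists can be filtered.
orientᵇ : ∀ {m} → Code (suc m) → Fin (suc m) → Bool
orientᵇ (v , w) y = inCycle (λ x → lookup v (lookup v (lookup w x))) zero y

module Oriented {m} {v w : Vec (Fin (suc m)) (suc m)} (cv : IsCurve (lookup v) (lookup w)) where
  open IsCurve cv
  open FourValent fourValent
  private module K = Curve {χ = lookup v ∘ lookup v} {lookup w} σ⁴ σσ≢ ττ τ≢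

  o : Fin (suc m) → Bool
  o = orientᵇ (v , w)

  oτ : ∀ x → o (lookup w x) ≡ not (o x)
  oτ = K.orient-τ connected zero

  oχ : ∀ x → o (lookup v (lookup v x)) ≡ not (o x)
  oχ = K.orient-χ connected zero

  open Discharge cv o oτ oχ public

goodᵇ twistᵇ : ∀ {m} → Code (suc m) → Fin (suc m) → Bool
goodᵇ (v , w) x = agree (o x) (o (lookup v x)) ∧ (cycleLength (στ (lookup v) (lookup w)) x ≤ᵇ 47)
  where o = orientᵇ (v , w)
twistᵇ (v , w) x = not (agree (o x) (o (σ x))) ∧ (φ (φ x) == x) ∧ (φ (φ (σ (σ x))) == σ (σ x))
  where
  o = orientᵇ (v , w)
  σ = lookup v
  φ = στ (lookup v) (lookup w)

goods twists : ∀ m → ℕ → List (Code (suc m) × Fin (suc m))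
goods m f  = fibres goodᵇ (curves (suc m) f) (allFin (suc m))
twists m f = fibres twistᵇ (curves (suc m) f) (allFin (suc m))

reducible-corners : ∀ {m f} → 4 * f ≡ suc m + 8 →
                    length (curves (suc m) f) * suc m ≤ 48 * length (goods m f) + 4 * length (twists m f)
reducible-corners {m} {f} f-eq = begin
  length cs * suc m                                         ≡⟨ sum-const (suc m) cs ⟨
  sum (map (λ _ → suc m) cs)                                ≤⟨ sum-mono _ _ cs (λ {(v , w)} i → Oriented.reducible {v = v} {w} (∈-curves⁻ f-eq i)) ⟩
  sum (map (λ c → 48 * g c + 4 * h c) cs)                   ≡⟨ sum-+ (λ c → 48 * g c) (λ c → 4 * h c) cs ⟩
  sum (map (λ c → 48 * g c) cs) + sum (map (λ c → 4 * h c) cs) ≡⟨ cong₂ _+_ (sum-* 48 g cs) (sum-* 4 h cs) ⟩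
  48 * sum (map g cs) + 4 * sum (map h cs)                  ≡⟨ cong₂ (λ a b → 48 * a + 4 * b) (length-fibres goodᵇ cs (allFin (suc m))) (length-fibres twistᵇ cs (allFin (suc m))) ⟨
  48 * length (goods m f) + 4 * length (twists m f)         ∎
  where
  open ≤-Reasoning
  cs : List (Code (suc m))
  cs = curves (suc m) f
  g h : Code (suc m) → ℕ
  g c = length (filterᵇ (goodᵇ c) (allFin (suc m)))
  h c = length (filterᵇ (twistᵇ c) (allFin (suc m)))

-- A face of degree at most 47 is walked along in 46 steps of two letters; two more reach the strand.
wordLength : ℕ
wordLength = 2 + 2 * 46

abstract
  -- The list has 3 to the power 94 entries and stays abstract; only its length enters the
  -- constants.
  words : List (Vec (Fin 3) wordLength)
  words = allVecs (allFin 3) wordLength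

  ∈-words : ∀ w → w ∈ words
  ∈-words = ∈-allVecs ∈-allFin

run-≗ : ∀ {H : Set} {f τ f′ τ′ : H → H} → f ≗ f′ → τ ≗ τ′ → ∀ {l} (w : Vec (Fin 3) l) a →
        Words.run f τ w a ≡ Words.run f′ τ′ w a
run-≗ ef eτ []v a = refl
run-≗ ef eτ (zero ∷v w) a = run-≗ ef eτ w a
run-≗ {f′ = f′} ef eτ (suc zero ∷v w) a = trans (ef _) (cong f′ (run-≗ ef eτ w a))
run-≗ {τ′ = τ′} ef eτ (suc (suc zero) ∷v w) a = trans (eτ _) (cong τ′ (run-≗ ef eτ w a))

ext-≗ : ∀ {H : Set} {f g : H → H} → f ≗ g → ext f ≗ ext g
ext-≗ e (inj₁ x) = cong inj₁ (e x)
ext-≗ e (inj₂ b) = refl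

four-≗ : ∀ {m} {f g : Fin m → Fin m} → f ≗ g → four f ≗ four g
four-≗ e (old y) = cong (inj₁ ∘ inj₁) (e y)
four-≗ e d₀ = refl
four-≗ e d₁ = refl
four-≗ e d₂ = refl
four-≗ e d₃ = refl

join-≗ : ∀ {m} {f g : Fin m → Fin m} → f ≗ g → ∀ y₂ y₁ → join f y₂ y₁ ≗ join g y₂ y₁
join-≗ e y₂ y₁ = Sub₁.sub-cong (Sub₀.sub-cong e y₂) y₁

insertCode-decode : ∀ {m} (c : Code m) (y₂ : Fin m) (y₁ : Fin m ⊎ Bool) (t : Tag m) {σ τ : Fin m → Fin m} (X : Code (4 + m)) →
  proj₁ (decode c) ≗ σ → proj₂ (decode c) ≗ τ →
  conj t (four σ) ≗ proj₁ (decode X) → conj t (join τ y₂ y₁) ≗ proj₂ (decode X) → insertCode c y₂ y₁ t ≡ X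
insertCode-decode (v , w) y₂ y₁ t X eσ eτ p q = encode-decode _ _ X
  (λ x → trans (cong (relabel t) (four-≗ eσ (unlabel t x))) (p x))
  (λ x → trans (cong (relabel t) (join-≗ eτ y₂ y₁ (unlabel t x))) (q x))

-- The word leads from the first strand to the second, so a reduction is undone by one corner of the
-- smaller curve, a tag, and one of a fixed number of words.
goods≤ : ∀ {m f} → 4 * f ≡ m + 8 → Fin m →
         length (goods (3 + m) (suc f)) ≤ ((length (curves m f) * m) * length (tags m)) * length words
goods≤ {m} {f} f-eq y₀ = subst (length (goods (3 + m) (suc f)) ≤_) size
  (length-surjection g {ys = dom} (fibres-unique goodᵇ (curves-unique (4 + m) (suc f)) (allFin⁺ (4 + m))) onto)
  where
  dom : List (((Code m × Fin m) × Tag m) × Vec (Fin 3) wordLength)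
  dom = pairs (pairs (pairs (curves m f) (allFin m)) (tags m)) words
  size : length dom ≡ ((length (curves m f) * m) * length (tags m)) * length words
  size = trans (length-pairs (pairs (pairs (curves m f) (allFin m)) (tags m)) words) (cong (_* length words)
    (trans (length-pairs (pairs (curves m f) (allFin m)) (tags m)) (cong (_* length (tags m))
    (trans (length-pairs (curves m f) (allFin m)) (cong (length (curves m f) *_) (length-allFin m))))))
  end : Code m → Fin m → Vec (Fin 3) wordLength → Fin m ⊎ Bool
  end (v , w) y₂ u = Words.run (ext (lookup v)) (Sub₀.sub (lookup w) y₂) u (inj₂ false)
  g : ((Code m × Fin m) × Tag m) × Vec (Fin 3) wordLength → Code (4 + m) × Fin (4 + m)
  g (((c , y₂) , t) , u) = insertCode c y₂ (end c y₂ u) t , relabel t d₂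
  onto : ∀ {a} → a ∈ goods (3 + m) (suc f) → ∃ λ b → b ∈ dom × g b ≡ a
  onto {(v , w) , x} i = (((c , y₂) , t) , u) , ∈-pairs⁺ (∈-pairs⁺ (∈-pairs⁺ (∈-curves⁺ f-eq y₀ Co.curveY) (∈-allFin y₂)) (∈-tags t)) (∈-words u)
      , cong₂ _,_ (insertCode-decode c y₂ (end c y₂ u) t (v , w) (lookup∘tabulate σY) (lookup∘tabulate τY)
          (λ z → sym (σ≗ z)) (λ z → trans (cong (λ y → conj t (join τY y₂ y) z) end-u) (sym (τ≗ z)))) at₂
    where
    member : (v , w) ∈ curves (4 + m) (suc f) × goodᵇ (v , w) x ≡ true
    member = ∈-fibres⁻ goodᵇ (curves (4 + m) (suc f)) (allFin (4 + m)) i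
    cv : IsCurve (lookup v) (lookup w)
    cv = ∈-curves⁻ (trans (*-suc 4 f) (cong (4 +_) f-eq)) (proj₁ member)
    module O = Oriented {v = v} {w} cv
    coherent : O.o (lookup v x) ≡ O.o x
    coherent = agree-true⁻ (proj₁ (∧-true⁻ {agree (O.o x) (O.o (lookup v x))} (proj₂ member)))
    module Co = Coherent cv y₀ O.o O.oτ O.oχ x coherent
    open Reduction Co.reduction
    c : Code m
    c = encode (σY , τY)
    short : ∃ λ d → suc d ≤ 47 × iter (suc d) (lookup v ∘ lookup w) x ≡ x
    short = Lengths.short-period (FourValent.φ-inj (IsCurve.fourValent cv))
      (≤ᵇ-true⁻ (proj₂ (∧-true⁻ {agree (O.o x) (O.o (lookup v x))} (proj₂ member))))
    path : Words.Reach (ext σY) (Sub₀.sub τY y₂) wordLength (inj₂ false) y₁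
    path = Words.reach-≤ (ext σY) (Sub₀.sub τY y₂) (+-monoʳ-≤ 2 (*-monoʳ-≤ 2 (≤-pred (proj₁ (proj₂ short)))))
      (Co.linked (proj₁ short) (proj₂ (proj₂ short)))
    u : Vec (Fin 3) wordLength
    u = proj₁ path
    end-u : end c y₂ u ≡ y₁
    end-u = trans (run-≗ (ext-≗ (lookup∘tabulate σY)) (Sub₀.sub-cong (lookup∘tabulate τY) y₂) u (inj₂ false)) (proj₂ path)

bigonCode : ∀ {m} → Code m → Fin m → Tag m → Code (4 + m)
bigonCode (v , w) y t = insertCode (v , w) y (bigonEnd (lookup v) (lookup w) y) t

bigonEnd-≗ : ∀ {m} {σ τ σ′ τ′ : Fin m → Fin m} → σ ≗ σ′ → τ ≗ τ′ → ∀ y → bigonEnd σ τ y ≡ bigonEnd σ′ τ′ y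
bigonEnd-≗ {τ = τ} eσ eτ y = trans (cong (Sub₀.sub τ y ∘ inj₁) (eσ y)) (Sub₀.sub-cong eτ y _)

bigonCode-decode : ∀ {m} (c : Code m) (X : Code (4 + m)) {σ τ : Fin (4 + m) → Fin (4 + m)} {x} (R : BigonReduction σ τ x) →
  let open BigonReduction R in
  proj₁ (decode c) ≗ σY → proj₂ (decode c) ≗ τY → σ ≗ proj₁ (decode X) → τ ≗ proj₂ (decode X) → bigonCode c y t ≡ X
bigonCode-decode (v , w) X {σ} {τ} R eσ eτ p q = insertCode-decode (v , w) y _ t X eσ eτ
  (λ z → trans (sym (σ-relabel (unlabel t z))) (trans (cong σ (relabel-unlabel t z)) (p z)))
  (λ z → trans (cong (λ e → conj t (join τY y e) z) (bigonEnd-≗ eσ eτ y))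
    (trans (sym (τ-relabel (unlabel t z))) (trans (cong τ (relabel-unlabel t z)) (q z))))
  where open BigonReduction R

-- The bigons fix both second strands and also where the second crossing goes. Free are only one
-- corner of the smallest curve and the two tags.
twists≤ : ∀ {m f} → 4 * f ≡ m + 8 → Fin m →
          length (twists (3 + (4 + m)) (2 + f)) ≤ ((length (curves m f) * m) * length (tags m)) * length (tags (4 + m))
twists≤ {m} {f} f-eq y₀ = subst (length (twists (3 + (4 + m)) (2 + f)) ≤_) size
  (length-surjection g {ys = dom} (fibres-unique twistᵇ (curves-unique (4 + (4 + m)) (2 + f)) (allFin⁺ (4 + (4 + m)))) onto)
  where
  dom : List (((Code m × Fin m) × Tag m) × Tag (4 + m))
  dom = pairs (pairs (pairs (curves m f) (allFin m)) (tags m)) (tags (4 + m))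
  size : length dom ≡ ((length (curves m f) * m) * length (tags m)) * length (tags (4 + m))
  size = trans (length-pairs (pairs (pairs (curves m f) (allFin m)) (tags m)) (tags (4 + m))) (cong (_* length (tags (4 + m)))
    (trans (length-pairs (pairs (curves m f) (allFin m)) (tags m)) (cong (_* length (tags m))
    (trans (length-pairs (curves m f) (allFin m)) (cong (length (curves m f) *_) (length-allFin m))))))
  -- The first removal is recorded at `z` and the twist at `x`, the two corners of one bigon; a step
  -- along this face leads from `z` to `x`.
  mark : ∀ {k} → Code k → Fin k → Fin k
  mark (v , w) x = lookup v (lookup w x)
  g : ((Code m × Fin m) × Tag m) × Tag (4 + m) → Code (4 + (4 + m)) × Fin (4 + (4 + m))
  g (((c , y) , t) , s) = X , mark X (relabel s d₂)
    where
    Y : Code (4 + m)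
    Y = bigonCode c y t
    X : Code (4 + (4 + m))
    -- The flag `d₂` of the first insertion is `v`, three turns after the place `y` of the second;
    -- one more turn returns to it.
    X = bigonCode Y (lookup (proj₁ Y) (relabel t d₂)) s
  onto : ∀ {a} → a ∈ twists (3 + (4 + m)) (2 + f) → ∃ λ b → b ∈ dom × g b ≡ a
  onto {(v , w) , x} i = from-first Tw.first
    where
    σ τ φ : Fin (4 + (4 + m)) → Fin (4 + (4 + m))
    σ = lookup v
    τ = lookup w
    φ = στ σ τ
    member : (v , w) ∈ curves (4 + (4 + m)) (2 + f) × twistᵇ (v , w) x ≡ true
    member = ∈-fibres⁻ twistᵇ (curves (4 + (4 + m)) (2 + f)) (allFin (4 + (4 + m))) i
    cv : IsCurve σ τ
    cv = ∈-curves⁻ (trans (*-suc 4 (suc f)) (cong (4 +_) (trans (*-suc 4 f) (cong (4 +_) f-eq)))) (proj₁ member)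
    module O = Oriented {v = v} {w} cv
    parts : O.alt x ≡ true × (φ (φ x) == x) ∧ (φ (φ (σ (σ x))) == σ (σ x)) ≡ true
    parts = ∧-true⁻ (proj₂ member)
    bigons : (φ (φ x) == x) ≡ true × (φ (φ (σ (σ x))) == σ (σ x)) ≡ true
    bigons = ∧-true⁻ (proj₂ parts)
    not-monogon : ∀ y → O.alt y ≡ true → φ y ≢ y
    not-monogon y a e = true≢false (trans (sym a) (cong not (O.monogon-coherent y e)))
    module Tw = Twist cv y₀ x (==⇒≡ (proj₁ bigons)) (not-monogon x (proj₁ parts))
                (==⇒≡ (proj₂ bigons)) (not-monogon (σ (σ x)) (trans (O.alt-σσ x) (proj₁ parts)))
    from-first : BigonReduction σ τ Tw.z → ∃ λ b → b ∈ dom × g b ≡ ((v , w) , x)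
    from-first R = from-second (Tw.Second.second R)
      where
      module R = BigonReduction R
      from-second : BigonReduction R.σY R.τY (Tw.Second.v R) → ∃ λ b → b ∈ dom × g b ≡ ((v , w) , x)
      from-second R₂ = (((c , Z.y) , Z.t) , R.t)
        , ∈-pairs⁺ (∈-pairs⁺ (∈-pairs⁺ (∈-curves⁺ f-eq y₀ (Tw.Second.Third.curveZ R R₂)) (∈-allFin Z.y)) (∈-tags Z.t)) (∈-tags R.t)
        , cong₂ _,_ X≡ (trans (cong₂ mark X≡ R.at₂) (==⇒≡ (proj₁ bigons)))
        where
        module Z = BigonReduction R₂
        c : Code m
        c = encode (Z.σY , Z.τY)
        Y : Code (4 + m)
        Y = encode (R.σY , R.τY)
        Y≡ : bigonCode c Z.y Z.t ≡ Y
        Y≡ = bigonCode-decode c Y R₂ (lookup∘tabulate Z.σY) (lookup∘tabulate Z.τY)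
          (λ z → sym (lookup∘tabulate R.σY z)) (λ z → sym (lookup∘tabulate R.τY z))
        y≡ : lookup (proj₁ Y) (relabel Z.t d₂) ≡ R.y
        y≡ = trans (lookup∘tabulate R.σY _) (trans (cong R.σY Z.at₂) (FourValent.σ⁴ R.fvY R.y))
        X≡ : proj₁ (g (((c , Z.y) , Z.t) , R.t)) ≡ (v , w)
        X≡ = trans (cong (λ Y → bigonCode Y (lookup (proj₁ Y) (relabel Z.t d₂)) R.t) Y≡)
          (trans (cong (λ y → bigonCode Y y R.t) y≡)
            (bigonCode-decode Y (v , w) R (lookup∘tabulate R.σY) (lookup∘tabulate R.τY) (λ _ → refl) (λ _ → refl)))

ratio : ℕ
ratio = 48 * length words + 4

growth : ∀ {m f} → 4 * f ≡ m + 8 → Fin m →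
         length (curves (8 + m) (2 + f)) * (8 + m) ≤ ratio * ((length (curves (4 + m) (1 + f)) * (4 + m)) * length (tags (4 + m)))
growth {m} {f} f-eq y₀ = arithmetic (length words) (length (tags (4 + m)))
  (reducible-corners {7 + m} {2 + f} (trans (*-suc 4 (suc f)) (cong (4 +_) f-eq₁))) (goods≤ {4 + m} {suc f} f-eq₁ zero) (twists≤ {m} {f} f-eq y₀)
  -- Twists are bounded two crossings further down. Curls at all those corners inject into the
  -- corners one crossing up, so both reductions are compared with the same number.
  (≤-trans (monogons f-eq) (marked≤ (4 + m) (suc f) 1))
  where
  f-eq₁ : 4 * suc f ≡ (4 + m) + 8
  f-eq₁ = trans (*-suc 4 f) (cong (4 +_) f-eq)
  arithmetic : ∀ {a g h b e} W R → a ≤ 48 * g + 4 * h → g ≤ (b * R) * W → h ≤ e * R → e ≤ b → a ≤ (48 * W + 4) * (b * R)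
  arithmetic {a} {g} {h} {b} {e} W R p q r s = begin
    a                                ≤⟨ p ⟩
    48 * g + 4 * h                   ≤⟨ +-mono-≤ (*-monoʳ-≤ 48 q) (*-monoʳ-≤ 4 (≤-trans r (*-monoˡ-≤ R s))) ⟩
    48 * ((b * R) * W) + 4 * (b * R) ≡⟨ solve 2 (λ x W → con 48 :* (x :* W) :+ con 4 :* x := (con 48 :* W :+ con 4) :* x) refl (b * R) W ⟩
    (48 * W + 4) * (b * R)           ∎
    where
    open ≤-Reasoning
    open +-*-Solver

-- Counting plane curves

faces-eq : ∀ n → 4 * (n + 2) ≡ 4 * n + 8
faces-eq n = *-distribˡ-+ 4 n 2

#curves #corners #tags : ℕ → ℕ
#curves n = length (curves (4 * n) (n + 2))
#corners n = #curves n * (4 * n)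
#tags n = length (tags (4 * n))

#marked : ℕ → ℕ → ℕ
#marked n j = length (marked (4 * n) (n + 2) j)

monogonal≤ : ∀ n → #corners n * #tags n ≤ #marked (suc n) 1
monogonal≤ n = subst (λ M → #corners n * #tags n ≤ length (marked M (suc (n + 2)) 1)) (sym (*-suc 4 n)) (monogons {4 * n} {n + 2} (faces-eq n))

lengthened≤ : ∀ n j → #marked n j * #tags n ≤ #marked (suc n) (suc j)
lengthened≤ n j = subst (λ M → #marked n j * #tags n ≤ length (marked M (suc (n + 2)) (suc j))) (sym (*-suc 4 n)) (lengthen {4 * n} {n + 2} j (faces-eq n))

-- The twist reduction descends by two crossings and must leave a flag, so the bound starts at three
-- crossings.
corners-growth : ∀ n → #corners (3 + n) ≤ ratio * (#corners (2 + n) * #tags (2 + n))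
corners-growth n = transport (sym (*-suc 4 (suc n)))
  (sym (trans (*-suc 4 (2 + n)) (cong (4 +_) (*-suc 4 (suc n)))))
  (growth {4 * suc n} {suc n + 2} (faces-eq (suc n)) zero)
  where
  transport : ∀ {k l k′ l′} → k ≡ k′ → l ≡ l′ →
              length (curves l (3 + n + 2)) * l ≤ ratio * ((length (curves k (2 + n + 2)) * k) * length (tags k)) →
              length (curves l′ (3 + n + 2)) * l′ ≤ ratio * ((length (curves k′ (2 + n + 2)) * k′) * length (tags k′))
  transport refl refl p = p

-- Growth and lengthening carry the same number of tags, so each curl lowers the guaranteed share of
-- marked corners by no more than the factor `ratio`.
corners≤marked : ∀ j n → #corners (suc j + (2 + n)) ≤ ratio ^ suc j * #marked (suc j + (2 + n)) (suc j)
corners≤marked zero n = ≤-trans (corners-growth n) (≤-trans (*-monoʳ-≤ ratio (monogonal≤ (2 + n))) (≤-reflexive (cong (_* #marked (3 + n) 1) (sym (*-identityʳ ratio)))))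
corners≤marked (suc j) n = begin
  #corners (suc N)                                  ≤⟨ subst (λ k → #corners (suc k) ≤ ratio * (#corners k * #tags k)) (sym N≡) (corners-growth (suc j + n)) ⟩
  ratio * (#corners N * #tags N)                        ≤⟨ *-monoʳ-≤ ratio (*-monoˡ-≤ (#tags N) (corners≤marked j n)) ⟩
  ratio * ((ratio ^ suc j * #marked N (suc j)) * #tags N) ≡⟨ solve 4 (λ r p b t → r :* ((p :* b) :* t) := (r :* p) :* (b :* t)) refl ratio (ratio ^ suc j) (#marked N (suc j)) (#tags N) ⟩
  ratio ^ suc (suc j) * (#marked N (suc j) * #tags N)  ≤⟨ *-monoʳ-≤ (ratio ^ suc (suc j)) (lengthened≤ N (suc j)) ⟩
  ratio ^ suc (suc j) * #marked (suc N) (suc (suc j)) ∎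
  where
  open ≤-Reasoning
  open +-*-Solver
  N : ℕ
  N = suc j + (2 + n)
  N≡ : N ≡ 2 + (suc j + n)
  N≡ = trans (+-suc (suc j) (suc n)) (cong suc (+-suc (suc j) n))

-- Both loops join neighbouring flags, so the faces are two monogons and a bigon. Curls turn this
-- example into one for every larger number of crossings.
figureEight : Code 4
figureEight = (d ∷v e ∷v f ∷v c ∷v []v) , (d ∷v c ∷v f ∷v e ∷v []v)
  where
  c d e f : Fin 4
  c = zero
  d = suc zero
  e = suc (suc zero)
  f = suc (suc (suc zero))

tags-positive : ∀ m → 1 ≤ length (tags m)
tags-positive m = length-⊆ {xs = t ∷ []} ([] ∷ []) (λ { (here refl) → ∈-tags t })
  where
  t : Tag m
  t = (zero , zero) , (zero , zero)

curves-positive : ∀ n → 1 ≤ #curves (suc n)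
curves-positive zero = length-⊆ {xs = figureEight ∷ []} ([] ∷ [])
  (λ { (here refl) → ∈-filterᵇ⁺ (isCurveᵇ 3 ∘ decode) (∈-codes figureEight) refl })
curves-positive (suc n) = positive (begin
  1                                    ≤⟨ *-mono-≤ {1} {_} {1} (*-mono-≤ {1} {_} {1} (curves-positive n) (s≤s z≤n)) (tags-positive (4 * suc n)) ⟩
  #corners (suc n) * #tags (suc n)                ≤⟨ monogonal≤ (suc n) ⟩
  #marked (2 + n) 1                          ≤⟨ marked≤ (4 * (2 + n)) (2 + n + 2) 1 ⟩
  #curves (2 + n) * (4 * (2 + n))            ∎)
  where
  open ≤-Reasoning
  positive : ∀ {a b} → 1 ≤ a * b → 1 ≤ a
  positive {suc a} _ = s≤s z≤n

labelledCurves-codes : ∀ n → labelledCurves n ≡ map decode (curves (4 * n) (n + 2))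
labelledCurves-codes n = trans (cong (filterᵇ (isPlaneCurve n)) (allPairs-codes (4 * n))) (filterᵇ-map (isPlaneCurve n) decode (codes (4 * n)))

curveCount≡ : ∀ n → curveCount n ≡ #curves n
curveCount≡ n = trans (cong length (labelledCurves-codes n)) (length-map decode (curves (4 * n) (n + 2)))

faceTotal≡ : ∀ n k → degreeKFaceTotal n k ≡ faceTotal (4 * n) (n + 2) k
faceTotal≡ n k = trans (cong (sum ∘ map (λ p → numCyclesOfLength k (στ (proj₁ p) (proj₂ p)))) (labelledCurves-codes n))
  (cong sum (sym (map-∘ (curves (4 * n) (n + 2)))))

-- A factor `ratio` is paid for each curl, and a face of degree `k` may be marked at each of its `k`
-- flags.
constant : ℕ → ℕ
constant k = ratio ^ k * k

many-faces : ∀ j n → let N = suc j + (2 + n) in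
             (N + 2) * curveCount N ≤ constant (suc j) * degreeKFaceTotal N (suc j)
many-faces j n = begin
  (N + 2) * curveCount N                   ≡⟨ cong ((N + 2) *_) (curveCount≡ N) ⟩
  (N + 2) * #curves N                            ≡⟨ *-comm (N + 2) (#curves N) ⟩
  #curves N * (N + 2)                            ≤⟨ *-monoʳ-≤ (#curves N) (small (j + (2 + n))) ⟩
  #corners N                                      ≤⟨ corners≤marked j n ⟩
  ratio ^ suc j * #marked N (suc j)              ≤⟨ *-monoʳ-≤ (ratio ^ suc j) (marked≤faces {4 * N} {N + 2} (suc j) (faces-eq N)) ⟩
  ratio ^ suc j * (suc j * faceTotal (4 * N) (N + 2) (suc j)) ≡⟨ *-assoc (ratio ^ suc j) (suc j) _ ⟨
  constant (suc j) * faceTotal (4 * N) (N + 2) (suc j)        ≡⟨ cong (constant (suc j) *_) (faceTotal≡ N (suc j)) ⟨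
  constant (suc j) * degreeKFaceTotal N (suc j) ∎
  where
  open ≤-Reasoning
  N : ℕ
  N = suc j + (2 + n)
  small : ∀ k → suc k + 2 ≤ 4 * suc k
  small k = begin
    suc k + 2               ≤⟨ +-monoʳ-≤ (suc k) {2} {3} (s≤s (s≤s z≤n)) ⟩
    suc k + 3               ≤⟨ +-monoʳ-≤ (suc k) (*-monoʳ-≤ 3 {1} {suc k} (s≤s z≤n)) ⟩
    suc k + 3 * suc k       ∎

two-degrees : ∀ n k → degreeKFaceTotal n k + degreeKFaceTotal n (suc k) ≤ (n + 2) * curveCount n
two-degrees n k = begin
  degreeKFaceTotal n k + degreeKFaceTotal n (suc k)     ≡⟨ cong₂ _+_ (faceTotal≡ n k) (faceTotal≡ n (suc k)) ⟩
  sum (map (a k) cs) + sum (map (a (suc k)) cs)         ≡⟨ sum-+ (a k) (a (suc k)) cs ⟨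
  sum (map (λ c → a k c + a (suc k) c) cs)              ≤⟨ sum-mono _ (λ _ → n + 2) cs (λ {c} i → ≤-trans (disjoint (φ c)) (≤-reflexive (faces i))) ⟩
  sum (map (λ _ → n + 2) cs)                            ≡⟨ sum-const (n + 2) cs ⟩
  #curves n * (n + 2)                                         ≡⟨ *-comm (#curves n) (n + 2) ⟩
  (n + 2) * #curves n                                         ≡⟨ cong ((n + 2) *_) (curveCount≡ n) ⟨
  (n + 2) * curveCount n                                ∎
  where
  open ≤-Reasoning
  cs : List (Code (4 * n))
  cs = curves (4 * n) (n + 2)
  φ : Code (4 * n) → Fin (4 * n) → Fin (4 * n)
  φ c = στ (proj₁ (decode c)) (proj₂ (decode c))
  a : ℕ → Code (4 * n) → ℕ
  a k c = numCyclesOfLength k (φ c)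
  faces : ∀ {c} → c ∈ cs → numCycles (φ c) ≡ n + 2
  faces {c} i = *-cancelˡ-≡ (numCycles (φ c)) (n + 2) 4 (trans (IsCurve.planar (∈-curves⁻ (faces-eq n) i)) (sym (faces-eq n)))
  disjoint : ∀ {m} (π : Fin m → Fin m) → numCyclesOfLength k π + numCyclesOfLength (suc k) π ≤ numCycles π
  disjoint {m} π = begin
    numCyclesOfLength k π + numCyclesOfLength (suc k) π
      ≡⟨ cong₂ _+_ (sum-indicator (q k) (allFin m)) (sum-indicator (q (suc k)) (allFin m)) ⟨
    sum (map (indicator ∘ q k) (allFin m)) + sum (map (indicator ∘ q (suc k)) (allFin m))
      ≡⟨ sum-+ (indicator ∘ q k) (indicator ∘ q (suc k)) (allFin m) ⟨
    sum (map (λ x → indicator (q k x) + indicator (q (suc k) x)) (allFin m))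
      ≤⟨ sum-mono _ (indicator ∘ isCycleRep π) (allFin m) (λ {x} _ → at (isCycleRep π x) (cycleLength π x) k) ⟩
    sum (map (indicator ∘ isCycleRep π) (allFin m))
      ≡⟨ sum-indicator (isCycleRep π) (allFin m) ⟩
    numCycles π ∎
    where
    q : ℕ → Fin m → Bool
    q k x = isCycleRep π x ∧ (cycleLength π x ≡ᵇ k)
    at : ∀ b l k → indicator (b ∧ (l ≡ᵇ k)) + indicator (b ∧ (l ≡ᵇ suc k)) ≤ indicator b
    at false l k = z≤n
    at true zero zero = ≤-refl
    at true zero (suc k) = z≤n
    at true (suc zero) zero = ≤-refl
    at true (suc (suc l)) zero = z≤n
    at true (suc l) (suc k) = at true l k

-- The limits

pnk-value : ∀ n k d → (n + 2) * curveCount n ≡ suc d → pnk n k ≡ fromℚᵘ (mkℚᵘ (ℤ.+ degreeKFaceTotal n k) d)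
pnk-value n k d eq with (n + 2) * curveCount n
pnk-value n k d refl | suc .d = refl

positive-denominator : ∀ n → n ≥ 1 → ∃ λ d → (n + 2) * curveCount n ≡ suc d
positive-denominator (suc n) _ = go ((suc n + 2) * curveCount (suc n))
  (*-mono-≤ {1} {suc n + 2} {1} (s≤s z≤n) (subst (1 ≤_) (sym (curveCount≡ (suc n))) (curves-positive n)))
  where
  go : ∀ k → 1 ≤ k → ∃ λ d → k ≡ suc d
  go (suc d) _ = d , refl

-- `mkℚᵘ` stores the denominator less one, so this is the reciprocal of `constant k + 1`, positive
-- for every `k`.
gap : ℕ → ℚ
gap k = fromℚᵘ (mkℚᵘ (ℤ.+ 1) (constant k))

gap-positive : ∀ k → 0ℚ ℚ.< gap k
gap-positive k = ℚₚ.toℚᵘ-cancel-< (ℚᵘₚ.<-≤-trans {ℚᵘ.0ℚᵘ} {mkℚᵘ (ℤ.+ 1) (constant k)}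
  (ℚᵘₚ.positive⁻¹ (mkℚᵘ (ℤ.+ 1) (constant k))) (ℚᵘₚ.≤-reflexive (ℚᵘₚ.≃-sym (ℚₚ.toℚᵘ-fromℚᵘ (mkℚᵘ (ℤ.+ 1) (constant k))))))

fromℚᵘ-mono : ∀ {p q} → p ℚᵘ.≤ q → fromℚᵘ p ℚ.≤ fromℚᵘ q
fromℚᵘ-mono {p} {q} le = ℚₚ.toℚᵘ-cancel-≤ (ℚᵘₚ.≤-trans (ℚᵘₚ.≤-reflexive (ℚₚ.toℚᵘ-fromℚᵘ p))
  (ℚᵘₚ.≤-trans le (ℚᵘₚ.≤-reflexive (ℚᵘₚ.≃-sym (ℚₚ.toℚᵘ-fromℚᵘ q)))))

lower : ∀ k n d → suc d ≤ constant k * degreeKFaceTotal n k → (n + 2) * curveCount n ≡ suc d → gap k ℚ.≤ pnk n k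
lower k n d le eq = subst (gap k ℚ.≤_) (sym (pnk-value n k d eq)) (fromℚᵘ-mono {mkℚᵘ (ℤ.+ 1) (constant k)} {mkℚᵘ (ℤ.+ t) d} (*≤*
  (subst₂ ℤ._≤_ (ℤₚ.pos-* 1 (suc d)) (ℤₚ.pos-* t (suc (constant k))) (+≤+ (begin
    1 * suc d              ≡⟨ *-identityˡ (suc d) ⟩
    suc d                  ≤⟨ le ⟩
    constant k * t         ≤⟨ *-monoˡ-≤ t (n≤1+n (constant k)) ⟩
    suc (constant k) * t   ≡⟨ *-comm (suc (constant k)) t ⟩
    t * suc (constant k)   ∎)))))
  where
  open ≤-Reasoning
  t : ℕ
  t = degreeKFaceTotal n k

upper : ∀ k n d → suc d ≤ constant (suc k) * degreeKFaceTotal n (suc k) → (n + 2) * curveCount n ≡ suc d →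
        pnk n k ℚ.≤ 1ℚ ℚ.- gap (suc k)
upper k n d le eq = subst (ℚ._≤ 1ℚ ℚ.- g) (sym (pnk-value n k d eq)) (subst (ℚ._≤ 1ℚ ℚ.- g) cancel (ℚₚ.+-monoˡ-≤ (ℚ.- g) sum≤1))
  where
  c t t′ : ℕ
  c = constant (suc k)
  t = degreeKFaceTotal n k
  t′ = degreeKFaceTotal n (suc k)
  p g : ℚ
  p = fromℚᵘ (mkℚᵘ (ℤ.+ t) d)
  g = gap (suc k)
  cancel : (p ℚ.+ g) ℚ.+ (ℚ.- g) ≡ p
  cancel = trans (ℚₚ.+-assoc p g (ℚ.- g)) (trans (cong (p ℚ.+_) (ℚₚ.+-inverseʳ g)) (ℚₚ.+-identityʳ p))
  nat : t * suc c + 1 * suc d ≤ 1 * (suc d * suc c)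
  nat = begin
    t * suc c + 1 * suc d      ≡⟨ cong (t * suc c +_) (*-identityˡ (suc d)) ⟩
    t * suc c + suc d          ≤⟨ +-monoʳ-≤ (t * suc c) (≤-trans le (≤-trans (*-monoˡ-≤ t′ (n≤1+n c)) (≤-reflexive (*-comm (suc c) t′)))) ⟩
    t * suc c + t′ * suc c     ≡⟨ *-distribʳ-+ (suc c) t t′ ⟨
    (t + t′) * suc c           ≤⟨ *-monoˡ-≤ (suc c) (≤-trans (two-degrees n k) (≤-reflexive eq)) ⟩
    suc d * suc c              ≡⟨ *-identityˡ _ ⟨
    1 * (suc d * suc c)        ∎
    where open ≤-Reasoning
  sum≤1 : p ℚ.+ g ℚ.≤ 1ℚ
  sum≤1 = ℚₚ.toℚᵘ-cancel-≤ (ℚᵘₚ.≤-trans (ℚᵘₚ.≤-reflexive (ℚᵘₚ.≃-trans (ℚₚ.toℚᵘ-homo-+ p g)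
      (ℚᵘₚ.+-cong (ℚₚ.toℚᵘ-fromℚᵘ (mkℚᵘ (ℤ.+ t) d)) (ℚₚ.toℚᵘ-fromℚᵘ (mkℚᵘ (ℤ.+ 1) c)))))
    (*≤* (subst₂ ℤ._≤_
      (trans (ℤₚ.pos-+ (t * suc c) (1 * suc d)) (trans (cong₂ ℤ._+_ (ℤₚ.pos-* t (suc c)) (ℤₚ.pos-* 1 (suc d))) (sym (ℤₚ.*-identityʳ _))))
      (ℤₚ.pos-* 1 (suc d * suc c)) (+≤+ nat))))

enough : ∀ j n → suc j + 2 ≤ n → ∀ d → (n + 2) * curveCount n ≡ suc d → suc d ≤ constant (suc j) * degreeKFaceTotal n (suc j)
enough j n le d eq = subst (_≤ constant (suc j) * degreeKFaceTotal n (suc j)) eq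
  (subst (λ N → (N + 2) * curveCount N ≤ constant (suc j) * degreeKFaceTotal N (suc j))
    (trans (sym (+-assoc (suc j) 2 _)) (m+[n∸m]≡n le)) (many-faces j (n ∸ (suc j + 2))))

-- A limsup below 1 means a fixed gap below 1 from some point on, and a liminf above 0 a fixed
-- positive lower bound from some point on. The middle inequality holds for every bounded sequence.
theorem5 : (k : ℕ) → k ≥ 1 →
    (∃[ ε ] (0ℚ ℚ.< ε × ∃[ N ] ((n : ℕ) → n ≥ N → n ≥ 1 → pnk n k ℚ.≤ 1ℚ ℚ.- ε)))
    × (∃[ ε ] (0ℚ ℚ.< ε × ∃[ N ] ((n : ℕ) → n ≥ N → n ≥ 1 → ε ℚ.≤ pnk n k)))
theorem5 (suc j) _ =
  -- With k = j + 1 the upper half rests on faces of degree j + 2. Each threshold is the degree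
  -- produced plus two: as many curls as the degree, starting from at least two crossings.
  (gap (2 + j) , gap-positive (2 + j) , 2 + j + 2 , λ n n≥N n≥1 →
    let (d , eq) = positive-denominator n n≥1 in upper (suc j) n d (enough (suc j) n n≥N d eq) eq) ,
  (gap (suc j) , gap-positive (suc j) , suc j + 2 , λ n n≥N n≥1 →
    let (d , eq) = positive-denominator n n≥1 in lower (suc j) n d (enough j n n≥N d eq) eq)
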